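{- Let $q\equiv 1\pmod 4$ be a prime power, let $\gamma$ be a primitive element of $\mathbb{F}_{q^2}$, and put $\delta=\gamma^{\frac{q+1}{2}}$. Let $Q(4,q)$ be the parabolic quadric, $A$ the group acting on its points, and $C_{\frac{q+1}{2}}^{(2(q+1),q^2)}\subset\mathbb{F}_{q^2}^*$ the coset that are defined in the context, and for a point $P$ of $Q(4,q)$ let $O(P)$ denote the $A$-orbit of $P$. Put $$S=\Big\{\big\langle\big(1,\,y,\,y^{ -1}(w-\tfrac12)\big)\big\rangle \;\Big|\; w\in C_{\frac{q+1}{2}}^{(2(q+1),q^2)},\ y\in\mathbb{F}_{q^2}^*\Big\}$$ and $$\mathcal{M}=O(0,0,1)\cup O(1,1,-\tfrac12)\cup O(0,1,\delta)\cup S.$$ Then $\mathcal{M}$ is a $\frac{q+1}{2}$-ovoid of $Q(4,q)$.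
   Context: Let $q\equiv 1\pmod 4$ be a prime power and let $\gamma$ be a fixed primitive element of $\mathbb{F}_{q^2}$ (a generator of $\mathbb{F}_{q^2}^*$). For a positive integer $e$ dividing $q^2-1$, let $C_0^{(e,q^2)}$ be the subgroup of index $e$ of $\mathbb{F}_{q^2}^*$ and let $C_i^{(e,q^2)}=\gamma^i C_0^{(e,q^2)}$ for $0\le i\le e-1$. Let $V=\mathbb{F}_q\times\mathbb{F}_{q^2}\times\mathbb{F}_{q^2}$, viewed as a 5-dimensional vector space over $\mathbb{F}_q$, and let $f(x,y,z)=x^2+\mathrm{Tr}_{q^2/q}(yz)$, where $\mathrm{Tr}_{q^2/q}(t)=t+t^q$ is the trace from $\mathbb{F}_{q^2}$ to $\mathbb{F}_q$; $f$ is a non-degenerate quadratic form on $V$. The projective space $\mathrm{PG}(4,q)$ is that of $V$; its points are the one-dimensional $\mathbb{F}_q$-subspaces $\langle (x,y,z)\rangle$, also written simply $(x,y,z)$. The points of the parabolic quadric $Q(4,q)$ are $$Q(4,q)=\{\langle (x,y,z)\rangle\mid 0\neq (x,y,z)\in V,\ f(x,y,z)=0\},$$ and the lines of $Q(4,q)$ are the lines of $\mathrm{PG}(4,q)$ all of whose points lie in this set. For a positive integer $m$, an $m$-ovoid of $Q(4,q)$ is a set of points of $Q(4,q)$ that meets every line of $Q(4,q)$ in exactly $m$ points. The group $A$ is the group of projective linear transformations of $\mathrm{PG}(4,q)$, preserving $Q(4,q)$, generated by the maps $T_u:(x,y,z)\mapsto (x,yu,zu^{ -1})$ for $u\in C_0^{(2,q^2)}$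 (the nonzero squares of $\mathbb{F}_{q^2}$), together with the two involutions $\sigma:(x,y,z)\mapsto (x,y^q,z^q)$ and $\tau:(x,y,z)\mapsto (x,z,y)$. -}

module Defs where

open import Level using (Level; _⊔_; suc)
open import Algebra.Bundles using (CommutativeRing)
open import Algebra.Morphism.Structures using (IsRingHomomorphism)
import Algebra.Properties.Semiring.Exp
open import Data.Empty using (⊥-elim)
open import Data.Fin.Base using (Fin)
import Data.Fin.Properties as Fin
import Data.Nat.Base as ℕ
open ℕ using (ℕ)
open import Data.Nat.DivMod using (_/_)
open import Data.Product.Base using (∃-syntax; _×_; _,_; proj₁; proj₂)
open import Data.Product.Relation.Binary.Pointwise.NonDependent using (×-setoid)
open import Function.Base using (_∘_; id)
open import Function.Bundles using (Inverse)
open import Function.Properties.Inverse using (Inverse⇒Injection)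
open import Relation.Binary.Bundles using (Setoid)
open import Relation.Binary.Definitions using (Decidable)
import Relation.Binary.Construct.On as On
open import Relation.Binary.PropositionalEquality using (_≡_)
import Relation.Binary.PropositionalEquality.Properties as ≡
import Relation.Binary.Reasoning.Setoid as SetoidReasoning
open import Relation.Nullary.Decidable using (yes; no; via-injection)
open import Relation.Nullary.Negation using (¬_)
open import Relation.Unary using (Pred; _∈_; _⊆_; _∩_; _∪_)

private variable
  c ℓ : Level

HasCardinality : Setoid c ℓ → ℕ → Set (c ⊔ ℓ)
HasCardinality S n = Inverse S (≡.setoid (Fin n))

-- The library's `HeytingField` carries an apartness relation that need not be
-- decidable, even when the carrier is finite; here "nonzero" is plain `_≉ 0#`.
record FiniteField (c ℓ : Level) (n : ℕ) : Set (suc (c ⊔ ℓ)) where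
  field
    commutativeRing : CommutativeRing c ℓ
  open CommutativeRing commutativeRing public
  field
    1≉0      : 1# ≉ 0#
    inverse  : ∀ x → x ≉ 0# → ∃[ y ] x * y ≈ 1#
    finite   : HasCardinality setoid n

  open Algebra.Properties.Semiring.Exp semiring public using (_^_)

  _≟_ : Decidable _≈_
  _≟_ = via-injection (Inverse⇒Injection finite) Fin._≟_

  -- Total, with the convention 0⁻¹ = 0.
  infix 9 _⁻¹
  _⁻¹ : Carrier → Carrier
  x ⁻¹ with x ≟ 0#
  ... | yes _   = 0#
  ... | no  x≉0 = proj₁ (inverse x x≉0)

  ⁻¹-inverseʳ : ∀ {x} → x ≉ 0# → x * x ⁻¹ ≈ 1#
  ⁻¹-inverseʳ {x} x≉0 with x ≟ 0#
  ... | yes x≈0  = ⊥-elim (x≉0 x≈0)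
  ... | no  x≉0′ = proj₂ (inverse x x≉0′)

  ⁻¹-inverseˡ : ∀ {x} → x ≉ 0# → x ⁻¹ * x ≈ 1#
  ⁻¹-inverseˡ x≉0 = trans (*-comm _ _) (⁻¹-inverseʳ x≉0)

  ½ : Carrier
  ½ = (1# + 1#) ⁻¹

  x*y≈0⇒y≈0 : ∀ {x y} → x ≉ 0# → x * y ≈ 0# → y ≈ 0#
  x*y≈0⇒y≈0 {x} {y} x≉0 xy≈0 = begin
    y               ≈⟨ *-identityˡ y ⟨
    1# * y          ≈⟨ *-congʳ (⁻¹-inverseˡ x≉0) ⟨
    x ⁻¹ * x * y    ≈⟨ *-assoc _ _ _ ⟩
    x ⁻¹ * (x * y)  ≈⟨ *-congˡ xy≈0 ⟩
    x ⁻¹ * 0#       ≈⟨ zeroʳ _ ⟩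
    0#              ∎
    where open SetoidReasoning setoid

  x⁻¹≉0 : ∀ {x} → x ≉ 0# → x ⁻¹ ≉ 0#
  x⁻¹≉0 x≉0 x⁻¹≈0 =
    1≉0 (trans (sym (⁻¹-inverseʳ x≉0)) (trans (*-congˡ x⁻¹≈0) (zeroʳ _)))

  *-≉0 : ∀ {x y} → x ≉ 0# → y ≉ 0# → x * y ≉ 0#
  *-≉0 x≉0 y≉0 = y≉0 ∘ x*y≈0⇒y≈0 x≉0

  x^n≈0⇒x≈0 : ∀ {x} n → x ^ n ≈ 0# → x ≈ 0#
  x^n≈0⇒x≈0     ℕ.zero    1≈0  = ⊥-elim (1≉0 1≈0)
  x^n≈0⇒x≈0 {x} (ℕ.suc n) eq with x ≟ 0#
  ... | yes x≈0 = x≈0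
  ... | no  x≉0 = x^n≈0⇒x≈0 n (x*y≈0⇒y≈0 x≉0 eq)

  IsPrimitive : Carrier → Set (c ⊔ ℓ)
  IsPrimitive γ = γ ≉ 0# × (∀ x → x ≉ 0# → ∃[ i ] x ≈ γ ^ i)

  coset : ∀ {a} → Carrier → Pred Carrier a → Pred Carrier (c ⊔ ℓ ⊔ a)
  coset r H x = ∃[ h ] h ∈ H × x ≈ r * h

  -- H is a subgroup, of index e, of the multiplicative group of nonzero elements:
  -- that group is the disjoint union of e cosets of H.
  record IsSubgroupOfIndex {a} (e : ℕ) (H : Pred Carrier a) : Set (c ⊔ ℓ ⊔ a) where
    field
      respects  : ∀ {x y} → x ≈ y → x ∈ H → y ∈ H
      nonzero   : ∀ {x} → x ∈ H → x ≉ 0#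
      1∈        : 1# ∈ H
      *-closed  : ∀ {x y} → x ∈ H → y ∈ H → x * y ∈ H
      ⁻¹-closed : ∀ {x} → x ∈ H → x ⁻¹ ∈ H
      rep       : Fin e → Carrier
      rep≉0     : ∀ i → rep i ≉ 0#
      cover     : ∀ {x} → x ≉ 0# → ∃[ i ] x ∈ coset (rep i) H
      disjoint  : ∀ {x} i j → x ∈ coset (rep i) H → x ∈ coset (rep j) H → i ≡ j

-- F plays the role of 𝔽_q and K that of 𝔽_{q²}, with ι the inclusion.
module Geometry
  {c₁ ℓ₁ c₂ ℓ₂ : Level} (q : ℕ)
  (F : FiniteField c₁ ℓ₁ q) (K : FiniteField c₂ ℓ₂ (q ℕ.^ 2))
  (ι : FiniteField.Carrier F → FiniteField.Carrier K)
  (ι-isRingHomomorphism : IsRingHomomorphism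
    (FiniteField.rawRing F) (FiniteField.rawRing K) ι)
  where

  private
    module F = FiniteField F
    module K = FiniteField K
    module ι = IsRingHomomorphism ι-isRingHomomorphism

  open K using (_^_)

  vectors : Setoid (c₁ ⊔ c₂) (ℓ₁ ⊔ ℓ₂)
  vectors = ×-setoid F.setoid (×-setoid K.setoid K.setoid)

  open Setoid vectors public using () renaming
    (Carrier to V; _≈_ to _≈ᵥ_; refl to ≈ᵥ-refl; sym to ≈ᵥ-sym; trans to ≈ᵥ-trans)

  0ᵥ : V
  0ᵥ = F.0# , K.0# , K.0#

  infixl 6 _+ᵥ_
  _+ᵥ_ : V → V → V
  (x , y , z) +ᵥ (x′ , y′ , z′) = x F.+ x′ , y K.+ y′ , z K.+ z′

  infixr 7 _·_
  _·_ : F.Carrier → V → V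
  a · (x , y , z) = a F.* x , ι a K.* y , ι a K.* z

  ·-cong : ∀ {a b v w} → a F.≈ b → v ≈ᵥ w → a · v ≈ᵥ b · w
  ·-cong a≈b (p , r , s) =
    F.*-cong a≈b p , K.*-cong (ι.⟦⟧-cong a≈b) r , K.*-cong (ι.⟦⟧-cong a≈b) s

  ·-identity : ∀ v → F.1# · v ≈ᵥ v
  ·-identity (x , y , z) =
    F.*-identityˡ x ,
    K.trans (K.*-congʳ ι.1#-homo) (K.*-identityˡ y) ,
    K.trans (K.*-congʳ ι.1#-homo) (K.*-identityˡ z)

  ·-assoc : ∀ a b v → (a F.* b) · v ≈ᵥ a · (b · v)
  ·-assoc a b (x , y , z) =
    F.*-assoc a b x ,
    K.trans (K.*-congʳ (ι.*-homo a b)) (K.*-assoc _ _ y) ,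
    K.trans (K.*-congʳ (ι.*-homo a b)) (K.*-assoc _ _ z)

  Tr : K.Carrier → K.Carrier
  Tr t = t K.+ t ^ q

  -- The values of f lie in the subfield ι F of K.
  f : V → K.Carrier
  f (x , y , z) = ι x ^ 2 K.+ Tr (y K.* z)

  record Point : Set (c₁ ⊔ c₂ ⊔ ℓ₁ ⊔ ℓ₂) where
    constructor ⟨_∣_⟩
    field
      vec   : V
      vec≉0 : ¬ vec ≈ᵥ 0ᵥ
  open Point public

  infix 4 _∼_
  _∼_ : Point → Point → Set (c₁ ⊔ ℓ₁ ⊔ ℓ₂)
  P ∼ R = ∃[ a ] a F.≉ F.0# × vec P ≈ᵥ a · vec R

  ∼-refl : ∀ {P} → P ∼ P
  ∼-refl {P} = F.1# , F.1≉0 , ≈ᵥ-sym (·-identity (vec P))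

  ∼-sym : ∀ {P R} → P ∼ R → R ∼ P
  ∼-sym {P} {R} (a , a≉0 , P≈aR) = a F.⁻¹ , F.x⁻¹≉0 a≉0 , (begin
    vec R                      ≈⟨ ·-identity (vec R) ⟨
    F.1# · vec R               ≈⟨ ·-cong (F.⁻¹-inverseˡ a≉0) ≈ᵥ-refl ⟨
    ((a F.⁻¹) F.* a) · vec R   ≈⟨ ·-assoc _ a (vec R) ⟩
    (a F.⁻¹) · (a · vec R)     ≈⟨ ·-cong F.refl P≈aR ⟨
    (a F.⁻¹) · vec P           ∎)
    where open SetoidReasoning vectors

  ∼-trans : ∀ {P R S} → P ∼ R → R ∼ S → P ∼ S
  ∼-trans {P} {R} {S} (a , a≉0 , P≈aR) (b , b≉0 , R≈bS) =
    a F.* b , F.*-≉0 a≉0 b≉0 , (begin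
      vec P               ≈⟨ P≈aR ⟩
      a · vec R           ≈⟨ ·-cong F.refl R≈bS ⟩
      a · (b · vec S)     ≈⟨ ·-assoc a b (vec S) ⟨
      (a F.* b) · vec S   ∎)
    where open SetoidReasoning vectors

  PG : Setoid (c₁ ⊔ c₂ ⊔ ℓ₁ ⊔ ℓ₂) (c₁ ⊔ ℓ₁ ⊔ ℓ₂)
  PG = record
    { Carrier       = Point
    ; _≈_           = _∼_
    ; isEquivalence = record
      { refl  = λ {P} → ∼-refl {P}
      ; sym   = λ {P R} → ∼-sym {P} {R}
      ; trans = λ {P R S} → ∼-trans {P} {R} {S}
      }
    }

  Q4 : Pred Point ℓ₂
  Q4 P = f (vec P) K.≈ K.0#

  record Line : Set (c₁ ⊔ c₂ ⊔ ℓ₁ ⊔ ℓ₂) where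
    field
      P R : Point
      P≁R : ¬ P ∼ R

  pointsOf : Line → Pred Point (c₁ ⊔ ℓ₁ ⊔ ℓ₂)
  pointsOf l X = ∃[ a ] ∃[ b ] vec X ≈ᵥ a · vec P +ᵥ b · vec R
    where open Line l

  IsQ4Line : Line → Set (c₁ ⊔ c₂ ⊔ ℓ₁ ⊔ ℓ₂)
  IsQ4Line l = pointsOf l ⊆ Q4

  restrict : ∀ {a} → Pred Point a → Setoid (c₁ ⊔ c₂ ⊔ ℓ₁ ⊔ ℓ₂ ⊔ a) (c₁ ⊔ ℓ₁ ⊔ ℓ₂)
  restrict M = On.setoid PG (proj₁ {B = M})

  record IsOvoid {a} (m : ℕ) (M : Pred Point a) : Set (c₁ ⊔ c₂ ⊔ ℓ₁ ⊔ ℓ₂ ⊔ a) where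
    field
      positive : 0 ℕ.< m
      respects : ∀ {P R} → P ∼ R → P ∈ M → R ∈ M
      onQ4     : M ⊆ Q4
      meets    : ∀ l → IsQ4Line l → HasCardinality (restrict (pointsOf l ∩ M)) m

  σ : Point → Point
  σ ⟨ (x , y , z) ∣ nz ⟩ = ⟨ (x , y ^ q , z ^ q) ∣
    (λ (p , r , s) → nz (p , K.x^n≈0⇒x≈0 q r , K.x^n≈0⇒x≈0 q s)) ⟩

  τ : Point → Point
  τ ⟨ (x , y , z) ∣ nz ⟩ = ⟨ (x , z , y) ∣ (λ (p , r , s) → nz (p , s , r)) ⟩

  T : (u : K.Carrier) → u K.≉ K.0# → Point → Point
  T u u≉0 ⟨ (x , y , z) ∣ nz ⟩ = ⟨ (x , y K.* u , z K.* u K.⁻¹) ∣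
    (λ (p , r , s) → nz
      ( p
      , K.x*y≈0⇒y≈0 u≉0 (K.trans (K.*-comm u y) r)
      , K.x*y≈0⇒y≈0 (K.x⁻¹≉0 u≉0) (K.trans (K.*-comm (u K.⁻¹) z) s))) ⟩

  -- C₀ e stands for the subgroup of index e of the multiplicative group of K.
  module Construction
    {a : Level} (γ : K.Carrier) (C₀ : ℕ → Pred K.Carrier a) where

    C : (e i : ℕ) → Pred K.Carrier (c₂ ⊔ ℓ₂ ⊔ a)
    C e i = K.coset (γ ^ i) (C₀ e)

    -- Transformations of PG(4,q) are functions on point representatives, compared
    -- pointwise by _∼_; in particular inv-A asks for an inverse up to _∼_.
    data A : (Point → Point) → Set (c₁ ⊔ c₂ ⊔ ℓ₁ ⊔ ℓ₂ ⊔ a) where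
      T-gen   : ∀ u (u≉0 : u K.≉ K.0#) → u ∈ C₀ 2 → A (T u u≉0)
      σ-gen   : A σ
      τ-gen   : A τ
      id-A    : A id
      ∘-A     : ∀ {g h} → A g → A h → A (g ∘ h)
      inv-A   : ∀ {g h} → A g → (∀ P → h (g P) ∼ P) → (∀ P → g (h P) ∼ P) → A h

    O : Point → Pred Point (c₁ ⊔ c₂ ⊔ ℓ₁ ⊔ ℓ₂ ⊔ a)
    O P R = ∃[ g ] A g × R ∼ g P

    δ : K.Carrier
    δ = γ ^ (ℕ.suc q / 2)

    S : Pred Point (c₁ ⊔ c₂ ⊔ ℓ₁ ⊔ ℓ₂ ⊔ a)
    S P = ∃[ w ] ∃[ y ] w ∈ C (2 ℕ.* ℕ.suc q) (ℕ.suc q / 2) × y K.≉ K.0# ×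
      P ∼ ⟨ (F.1# , y , y K.⁻¹ K.* (w K.- K.½)) ∣ F.1≉0 ∘ proj₁ ⟩

    ℳ : Pred Point (c₁ ⊔ c₂ ⊔ ℓ₁ ⊔ ℓ₂ ⊔ a)
    ℳ = O ⟨ (F.0# , K.0# , K.1#) ∣ (λ (_ , _ , s) → K.1≉0 s) ⟩
      ∪ O ⟨ (F.1# , K.1# , K.- K.½) ∣ F.1≉0 ∘ proj₁ ⟩
      ∪ O ⟨ (F.0# , K.1# , δ) ∣ (λ (_ , r , _) → K.1≉0 r) ⟩
      ∪ S

{-# OPTIONS --safe #-}
module Submission where

-- Put g (x , y , z) = yz + x²/2. Then f = g + g^q, so on Q(4,q) the values of g lie
-- in δF. The set ℳ consists of the points of Q(4,q) where g lies in δ times the nonzero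
-- squares of F (these are O(0,1,δ) ∪ S) and of the points where g = 0 and each of y, z
-- is 0 or a square of K (the other two orbits). On a line of Q(4,q), g is δ times a
-- binary quadratic form over F which, unless it vanishes, is nondegenerate. In a basis of
-- the line that is isotropic (hyperbolic case) or orthogonal (anisotropic case), and for
-- a suitable nonsquare μ of F, the map (s , t) ↦ (μt , s) multiplies g by a nonsquare
-- (-1 is a square because q ≡ 1 mod 4), and it exchanges the two zeros of g, exactly one
-- of which is in ℳ. If g vanishes on the line, then all y or all z coordinates vanish, and
-- multiplication by the nonsquare δ is such a map. In each case ℳ and its complement are
-- exchanged, so ℳ contains half of the q + 1 points.

open import Defs
open import Algebra.Bundles using (AbelianGroup; CommutativeSemiring; CommutativeRing; RawRing)
open import Algebra.Morphism.Structures using (IsRingHomomorphism)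
import Algebra.Properties.CommutativeMonoid.Sum
import Algebra.Properties.CommutativeSemiring.Binomial
import Algebra.Properties.CommutativeSemiring.Exp
import Algebra.Properties.Group
import Algebra.Properties.Monoid.Mult
import Algebra.Properties.Ring
import Algebra.Properties.Semiring.Exp
import Algebra.Properties.Semiring.Mult
import Algebra.Solver.CommutativeMonoid
import Algebra.Solver.Ring
import Algebra.Solver.Ring.AlmostCommutativeRing as ACR
open import Data.Empty using (⊥; ⊥-elim)
open import Data.Fin.Base using (Fin; zero; suc; punchOut; toℕ; fromℕ; inject₁; fromℕ<)
import Data.Fin.Permutation as Perm
import Data.Fin.Properties as Fin
open import Data.Maybe.Base using (Maybe; just; nothing)
import Data.Nat.Base as ℕ
open ℕ using (ℕ; zero; suc; _∸_; _!; z<s; s<s)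
open import Data.Nat.Combinatorics using (_C_; nCn≡1; k![n∸k]!∣n!; nCk≡n!/k![n-k]!)
open import Data.Nat.Divisibility using (_∣_; divides; ∣⇒≤; m∣m*n; n∣m*n; *-cancelʳ-∣)
open import Data.Nat.DivMod using (_/_; _%_; m/n*n≡m; m*n/n≡m; m≡m%n+[m/n]*n; m%n<n)
open import Data.Nat.Primality using (Prime; prime⇒nonZero; prime⇒nonTrivial; euclidsLemma)
import Data.Nat.Properties as ℕ
import Data.Nat.Solver
open import Data.Product.Base using (∃-syntax; ∃₂; _×_; _,_; proj₁; proj₂)
open import Data.Product.Function.NonDependent.Setoid using (_×-inverse_)
open import Data.Product.Relation.Binary.Pointwise.NonDependent using (×-setoid)
open import Data.Sum.Base as Sum using (_⊎_; inj₁; inj₂; [_,_])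
open import Function.Base using (_∘_; id)
open import Function.Bundles using (Inverse)
import Function.Construct.Composition as Compose
open import Function.Definitions using (Injective; Congruent)
open import Level using (Level; _⊔_)
open import Relation.Binary.Bundles using (Setoid)
import Relation.Binary.Construct.On as On
open import Relation.Binary.Definitions using (_Respects_)
open import Relation.Binary.PropositionalEquality as ≡ using (_≡_)
import Relation.Binary.PropositionalEquality.Properties as ≡
import Relation.Binary.Reasoning.Setoid as SetoidReasoning
open import Relation.Nullary.Decidable using (Dec; yes; no; _×-dec_; _⊎-dec_; ¬?)
open import Relation.Nullary.Negation using (¬_)
open import Relation.Unary using (Pred; Decidable; _∈_; _⊆_; _∩_; ∁)

-- Finite sets

-- Two facts about squares of K govern the zeros of g. Every element of F is a square of K, so
-- scaling a vector preserves the square classes of y and z. Every nonzero element of δF is a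
-- nonsquare of K: its power q - 1 is -1, and (q + 1)/2 is odd, a second use of q ≡ 1 mod 4. If v
-- and w are zeros of g, substituting yz = -x²/2 shows that the polar form B v w, multiplied by a
-- nonzero y or z coordinate of each vector, is a square. As B v w lies in δF, those two coordinates
-- have different classes unless B v w = 0. A similar substitution excludes lines on which g has
-- rank one. The coset in the definition of S is δ times the nonzero squares of F, because these
-- squares form the subgroup of index 2(q + 1) of the cyclic group of K. This subgroup and the
-- squares of K are given only by their index, so they are first identified with the solutions of
-- x^((q-1)/2) = 1 and x^((q²-1)/2) = 1; membership then becomes an equation between powers, which
-- is decidable and multiplicative.

private variable
  a b ℓ ℓ′ p p′ : Level
  m n : ℕ

mkInverse : (S : Setoid a ℓ) (T : Setoid b ℓ′) →
  (to : Setoid.Carrier S → Setoid.Carrier T) (from : Setoid.Carrier T → Setoid.Carrier S) →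
  Congruent (Setoid._≈_ S) (Setoid._≈_ T) to → Congruent (Setoid._≈_ T) (Setoid._≈_ S) from →
  (∀ y → Setoid._≈_ T (to (from y)) y) → (∀ x → Setoid._≈_ S (from (to x)) x) → Inverse S T
mkInverse S T to from to-cong from-cong to∘from from∘to = record
  { to = to ; from = from ; to-cong = to-cong ; from-cong = from-cong
  ; inverse = (λ y≈ → Setoid.trans T (to-cong y≈) (to∘from _))
            , (λ x≈ → Setoid.trans S (from-cong x≈) (from∘to _)) }

cardinality-via : {S : Setoid a ℓ} {T : Setoid b ℓ′} → Inverse S T → HasCardinality T n → HasCardinality S n
cardinality-via = Compose.inverse

injective⇒cardinality-≤ : {S : Setoid a ℓ} {T : Setoid b ℓ′} → HasCardinality S m → HasCardinality T n →
  (f : Setoid.Carrier S → Setoid.Carrier T) → Injective (Setoid._≈_ S) (Setoid._≈_ T) f → m ℕ.≤ n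
injective⇒cardinality-≤ {S = S} {T} cS cT f f-injective = Fin.injective⇒≤ {f = cT.to ∘ f ∘ cS.from}
    λ {i} {j} eq →
  ≡.trans (≡.sym (cS.inverseˡ S.refl))
    (≡.trans (cS.to-cong (f-injective (T.trans (T.sym (cT.inverseʳ ≡.refl)) (cT.inverseʳ eq))))
        (cS.inverseˡ S.refl))
  where
  module S = Setoid S
  module T = Setoid T
  module cS = Inverse cS
  module cT = Inverse cT

cardinality-unique : {S : Setoid a ℓ} → HasCardinality S m → HasCardinality S n → m ≡ n
cardinality-unique c c′ = ℕ.≤-antisym (injective⇒cardinality-≤ c c′ id id) (injective⇒cardinality-≤ c′ c id id)

-- If j were missed, punching it out would leave an injection into a smaller set.
Fin-injective⇒surjective : (f : Fin n → Fin n) → Injective _≡_ _≡_ f → ∀ j → ∃[ i ] f i ≡ j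
Fin-injective⇒surjective {suc n} f f-injective j with Fin.any? (λ i → f i Fin.≟ j)
... | yes hit  = hit
... | no  miss = ⊥-elim (Fin.<⇒notInjective
  {f = λ i → punchOut (j≢f i)} (ℕ.n<1+n n) (λ eq → f-injective (Fin.punchOut-injective (j≢f _) (j≢f _) eq)))
  where
  j≢f : ∀ i → ¬ j ≡ f i
  j≢f i eq = miss (i , ≡.sym eq)

injective⇒surjective : {S : Setoid a ℓ} {T : Setoid b ℓ′} → HasCardinality S n → HasCardinality T n →
  (f : Setoid.Carrier S → Setoid.Carrier T) → Injective (Setoid._≈_ S) (Setoid._≈_ T) f →
  ∀ y → ∃[ x ] Setoid._≈_ T (f x) y
injective⇒surjective {S = S} {T} cS cT f f-injective y =
  let i , eq = Fin-injective⇒surjective (cT.to ∘ f ∘ cS.from) injective (cT.to y)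
  in cS.from i , T.trans (T.sym (cT.inverseʳ ≡.refl)) (cT.inverseʳ eq)
  where
  module S = Setoid S
  module T = Setoid T
  module cS = Inverse cS
  module cT = Inverse cT
  injective : Injective _≡_ _≡_ (cT.to ∘ f ∘ cS.from)
  injective eq = ≡.trans (≡.sym (cS.inverseˡ S.refl))
    (≡.trans (cS.to-cong (f-injective (T.trans (T.sym (cT.inverseʳ ≡.refl)) (cT.inverseʳ eq))))
        (cS.inverseˡ S.refl))

cardinality-× : {S : Setoid a ℓ} {T : Setoid b ℓ′} → HasCardinality S m → HasCardinality T n →
  HasCardinality (×-setoid S T) (m ℕ.* n)
cardinality-× cS cT = Compose.inverse (cS ×-inverse cT)
  (mkInverse _ (≡.setoid _) (λ (i , j) → Fin*.from (i , j)) Fin*.to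
    (λ (p , q) → ≡.cong₂ (λ i j → Fin*.from (i , j)) p q) (λ { ≡.refl → ≡.refl , ≡.refl })
    Fin*.strictlyInverseʳ (λ x → ,-injective (Fin*.strictlyInverseˡ x)))
  where
  module Fin* = Inverse (Fin.*↔×)
  ,-injective : ∀ {A : Set a} {B : Set b} {x y : A × B} → x ≡ y → proj₁ x ≡ proj₁ y × proj₂ x ≡ proj₂ y
  ,-injective ≡.refl = ≡.refl , ≡.refl

Sub : (S : Setoid a ℓ) → Pred (Setoid.Carrier S) p → Setoid (a ⊔ p) ℓ
Sub S P = On.setoid S (proj₁ {B = P})

Sub-cong : (S : Setoid a ℓ) {P : Pred (Setoid.Carrier S) p} {R : Pred (Setoid.Carrier S) p′} → P ⊆ R → R ⊆ P →
  Inverse (Sub S P) (Sub S R)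
Sub-cong S P⊆R R⊆P = mkInverse _ _ (λ (x , px) → x , P⊆R px) (λ (x , rx) → x , R⊆P rx) id id
  (λ _ → Setoid.refl S) (λ _ → Setoid.refl S)

Sub-∩ : (S : Setoid a ℓ) {P : Pred (Setoid.Carrier S) p} {R : Pred (Setoid.Carrier S) p′} →
  Inverse (Sub S (P ∩ R)) (Sub (Sub S P) (λ x → R (proj₁ x)))
Sub-∩ S = mkInverse _ _ (λ (x , px , rx) → (x , px) , rx) (λ ((x , px) , rx) → x , px , rx) id id
  (λ _ → Setoid.refl S) (λ _ → Setoid.refl S)

module _ {P : Pred (Fin (suc n)) p} where

  private
    SubFin : ∀ {n} → Pred (Fin n) p → Setoid p _
    SubFin = Sub (≡.setoid (Fin _))

  Sub-suc-∈ : P zero → HasCardinality (SubFin (P ∘ suc)) m → HasCardinality (SubFin P) (suc m)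
  Sub-suc-∈ {m = m} P0 c = mkInverse _ (≡.setoid _) to from to-cong (λ { ≡.refl → ≡.refl }) to∘from from∘to
    where
    module c = Inverse c
    to : ∃[ i ] P i → Fin (suc m)
    to (zero  , _) = zero
    to (suc i , d) = suc (c.to (i , d))
    from : Fin (suc m) → ∃[ i ] P i
    from zero    = zero , P0
    from (suc j) = suc (proj₁ (c.from j)) , proj₂ (c.from j)
    to-cong : ∀ {x y} → proj₁ x ≡ proj₁ y → to x ≡ to y
    to-cong {zero  , _} {zero  , _} ≡.refl = ≡.refl
    to-cong {suc _ , _} {suc _ , _} ≡.refl = ≡.cong suc (c.to-cong ≡.refl)
    to∘from : ∀ j → to (from j) ≡ j
    to∘from zero    = ≡.refl
    to∘from (suc j) = ≡.cong suc (c.inverseˡ ≡.refl)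
    from∘to : ∀ x → proj₁ (from (to x)) ≡ proj₁ x
    from∘to (zero  , _) = ≡.refl
    from∘to (suc i , _) = ≡.cong suc (c.inverseʳ ≡.refl)

  Sub-suc-∉ : ¬ P zero → HasCardinality (SubFin (P ∘ suc)) m → HasCardinality (SubFin P) m
  Sub-suc-∉ ¬P0 c = Compose.inverse
    (mkInverse _ (SubFin (P ∘ suc)) to (λ (i , d) → suc i , d) (λ {x} {y} → to-cong {x} {y}) (≡.cong suc)
        (λ _ → ≡.refl) from∘to) c
    where
    to : ∃[ i ] P i → ∃[ i ] P (suc i)
    to (zero  , d) = ⊥-elim (¬P0 d)
    to (suc i , d) = i , d
    to-cong : ∀ {x y} → proj₁ x ≡ proj₁ y → proj₁ (to x) ≡ proj₁ (to y)
    to-cong {zero  , d} ≡.refl = ⊥-elim (¬P0 d)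
    to-cong {suc _ , _} {suc _ , _} ≡.refl = ≡.refl
    from∘to : ∀ x → suc (proj₁ (to x)) ≡ proj₁ x
    from∘to (zero  , d) = ⊥-elim (¬P0 d)
    from∘to (suc i , d) = ≡.refl

Fin-split : {P : Pred (Fin n) p} → Decidable P → ∃₂ λ m m′ → m ℕ.+ m′ ≡ n ×
  HasCardinality (Sub (≡.setoid (Fin n)) P) m × HasCardinality (Sub (≡.setoid (Fin n)) (∁ P)) m′
Fin-split {n = zero} P? = 0 , 0 , ≡.refl , empty , empty
  where
  empty : ∀ {p′} {R : Pred (Fin 0) p′} → HasCardinality (Sub (≡.setoid (Fin 0)) R) 0
  empty = mkInverse _ (≡.setoid _) proj₁ (λ ()) id (λ { {()} }) (λ ()) (λ { (() , _) })
Fin-split {n = suc n} {P = P} P? with P? zero | Fin-split {P = P ∘ suc} (P? ∘ suc)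
... | yes P0 | m , m′ , eq , c , c′ =
  suc m , m′ , ≡.cong suc eq , Sub-suc-∈ {P = P} P0 c , Sub-suc-∉ {P = ∁ P} (λ ¬P0 → ¬P0 P0) c′
... | no ¬P0 | m , m′ , eq , c , c′ =
  m , suc m′ , ≡.trans (ℕ.+-suc m m′) (≡.cong suc eq) , Sub-suc-∉ {P = P} ¬P0 c , Sub-suc-∈ {P = ∁ P} ¬P0 c′

Sub-via : (S : Setoid a ℓ) {P : Pred (Setoid.Carrier S) p} → P Respects (Setoid._≈_ S) →
  (c : HasCardinality S n) → Inverse (Sub S P) (Sub (≡.setoid (Fin n)) (P ∘ Inverse.from c))
Sub-via S P-respects c = mkInverse _ _ (λ (x , d) → c.to x , P-respects (S.sym (c.inverseʳ ≡.refl)) d)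
  (λ (i , d) → c.from i , d) c.to-cong c.from-cong (λ _ → c.inverseˡ S.refl) (λ _ → c.inverseʳ ≡.refl)
  where
  module c = Inverse c
  module S = Setoid S

split : (S : Setoid a ℓ) {P : Pred (Setoid.Carrier S) p} → P Respects (Setoid._≈_ S) → Decidable P →
  HasCardinality S n → ∃₂ λ m m′ → m ℕ.+ m′ ≡ n × HasCardinality (Sub S P) m × HasCardinality (Sub S (∁ P)) m′
split S {P = P} P-respects P? c =
  let m , m′ , eq , cP , c∁P = Fin-split {P = P ∘ Inverse.from c} (P? ∘ Inverse.from c) in
  m , m′ , eq , cardinality-via (Sub-via S P-respects c) cP ,
  cardinality-via (Sub-via S (λ x≈y ¬Px Py → ¬Px (P-respects (Setoid.sym S x≈y) Py)) c) c∁P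

-- Injectivity of φ gives inequalities both ways between the sizes of P and its complement, so no
-- inverse of φ has to be constructed.
half : (S : Setoid a ℓ) {P : Pred (Setoid.Carrier S) p} → P Respects (Setoid._≈_ S) → Decidable P →
  HasCardinality S (2 ℕ.* n) →
  (φ : Setoid.Carrier S → Setoid.Carrier S) → Injective (Setoid._≈_ S) (Setoid._≈_ S) φ →
  (∀ x → P x → ¬ P (φ x)) → (∀ x → ¬ P x → P (φ x)) → HasCardinality (Sub S P) n
half {n = n} S {P} P-respects P? c φ φ-injective P⇒¬Pφ ¬P⇒Pφ
  with m , m′ , eq , cP , c∁P ← split S P-respects P? c =
  ≡.subst (HasCardinality (Sub S P)) (ℕ.*-cancelˡ-≡ m n 2 2m≡2n) cP
  where
  m≡m′ : m ≡ m′
  m≡m′ = ℕ.≤-antisym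
    (injective⇒cardinality-≤ cP c∁P (λ (x , d) → φ x , P⇒¬Pφ x d) φ-injective)
    (injective⇒cardinality-≤ c∁P cP (λ (x , d) → φ x , ¬P⇒Pφ x d) φ-injective)
  2m≡2n : 2 ℕ.* m ≡ 2 ℕ.* n
  2m≡2n = ≡.trans (≡.cong (m ℕ.+_) (≡.trans (ℕ.+-identityʳ m) m≡m′)) eq

cardinality-remove : (S : Setoid a ℓ) (s : Setoid.Carrier S) → Decidable (λ x → Setoid._≈_ S x s) →
  HasCardinality S (suc n) → HasCardinality (Sub S (λ x → ¬ Setoid._≈_ S x s)) n
cardinality-remove S s s? c with split S (λ x≈y x≈s → Setoid.trans S (Setoid.sym S x≈y) x≈s) s? c
... | m , m′ , eq , cP , c∁P with cardinality-unique cP single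
  where
  single : HasCardinality (Sub S (λ x → Setoid._≈_ S x s)) 1
  single = mkInverse _ (≡.setoid _) (λ _ → zero) (λ _ → s , Setoid.refl S) (λ _ → ≡.refl) (λ _ → Setoid.refl S)
    (λ { zero → ≡.refl }) (λ (x , x≈s) → Setoid.sym S x≈s)
... | ≡.refl with ≡.refl ← eq = c∁P

-- Finite groups, binomial coefficients and the Frobenius map

-- Translation by x permutes the group; comparing the sum of all elements with the sum of all
-- translates leaves n copies of x. It serves the additive group, for the characteristic, and the
-- units, for Fermat's theorem.
lagrange : (G : AbelianGroup a ℓ) → HasCardinality (AbelianGroup.setoid G) n → ∀ x →
  AbelianGroup._≈_ G (Algebra.Properties.Monoid.Mult._×_ (AbelianGroup.monoid G) n x) (AbelianGroup.ε G)
lagrange {n = n} G c x = identityˡ-unique (n ×· x) (sum c.from) (sym (begin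
  sum c.from                         ≈⟨ sum-permute c.from π ⟩
  sum (λ i → c.from (Perm._⟨$⟩ʳ_ π i)) ≈⟨ sum-cong-≋ {n} (λ _ → c.inverseʳ ≡.refl) ⟩
  sum (λ i → x ∙ c.from i)           ≈⟨ ∑-distrib-+ (λ _ → x) c.from ⟩
  sum {n} (λ _ → x) ∙ sum c.from     ≈⟨ ∙-congʳ (sum-replicate n) ⟩
  (n ×· x) ∙ sum c.from              ∎))
  where
  open AbelianGroup G
  module c = Inverse c
  open Algebra.Properties.CommutativeMonoid.Sum commutativeMonoid
  open Algebra.Properties.Monoid.Mult monoid renaming (_×_ to _×·_)
  open Algebra.Properties.Group group using (identityˡ-unique; \\-leftDividesˡ; \\-leftDividesʳ)
  open SetoidReasoning setoid
  π : Perm.Permutation n n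
  π = Perm.permutation (λ i → c.to (x ∙ c.from i)) (λ i → c.to (x ⁻¹ ∙ c.from i))
    (λ i → ≡.trans (c.to-cong (trans (∙-congˡ (c.inverseʳ ≡.refl)) (\\-leftDividesˡ x _))) (c.inverseˡ refl))
    (λ i → ≡.trans (c.to-cong (trans (∙-congˡ (c.inverseʳ ≡.refl)) (\\-leftDividesʳ x _))) (c.inverseˡ refl))

prime∤! : ∀ {p} → Prime p → ∀ k → k ℕ.< p → ¬ p ∣ k !
prime∤! pr zero    _    p∣1 = ℕ.≤⇒≯ (∣⇒≤ p∣1) (ℕ.nonTrivial⇒n>1 _ {{prime⇒nonTrivial pr}})
prime∤! pr (suc k) k<p p∣k! with euclidsLemma (suc k) (k !) pr p∣k!
... | inj₁ p∣k = ℕ.<⇒≱ k<p (∣⇒≤ p∣k)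
... | inj₂ p∣k!′ = prime∤! pr k (ℕ.<-trans (ℕ.n<1+n k) k<p) p∣k!′

-- p divides p! = C · k! · (p - k)! but neither of the factorials.
prime∣C : ∀ {p} → Prime p → ∀ {k} → 0 ℕ.< k → k ℕ.< p → p ∣ p C k
prime∣C {p} pr {k} 0<k k<p with euclidsLemma (p C k) (k ! ℕ.* (p ∸ k) !) pr p∣product
  where
  instance
    _ = (ℕ.m*n≢0 (k !) ((p ∸ k) !) {{k ℕ.!≢0}} {{(p ∸ k) ℕ.!≢0}})
    _ = prime⇒nonZero pr
  p∣p! : ∀ {p} → .{{ℕ.NonZero p}} → p ∣ p !
  p∣p! {suc p} = m∣m*n (p !)
  p∣product : p ∣ (p C k) ℕ.* (k ! ℕ.* (p ∸ k) !)
  p∣product = ≡.subst (p ∣_)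
    (≡.sym (≡.trans (≡.cong (ℕ._* (k ! ℕ.* (p ∸ k) !)) (nCk≡n!/k![n-k]! (ℕ.<⇒≤ k<p)))
        (m/n*n≡m (k![n∸k]!∣n! (ℕ.<⇒≤ k<p)))))
    p∣p!
... | inj₁ p∣C = p∣C
... | inj₂ p∣k![p-k]! with euclidsLemma (k !) ((p ∸ k) !) pr p∣k![p-k]!
... | inj₁ p∣k! = ⊥-elim (prime∤! pr k k<p p∣k!)
... | inj₂ p∣[p-k]! = ⊥-elim (prime∤! pr (p ∸ k) (ℕ.∸-monoʳ-< 0<k (ℕ.<⇒≤ k<p)) p∣[p-k]!)

module Frobenius (R : CommutativeSemiring a ℓ) where

  open CommutativeSemiring R hiding (zero)
  open Algebra.Properties.Semiring.Exp semiring
  open Algebra.Properties.Semiring.Mult semiring renaming (_×_ to _×·_)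
  open Algebra.Properties.CommutativeSemiring.Binomial R
  open Algebra.Properties.CommutativeMonoid.Sum +-commutativeMonoid
  open SetoidReasoning setoid

  module _ {p : ℕ} (pr : Prime p) (p≈0 : p ×· 1# ≈ 0#) where

    p∣n⇒n×x≈0 : ∀ {n} x → p ∣ n → n ×· x ≈ 0#
    p∣n⇒n×x≈0 x (divides m ≡.refl) = begin
      (m ℕ.* p) ×· x        ≈⟨ ×-congʳ (m ℕ.* p) (*-identityˡ x) ⟨
      (m ℕ.* p) ×· (1# * x) ≈⟨ ×-assoc-* (m ℕ.* p) 1# x ⟨
      ((m ℕ.* p) ×· 1#) * x ≈⟨ *-congʳ (×1-homo-* m p) ⟩
      ((m ×· 1#) * (p ×· 1#)) * x ≈⟨ *-congʳ (*-congˡ p≈0) ⟩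
      ((m ×· 1#) * 0#) * x  ≈⟨ *-congʳ (zeroʳ _) ⟩
      0# * x                ≈⟨ zeroˡ x ⟩
      0#                    ∎

    ^p-+ : ∀ x y → (x + y) ^ p ≈ x ^ p + y ^ p
    ^p-+ x y = go p ≡.refl
      where
      -- The equation exposes p as a successor, so that the last term of the binomial sum can be
      -- split off as well as the first.
      go : ∀ p′ → p ≡ p′ → (x + y) ^ p ≈ x ^ p + y ^ p
      go zero    ≡.refl = ⊥-elim (ℕ.≢-nonZero⁻¹ 0 {{prime⇒nonZero pr}} ≡.refl)
      go (suc p′) ≡.refl = begin
        (x + y) ^ p                                               ≈⟨ theorem p x y ⟩
        term zero + sum (λ i → term (suc i))                      ≈⟨ +-cong first (sum-init-last (term ∘ suc)) ⟩
        y ^ p + (sum (λ i → term (suc (inject₁ i))) + term (fromℕ p)) ≈⟨ +-congˡ (+-cong middle last) ⟩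
        y ^ p + (0# + x ^ p)                                      ≈⟨ +-congˡ (+-identityˡ _) ⟩
        y ^ p + x ^ p                                             ≈⟨ +-comm _ _ ⟩
        x ^ p + y ^ p                                             ∎
        where
        term = binomialTerm x y p
        first : term zero ≈ y ^ p
        first = trans (×-homo-1 _) (*-identityˡ _)
        middle : sum (λ i → term (suc (inject₁ i))) ≈ 0#
        middle = trans (sum-cong-≋ (λ i → p∣n⇒n×x≈0 _ (prime∣C pr z<s
          (s<s (≡.subst (ℕ._< p′) (≡.sym (Fin.toℕ-inject₁ i)) (Fin.toℕ<n i)))))) (sum-replicate-zero p′)
        last : term (fromℕ p) ≈ x ^ p
        last rewrite Fin.toℕ-fromℕ p′ | nCn≡1 p | ℕ.n∸n≡0 p = trans (×-homo-1 _) (*-identityʳ _)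

    ^p^k-+ : ∀ k x y → (x + y) ^ (p ℕ.^ k) ≈ x ^ (p ℕ.^ k) + y ^ (p ℕ.^ k)
    ^p^k-+ zero    x y = trans (*-identityʳ _) (sym (+-cong (*-identityʳ x) (*-identityʳ y)))
    ^p^k-+ (suc k) x y = begin
      (x + y) ^ (p ℕ.* p ℕ.^ k)                        ≈⟨ ^-assocʳ (x + y) p _ ⟨
      ((x + y) ^ p) ^ (p ℕ.^ k)                        ≈⟨ ^-congˡ (p ℕ.^ k) (^p-+ x y) ⟩
      (x ^ p + y ^ p) ^ (p ℕ.^ k)                      ≈⟨ ^p^k-+ k _ _ ⟩
      (x ^ p) ^ (p ℕ.^ k) + (y ^ p) ^ (p ℕ.^ k)        ≈⟨ +-cong (^-assocʳ x p _) (^-assocʳ y p _) ⟩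
      x ^ (p ℕ.* p ℕ.^ k) + y ^ (p ℕ.* p ℕ.^ k)        ∎

-- The pair (m , n) of natural numbers stands for the coefficient m - n.
module RingSolver (R : CommutativeRing a ℓ) where

  open CommutativeRing R hiding (zero)
  open Algebra.Properties.Semiring.Mult semiring renaming (_×_ to _×·_)
  open Algebra.Properties.Ring ring using (-‿+-comm; -‿distribˡ-*; -‿distribʳ-*; -‿involutive; -0#≈0#)
  open SetoidReasoning setoid
  open Algebra.Solver.CommutativeMonoid +-commutativeMonoid using (solve; _⊕_; _⊜_)

  private
    coefficients : RawRing _ _
    coefficients = record
      { Carrier = ℕ × ℕ
      ; _≈_ = _≡_
      ; _+_ = λ (m , n) (m′ , n′) → m ℕ.+ m′ , n ℕ.+ n′
      ; _*_ = λ (m , n) (m′ , n′) → m ℕ.* m′ ℕ.+ n ℕ.* n′ , m ℕ.* n′ ℕ.+ n ℕ.* m′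
      ; -_  = λ (m , n) → n , m
      ; 0#  = 0 , 0
      ; 1#  = 1 , 0
      }

    ⟦_⟧ : ℕ × ℕ → Carrier
    ⟦ m , n ⟧ = m ×· 1# - n ×· 1#

    interchange : ∀ x y u v → (x + y) + (u + v) ≈ (x + u) + (y + v)
    interchange = solve 4 (λ x y u v → (x ⊕ y) ⊕ (u ⊕ v) ⊜ (x ⊕ u) ⊕ (y ⊕ v)) refl

    homomorphism : coefficients ACR.-Raw-AlmostCommutative⟶ ACR.fromCommutativeRing R
    homomorphism = record
      { ⟦_⟧ = ⟦_⟧
      ; +-homo = λ (m , n) (m′ , n′) → begin
          (m ℕ.+ m′) ×· 1# - (n ℕ.+ n′) ×· 1#
            ≈⟨ +-cong (×-homo-+ 1# m m′) (-‿cong (×-homo-+ 1# n n′)) ⟩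
          (m ×· 1# + m′ ×· 1#) - (n ×· 1# + n′ ×· 1#)
            ≈⟨ +-congˡ (-‿+-comm _ _) ⟨
          (m ×· 1# + m′ ×· 1#) + (- (n ×· 1#) - n′ ×· 1#)
            ≈⟨ interchange _ _ _ _ ⟩
          ⟦ m , n ⟧ + ⟦ m′ , n′ ⟧ ∎
      ; *-homo = λ (m , n) (m′ , n′) →
          let M = m ×· 1# ; N = n ×· 1# ; M′ = m′ ×· 1# ; N′ = n′ ×· 1# in begin
          (m ℕ.* m′ ℕ.+ n ℕ.* n′) ×· 1# - (m ℕ.* n′ ℕ.+ n ℕ.* m′) ×· 1#
            ≈⟨ +-cong (trans (×-homo-+ 1# (m ℕ.* m′) _) (+-cong (×1-homo-* m m′) (×1-homo-* n n′)))
                 (-‿cong (trans (×-homo-+ 1# (m ℕ.* n′) _) (+-cong (×1-homo-* m n′) (×1-homo-* n m′)))) ⟩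
          (M * M′ + N * N′) - (M * N′ + N * M′)
            ≈⟨ +-cong (+-congˡ (sym (trans (sym (-‿distribˡ-* _ _))
                (trans (-‿cong (sym (-‿distribʳ-* _ _))) (-‿involutive _)))))
                 (trans (sym (-‿+-comm _ _)) (+-cong (-‿distribʳ-* _ _) (-‿distribˡ-* _ _))) ⟩
          (M * M′ + - N * - N′) + (M * - N′ + - N * M′)
            ≈⟨ interchange _ _ _ _ ⟩
          (M * M′ + M * - N′) + (- N * - N′ + - N * M′)
            ≈⟨ +-cong (distribˡ _ _ _) (trans (distribˡ _ _ _) (+-comm _ _)) ⟨
          M * (M′ - N′) + - N * (M′ - N′)
            ≈⟨ distribʳ _ _ _ ⟨
          ⟦ m , n ⟧ * ⟦ m′ , n′ ⟧ ∎
      ; -‿homo = λ (m , n) → begin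
          n ×· 1# - m ×· 1#          ≈⟨ +-comm _ _ ⟩
          - (m ×· 1#) + n ×· 1#      ≈⟨ +-congˡ (-‿involutive _) ⟨
          - (m ×· 1#) - - (n ×· 1#)  ≈⟨ -‿+-comm _ _ ⟩
          - ⟦ m , n ⟧                ∎
      ; 0-homo = -‿inverseʳ 0#
      ; 1-homo = trans (+-cong (×-homo-1 1#) -0#≈0#) (+-identityʳ 1#)
      }

    -- Different pairs can stand for the same integer, so m - n and m′ - n′ are compared by cross
    -- addition.
    _≟_ : ∀ x y → Maybe (⟦ x ⟧ ≈ ⟦ y ⟧)
    (m , n) ≟ (m′ , n′) with m ℕ.+ n′ ℕ.≟ m′ ℕ.+ n
    ... | no _   = nothing
    ... | yes eq = just (x∙y⁻¹≈ε⇒x≈y _ _ (begin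
      (M - N) - (M′ - N′)       ≈⟨ +-congˡ (-‿+-comm _ _) ⟨
      (M - N) + (- M′ - - N′)   ≈⟨ +-congˡ (+-congˡ (-‿involutive _)) ⟩
      (M - N) + (- M′ + N′)     ≈⟨ solve 4 (λ x y u v → (x ⊕ y) ⊕ (u ⊕ v) ⊜ (x ⊕ v) ⊕ (u ⊕ y)) refl _ _ _ _ ⟩
      (M + N′) + (- M′ - N)     ≈⟨ +-cong (sym (×-homo-+ 1# m n′))
          (trans (-‿+-comm _ _) (-‿cong (sym (×-homo-+ 1# m′ n)))) ⟩
      (m ℕ.+ n′) ×· 1# - (m′ ℕ.+ n) ×· 1#  ≡⟨ ≡.cong (λ k → k ×· 1# - (m′ ℕ.+ n) ×· 1#) eq ⟩
      (m′ ℕ.+ n) ×· 1# - (m′ ℕ.+ n) ×· 1#  ≈⟨ -‿inverseʳ _ ⟩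
      0# ∎))
      where
      open Algebra.Properties.Group +-group using (x∙y⁻¹≈ε⇒x≈y)
      M = m ×· 1# ; N = n ×· 1# ; M′ = m′ ×· 1# ; N′ = n′ ×· 1#

  open Algebra.Solver.Ring coefficients (ACR.fromCommutativeRing R) homomorphism _≟_ public

-- Finite fields

module FieldProperties {c ℓ : Level} {N : ℕ} (𝔽 : FiniteField c ℓ N) where

  open FiniteField 𝔽 hiding (zero)
  open SetoidReasoning setoid
  open Algebra.Properties.Semiring.Exp semiring using (^-congˡ; ^-congʳ; ^-homo-*; ^-assocʳ) public
  open Algebra.Properties.CommutativeSemiring.Exp commutativeSemiring using (^-distrib-*) public
  open Algebra.Properties.Ring ring public using (-‿distribˡ-*; -‿distribʳ-*; -‿involutive; -0#≈0#)
  open Algebra.Properties.Group +-group public using ()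
    renaming (x∙y⁻¹≈ε⇒x≈y to x-y≈0⇒x≈y; x≈y⇒x∙y⁻¹≈ε to x≈y⇒x-y≈0; inverseˡ-unique to x+y≈0⇒x≈-y)
  open RingSolver commutativeRing public using (solve; _:=_; _:+_; _:*_; _:-_; :-_; con)

  *-cancelˡ-≉0 : ∀ {x y z} → x ≉ 0# → x * y ≈ x * z → y ≈ z
  *-cancelˡ-≉0 {x} {y} {z} x≉0 eq = begin
    y               ≈⟨ *-identityˡ y ⟨
    1# * y          ≈⟨ *-congʳ (⁻¹-inverseˡ x≉0) ⟨
    x ⁻¹ * x * y    ≈⟨ *-assoc _ _ _ ⟩
    x ⁻¹ * (x * y)  ≈⟨ *-congˡ eq ⟩
    x ⁻¹ * (x * z)  ≈⟨ *-assoc _ _ _ ⟨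
    x ⁻¹ * x * z    ≈⟨ *-congʳ (⁻¹-inverseˡ x≉0) ⟩
    1# * z          ≈⟨ *-identityˡ z ⟩
    z               ∎

  x*[x⁻¹*y]≈y : ∀ {x} → x ≉ 0# → ∀ y → x * (x ⁻¹ * y) ≈ y
  x*[x⁻¹*y]≈y {x} x≉0 y = trans (sym (*-assoc _ _ _)) (trans (*-congʳ (⁻¹-inverseʳ x≉0)) (*-identityˡ y))

  *-≈0 : ∀ {x y} → x * y ≈ 0# → x ≈ 0# ⊎ y ≈ 0#
  *-≈0 {x} xy≈0 with x ≟ 0#
  ... | yes x≈0 = inj₁ x≈0
  ... | no  x≉0 = inj₂ (x*y≈0⇒y≈0 x≉0 xy≈0)

  square≈0 : ∀ {x} → x * x ≈ 0# → x ≈ 0#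
  square≈0 = [ id , id ] ∘ *-≈0

  ^-≉0 : ∀ {x} n → x ≉ 0# → x ^ n ≉ 0#
  ^-≉0 n x≉0 = x≉0 ∘ x^n≈0⇒x≈0 n

  1^ : ∀ n → 1# ^ n ≈ 1#
  1^ zero    = refl
  1^ (suc n) = trans (*-identityˡ _) (1^ n)

  0^ : ∀ n → .{{ℕ.NonZero n}} → 0# ^ n ≈ 0#
  0^ (suc n) = zeroˡ _

  ^-comm : ∀ x m n → (x ^ m) ^ n ≈ (x ^ n) ^ m
  ^-comm x m n = begin
    (x ^ m) ^ n    ≈⟨ ^-assocʳ x m n ⟩
    x ^ (m ℕ.* n)  ≈⟨ ^-congʳ x (ℕ.*-comm m n) ⟩
    x ^ (n ℕ.* m)  ≈⟨ ^-assocʳ x n m ⟨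
    (x ^ n) ^ m    ∎

  square≈1 : ∀ {x} → x * x ≈ 1# → x ≈ 1# ⊎ x ≈ - 1#
  square≈1 {x} x²≈1 with *-≈0 {x - 1#} {x + 1#} (begin
      (x - 1#) * (x + 1#)  ≈⟨ solve 2 (λ x e → (x :- e) :* (x :+ e) := x :* x :- e :* e) refl x 1# ⟩
      x * x - 1# * 1#      ≈⟨ x≈y⇒x-y≈0 (trans x²≈1 (sym (*-identityˡ 1#))) ⟩
      0#                   ∎)
  ... | inj₁ x-1≈0 = inj₁ (x-y≈0⇒x≈y x 1# x-1≈0)
  ... | inj₂ x+1≈0 = inj₂ (x+y≈0⇒x≈-y x 1# x+1≈0)

  private module Mult = Algebra.Properties.Semiring.Mult semiring

  N×1≈0 : N Mult.× 1# ≈ 0#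
  N×1≈0 = lagrange +-abelianGroup finite 1#

  ×1-^ : ∀ m j → (m ℕ.^ j) Mult.× 1# ≈ (m Mult.× 1#) ^ j
  ×1-^ m zero    = Mult.×-homo-1 1#
  ×1-^ m (suc j) = trans (Mult.×1-homo-* m _) (*-congˡ (×1-^ m j))

  units : AbelianGroup (c ⊔ ℓ) ℓ
  units = record
    { Carrier = ∃[ x ] x ≉ 0#
    ; _≈_ = λ x y → proj₁ x ≈ proj₁ y
    ; _∙_ = λ (x , x≉0) (y , y≉0) → x * y , *-≉0 x≉0 y≉0
    ; ε = 1# , 1≉0
    ; _⁻¹ = λ (x , x≉0) → x ⁻¹ , x⁻¹≉0 x≉0
    ; isAbelianGroup = record
      { isGroup = record
        { isMonoid = record
          { isSemigroup = record
            { isMagma = record { isEquivalence = Setoid.isEquivalence (Sub setoid (_≉ 0#)) ; ∙-cong = *-cong }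
            ; assoc = λ _ _ _ → *-assoc _ _ _ }
          ; identity = (λ _ → *-identityˡ _) , (λ _ → *-identityʳ _) }
        ; inverse = (λ (_ , x≉0) → ⁻¹-inverseˡ x≉0) , (λ (_ , x≉0) → ⁻¹-inverseʳ x≉0)
        ; ⁻¹-cong = λ {x} {y} x≈y → ⁻¹-cong (proj₂ x) (proj₂ y) x≈y }
      ; comm = λ _ _ → *-comm _ _ } }
    where
    ⁻¹-cong : ∀ {x y} → x ≉ 0# → y ≉ 0# → x ≈ y → x ⁻¹ ≈ y ⁻¹
    ⁻¹-cong x≉0 y≉0 x≈y = *-cancelˡ-≉0 x≉0
      (trans (⁻¹-inverseʳ x≉0) (sym (trans (*-congʳ x≈y) (⁻¹-inverseʳ y≉0))))

  module _ {n : ℕ} (N≡1+n : N ≡ suc n) where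

    units-cardinality : HasCardinality (AbelianGroup.setoid units) n
    units-cardinality = cardinality-remove setoid 0# (_≟ 0#) (≡.subst (HasCardinality setoid) N≡1+n finite)

    fermat : ∀ {x} → x ≉ 0# → x ^ n ≈ 1#
    fermat {x} x≉0 = trans (sym (×-^ n)) (lagrange units units-cardinality (x , x≉0))
      where
      open Algebra.Properties.Monoid.Mult (AbelianGroup.monoid units) renaming (_×_ to _×·_)
      ×-^ : ∀ n → proj₁ (n ×· (x , x≉0)) ≈ x ^ n
      ×-^ zero    = refl
      ×-^ (suc n) = *-congˡ (×-^ n)

    fermat′ : ∀ x → x ^ N ≈ x
    fermat′ x with x ≟ 0#
    ... | no  x≉0 = trans (^-congʳ x N≡1+n) (trans (*-congˡ (fermat x≉0)) (*-identityʳ x))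
    ... | yes x≈0 = trans (^-congʳ x N≡1+n) (trans (*-congʳ x≈0) (trans (zeroˡ _) (sym x≈0)))

    -- The cosets are the single units. Applied to this subgroup, the results on subgroups of given
    -- index yield the order of γ (`order∣`).
    trivial-index : IsSubgroupOfIndex n (_≈ 1#)
    trivial-index = record
      { respects = λ x≈y x≈1 → trans (sym x≈y) x≈1
      ; nonzero = λ x≈1 x≈0 → 1≉0 (trans (sym x≈1) x≈0)
      ; 1∈ = refl
      ; *-closed = λ x≈1 y≈1 → trans (*-cong x≈1 y≈1) (*-identityˡ 1#)
      ; ⁻¹-closed = λ {x} x≈1 → trans (sym (*-identityˡ _)) (trans (*-congʳ (sym x≈1))
          (⁻¹-inverseʳ (λ x≈0 → 1≉0 (trans (sym x≈1) x≈0))))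
      ; rep = λ i → proj₁ (c.from i)
      ; rep≉0 = λ i → proj₂ (c.from i)
      ; cover = λ {x} x≉0 → c.to (x , x≉0) , 1# , refl ,
          trans (sym (c.inverseʳ {x = x , x≉0} ≡.refl)) (sym (*-identityʳ _))
      ; disjoint = λ { i j (h , h≈1 , x≈) (h′ , h′≈1 , x≈′) → ≡.trans (≡.sym (c.strictlyInverseˡ i))
          (≡.trans (c.to-cong (begin
            proj₁ (c.from i)        ≈⟨ trans (*-congˡ h≈1) (*-identityʳ _) ⟨
            proj₁ (c.from i) * h    ≈⟨ trans (sym x≈) x≈′ ⟩
            proj₁ (c.from j) * h′   ≈⟨ trans (*-congˡ h′≈1) (*-identityʳ _) ⟩
            proj₁ (c.from j)        ∎)) (c.strictlyInverseˡ j)) } }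
      where module c = Inverse units-cardinality

  -- Subgroups of a cyclic group that are given by their index

  module Powers {γ : Carrier} (γ-primitive : IsPrimitive γ) where

    private
      γ≉0 = proj₁ γ-primitive
      log : ∀ x → x ≉ 0# → ∃[ i ] x ≈ γ ^ i
      log = proj₂ γ-primitive

    module _ {a} {e : ℕ} {H : Pred Carrier a} (H-index : IsSubgroupOfIndex e H) where

      open IsSubgroupOfIndex H-index

      ^-closed : ∀ {x} n → x ∈ H → x ^ n ∈ H
      ^-closed zero    _  = 1∈
      ^-closed (suc n) hx = *-closed hx (^-closed n hx)

      e-nonZero : ℕ.NonZero e
      e-nonZero = ℕ.>-nonZero (ℕ.≤-<-trans ℕ.z≤n (Fin.toℕ<n (proj₁ (cover 1≉0))))

      cancel : ∀ {x y} → x ∈ H → x * y ∈ H → y ∈ H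
      cancel {x} {y} hx hxy = respects (begin
        x ⁻¹ * (x * y)  ≈⟨ *-assoc _ _ _ ⟨
        x ⁻¹ * x * y    ≈⟨ *-congʳ (⁻¹-inverseˡ (nonzero hx)) ⟩
        1# * y          ≈⟨ *-identityˡ y ⟩
        y               ∎) (*-closed (⁻¹-closed hx) hxy)

      -- The powers of γ^d lie in H, so the coset of `rep i` depends only on the exponent of `rep i`
      -- modulo d, and there are d residues. The common element of two cosets with the same residue
      -- is found by multiplying each representative by the power of γ^d that belongs to the other.
      index≤ : ∀ d → .{{ℕ.NonZero d}} → γ ^ d ∈ H → e ℕ.≤ d
      index≤ d hd = Fin.injective⇒≤ {f = λ i → fromℕ< (m%n<n (k i) d)} λ {i} {j} eq →
        disjoint i j (_ , power j , refl) (_ , power i ,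
          (begin
            rep i * (γ ^ d) ^ (k j / d)                                    ≈⟨ *-congʳ (rep≈ i) ⟩
            γ ^ (k i % d) * (γ ^ d) ^ (k i / d) * (γ ^ d) ^ (k j / d)
                ≈⟨ *-congʳ (*-congʳ (^-congʳ γ (same eq))) ⟩
            γ ^ (k j % d) * (γ ^ d) ^ (k i / d) * (γ ^ d) ^ (k j / d)
                ≈⟨ solve 3 (λ x y z → x :* y :* z := x :* z :* y) refl _ _ _ ⟩
            γ ^ (k j % d) * (γ ^ d) ^ (k j / d) * (γ ^ d) ^ (k i / d)      ≈⟨ *-congʳ (rep≈ j) ⟨
            rep j * (γ ^ d) ^ (k i / d)                                    ∎))
        where
        k : Fin e → ℕ
        k i = proj₁ (log (rep i) (rep≉0 i))
        same : ∀ {i j} → fromℕ< (m%n<n (k i) d) ≡ fromℕ< (m%n<n (k j) d) → k i % d ≡ k j % d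
        same eq = ≡.trans (≡.sym (Fin.toℕ-fromℕ< _)) (≡.trans (≡.cong toℕ eq) (Fin.toℕ-fromℕ< _))
        power : ∀ i → (γ ^ d) ^ (k i / d) ∈ H
        power i = ^-closed (k i / d) hd
        rep≈ : ∀ i → rep i ≈ γ ^ (k i % d) * (γ ^ d) ^ (k i / d)
        rep≈ i = begin
          rep i                                    ≈⟨ proj₂ (log (rep i) (rep≉0 i)) ⟩
          γ ^ k i                                  ≈⟨ ^-congʳ γ (m≡m%n+[m/n]*n (k i) d) ⟩
          γ ^ (k i % d ℕ.+ k i / d ℕ.* d)          ≈⟨ ^-homo-* γ (k i % d) _ ⟩
          γ ^ (k i % d) * γ ^ (k i / d ℕ.* d)      ≈⟨ *-congˡ (^-congʳ γ (ℕ.*-comm (k i / d) d)) ⟩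
          γ ^ (k i % d) * γ ^ (d ℕ.* (k i / d))    ≈⟨ *-congˡ (^-assocʳ γ d _) ⟨
          γ ^ (k i % d) * (γ ^ d) ^ (k i / d)      ∎

      -- Two of the e + 1 powers with exponents 0, ..., e share a coset, so γ^d ∈ H for some 0 < d ≤
      -- e, and `index≤` forces d = e.
      γ^index∈ : γ ^ e ∈ H
      γ^index∈ with i , j , i<j , eq ← Fin.pigeonhole (ℕ.n<1+n e) (λ i → proj₁ (cover (^-≉0 (toℕ i) γ≉0)))
               with _ , h , hh , γ^i≈ ← cover (^-≉0 (toℕ i) γ≉0) | _ , h′ , hh′ , γ^j≈ ← cover
                   (^-≉0 (toℕ j) γ≉0)
               with ≡.refl ← eq =
        ≡.subst (λ k → γ ^ k ∈ H) (ℕ.≤-antisym d≤e (index≤ d {{ℕ.>-nonZero (ℕ.m<n⇒0<n∸m i<j)}} γ^d∈H)) γ^d∈H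
        where
        d = toℕ j ∸ toℕ i
        d≤e : d ℕ.≤ e
        d≤e = ℕ.≤-trans (ℕ.m∸n≤m (toℕ j) (toℕ i)) (ℕ.≤-pred (Fin.toℕ<n j))
        r = rep _
        γ^d∈H : γ ^ d ∈ H
        γ^d∈H = cancel hh (respects (*-cancelˡ-≉0 (rep≉0 _) (begin
          r * h′                  ≈⟨ γ^j≈ ⟨
          γ ^ toℕ j               ≈⟨ ^-congʳ γ (ℕ.m+[n∸m]≡n (ℕ.<⇒≤ i<j)) ⟨
          γ ^ (toℕ i ℕ.+ d)       ≈⟨ ^-homo-* γ (toℕ i) d ⟩
          γ ^ toℕ i * γ ^ d       ≈⟨ *-congʳ γ^i≈ ⟩
          r * h * γ ^ d           ≈⟨ *-assoc _ _ _ ⟩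
          r * (h * γ ^ d)         ∎)) hh′)

      ∣⇒γ^∈ : ∀ {i} → e ∣ i → γ ^ i ∈ H
      ∣⇒γ^∈ (divides k ≡.refl) = respects (trans (^-assocʳ γ e k) (^-congʳ γ (ℕ.*-comm e k)))
          (^-closed k γ^index∈)

      -- The remainder r of i modulo e also satisfies γ^r ∈ H, and `index≤` excludes 0 < r < e.
      γ^∈⇒∣ : ∀ {i} → γ ^ i ∈ H → e ∣ i
      γ^∈⇒∣ {i} hi = lemma (i % e) ≡.refl
        where
        instance _ = e-nonZero
        split-power : γ ^ i ≈ γ ^ (i / e ℕ.* e) * γ ^ (i % e)
        split-power = begin
          γ ^ i                              ≈⟨ ^-congʳ γ (≡.trans (m≡m%n+[m/n]*n i e) (ℕ.+-comm (i % e) _)) ⟩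
          γ ^ (i / e ℕ.* e ℕ.+ i % e)        ≈⟨ ^-homo-* γ (i / e ℕ.* e) _ ⟩
          γ ^ (i / e ℕ.* e) * γ ^ (i % e)    ∎
        lemma : ∀ r → i % e ≡ r → e ∣ i
        lemma zero    eq = divides (i / e) (≡.trans (m≡m%n+[m/n]*n i e) (≡.cong (ℕ._+ i / e ℕ.* e) eq))
        lemma (suc r) eq = ⊥-elim (ℕ.<⇒≱ (≡.subst (ℕ._< e) eq (m%n<n i e)) (index≤ (suc r)
          (≡.subst (λ k → γ ^ k ∈ H) eq (cancel (∣⇒γ^∈ (n∣m*n (i / e))) (respects split-power hi)))))

    module _ {n : ℕ} (N≡1+n : N ≡ suc n) where

      order∣ : ∀ {i} → γ ^ i ≈ 1# → n ∣ i
      order∣ = γ^∈⇒∣ (trivial-index N≡1+n)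

      private
        n-nonZero : ℕ.NonZero n
        n-nonZero = e-nonZero (trivial-index N≡1+n)

        m-nonZero : ∀ e m → e ℕ.* m ≡ n → ℕ.NonZero m
        m-nonZero e m ≡.refl = ℕ.m*n≢0⇒n≢0 e {{n-nonZero}}

      module _ {a} {e m : ℕ} {H : Pred Carrier a} (H-index : IsSubgroupOfIndex e H) (em≡n : e ℕ.* m ≡ n) where

        open IsSubgroupOfIndex H-index

        -- With `^≈1⇒∈`, this identifies a subgroup known only by its index e with the kernel of the
        -- m-th power: both consist of the γ^i with e ∣ i.
        ∈⇒^≈1 : ∀ {x} → x ∈ H → x ^ m ≈ 1#
        ∈⇒^≈1 {x} hx with i , x≈γ^i ← log x (nonzero hx)
                     with divides k ≡.refl ← γ^∈⇒∣ H-index {i} (respects x≈γ^i hx) = begin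
          x ^ m                    ≈⟨ ^-congˡ m x≈γ^i ⟩
          (γ ^ (k ℕ.* e)) ^ m      ≈⟨ ^-assocʳ γ (k ℕ.* e) m ⟩
          γ ^ (k ℕ.* e ℕ.* m)      ≈⟨ ^-congʳ γ
              (≡.trans (ℕ.*-assoc k e m) (≡.trans (≡.cong (k ℕ.*_) em≡n) (ℕ.*-comm k n))) ⟩
          γ ^ (n ℕ.* k)            ≈⟨ ^-assocʳ γ n k ⟨
          (γ ^ n) ^ k              ≈⟨ ^-congˡ k (fermat N≡1+n γ≉0) ⟩
          1# ^ k                   ≈⟨ 1^ k ⟩
          1#                       ∎

        ^≈1⇒∈ : ∀ {x} → x ≉ 0# → x ^ m ≈ 1# → x ∈ H
        ^≈1⇒∈ {x} x≉0 x^m≈1 with i , x≈γ^i ← log x x≉0 =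
          respects (sym x≈γ^i) (∣⇒γ^∈ H-index {i}
              (*-cancelʳ-∣ m {{m-nonZero e m em≡n}} (≡.subst (_∣ i ℕ.* m) (≡.sym em≡n)
            (order∣ (trans (sym (^-assocʳ γ i m)) (trans (^-congˡ m (sym x≈γ^i)) x^m≈1))))))

-- For q = 4r + 1 and m = (q + 1) / 2, the exponents h, d, l and N are (q - 1) / 2,
-- q - 1, (q² - 1) / 2 and q² - 1.
record Exponents (q m : ℕ) : Set where
  field
    r h d l N : ℕ
    h≡2*r     : h ≡ 2 ℕ.* r
    d≡h+h     : d ≡ h ℕ.+ h
    q≡1+d     : q ≡ suc d
    m≡1+h     : m ≡ suc h
    l≡d*m     : l ≡ d ℕ.* m
    l+l≡N     : l ℕ.+ l ≡ N
    q²≡1+N    : q ℕ.^ 2 ≡ suc N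
    1+q*d≡N   : suc q ℕ.* d ≡ N
    h-nonZero : ℕ.NonZero h

exponents : ∀ {q} → q % 4 ≡ 1 → ¬ q ≡ 1 → Exponents q (suc q / 2)
exponents {q} q%4≡1 q≢1 = record
  { r = r ; h = 2 ℕ.* r ; d = 2 ℕ.* r ℕ.+ 2 ℕ.* r
  ; l = (2 ℕ.* r ℕ.+ 2 ℕ.* r) ℕ.* (suc q / 2) ; N = suc q ℕ.* (2 ℕ.* r ℕ.+ 2 ℕ.* r)
  ; h≡2*r = ≡.refl ; d≡h+h = ≡.refl ; q≡1+d = q≡1+d ; m≡1+h = m≡1+h ; l≡d*m = ≡.refl
  ; l+l≡N = ≡.subst₂ (λ m q → let d = 2 ℕ.* r ℕ.+ 2 ℕ.* r in d ℕ.* m ℕ.+ d ℕ.* m ≡ suc q ℕ.* d) (≡.sym m≡1+h)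
      (≡.sym q≡1+d)
      (solve 1 (λ h → (h :+ h) :* (con 1 :+ h) :+ (h :+ h) :* (con 1 :+ h) := (con 2 :+ (h :+ h)) :* (h :+ h))
          ≡.refl (2 ℕ.* r))
  ; q²≡1+N = ≡.subst (λ q → q ℕ.^ 2 ≡ suc (suc q ℕ.* (2 ℕ.* r ℕ.+ 2 ℕ.* r))) (≡.sym q≡1+d)
      (solve 1 (λ d → (con 1 :+ d) :* ((con 1 :+ d) :* con 1) := con 1 :+ (con 2 :+ d) :* d) ≡.refl
          (2 ℕ.* r ℕ.+ 2 ℕ.* r))
  ; 1+q*d≡N = ≡.refl
  -- Only q = 1 gives h = 0; a positive h makes `κ` vanish at 0.
  ; h-nonZero = ℕ.≢-nonZero λ h≡0 → q≢1 (≡.trans q≡1+d (≡.cong (λ h → suc (h ℕ.+ h)) h≡0)) }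
  where
  open Data.Nat.Solver.+-*-Solver
  r : ℕ
  r = q / 4
  q≡1+d : q ≡ suc (2 ℕ.* r ℕ.+ 2 ℕ.* r)
  q≡1+d = ≡.trans (m≡m%n+[m/n]*n q 4) (≡.trans (≡.cong (ℕ._+ r ℕ.* 4) q%4≡1)
    (solve 1 (λ r → con 1 :+ r :* con 4 := con 1 :+ (con 2 :* r :+ con 2 :* r)) ≡.refl r))
  m≡1+h : suc q / 2 ≡ suc (2 ℕ.* r)
  m≡1+h = ≡.trans (≡.cong (λ q → suc q / 2) q≡1+d)
    (≡.trans (≡.cong (_/ 2) (solve 1 (λ h → con 2 :+ (h :+ h) := (con 1 :+ h) :* con 2) ≡.refl (2 ℕ.* r)))
      (m*n/n≡m (suc (2 ℕ.* r)) 2))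

-- The extension K of F: conjugation, the basis 1, δ and the quadratic characters

module QuadraticExtension {c₁ ℓ₁ c₂ ℓ₂ a : Level} (p k : ℕ) {q m : ℕ}
  (p-prime : Prime p) (q≡p^k : q ≡ p ℕ.^ k) (E : Exponents q m)
  (F : FiniteField c₁ ℓ₁ q) (K : FiniteField c₂ ℓ₂ (q ℕ.^ 2))
  (ι : FiniteField.Carrier F → FiniteField.Carrier K)
  (ι-hom : IsRingHomomorphism (FiniteField.rawRing F) (FiniteField.rawRing K) ι)
  (γ : FiniteField.Carrier K) (γ-primitive : FiniteField.IsPrimitive K γ)
  (C₀ : ℕ → Pred (FiniteField.Carrier K) a)
  (C₀-index : ∀ e → e ∣ q ℕ.^ 2 ∸ 1 → FiniteField.IsSubgroupOfIndex K e (C₀ e))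
  where

  private
    open Exponents E
    module F where
      open FiniteField F public
      open FieldProperties F public
    open FiniteField K hiding (zero)
    open FieldProperties K
    open Powers γ-primitive
    module Mult = Algebra.Properties.Semiring.Mult semiring
    module ι = IsRingHomomorphism ι-hom
    open SetoidReasoning setoid

  private instance
    h-nonZero′ : ℕ.NonZero h
    h-nonZero′ = h-nonZero
    d-nonZero : ℕ.NonZero d
    d-nonZero = ≡.subst ℕ.NonZero (≡.sym d≡h+h) (ℕ.>-nonZero (ℕ.<-≤-trans (ℕ.>-nonZero⁻¹ h) (ℕ.m≤m+n h h)))
    m-nonZero : ℕ.NonZero m
    m-nonZero = ≡.subst ℕ.NonZero (≡.sym m≡1+h) _
    l-nonZero : ℕ.NonZero l
    l-nonZero = ≡.subst ℕ.NonZero (≡.sym l≡d*m) (ℕ.m*n≢0 d m)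

  private
    2*l≡N : 2 ℕ.* l ≡ N
    2*l≡N = ≡.trans (≡.cong (l ℕ.+_) (ℕ.+-identityʳ l)) l+l≡N

    2*1+q*h≡N : 2 ℕ.* suc q ℕ.* h ≡ N
    2*1+q*h≡N = ≡.trans (≡.cong (ℕ._* h) (ℕ.*-comm 2 (suc q))) (≡.trans (ℕ.*-assoc (suc q) 2 h)
      (≡.trans (≡.cong (suc q ℕ.*_) (≡.trans (≡.cong (h ℕ.+_) (ℕ.+-identityʳ h)) (≡.sym d≡h+h))) 1+q*d≡N))

  ι-^ : ∀ x j → ι (x F.^ j) ≈ ι x ^ j
  ι-^ x zero    = ι.1#-homo
  ι-^ x (suc j) = trans (ι.*-homo x _) (*-congˡ (ι-^ x j))

  ι0*x≈0 : ∀ {c x} → c F.≈ F.0# → ι c * x ≈ 0#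
  ι0*x≈0 c≈0 = trans (*-congʳ (trans (ι.⟦⟧-cong c≈0) ι.0#-homo)) (zeroˡ _)

  ι1*x≈x : ∀ {x} → ι F.1# * x ≈ x
  ι1*x≈x = trans (*-congʳ ι.1#-homo) (*-identityˡ _)

  ι1*ι1≈1 : ι F.1# * ι F.1# ≈ 1#
  ι1*ι1≈1 = trans ι1*x≈x ι.1#-homo

  ι≉0 : ∀ {x} → x F.≉ F.0# → ι x ≉ 0#
  ι≉0 {x} x≉0 ιx≈0 = 1≉0 (begin
    1#                   ≈⟨ ι.1#-homo ⟨
    ι F.1#               ≈⟨ ι.⟦⟧-cong (F.⁻¹-inverseʳ x≉0) ⟨
    ι (x F.* (x F.⁻¹))   ≈⟨ ι.*-homo x _ ⟩
    ι x * ι (x F.⁻¹)     ≈⟨ *-congʳ ιx≈0 ⟩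
    0# * ι (x F.⁻¹)      ≈⟨ zeroˡ _ ⟩
    0#                   ∎)

  ι≈0⇒≈0 : ∀ {x} → ι x ≈ 0# → x F.≈ F.0#
  ι≈0⇒≈0 {x} ιx≈0 with x F.≟ F.0#
  ... | yes x≈0 = x≈0
  ... | no  x≉0 = ⊥-elim (ι≉0 x≉0 ιx≈0)

  ι-injective : ∀ {x y} → ι x ≈ ι y → x F.≈ y
  ι-injective {x} {y} eq = F.x-y≈0⇒x≈y x y (ι≈0⇒≈0 (begin
    ι (x F.- y)      ≈⟨ ι.+-homo x _ ⟩
    ι x + ι (F.- y)  ≈⟨ +-congˡ (ι.-‿homo y) ⟩
    ι x - ι y        ≈⟨ x≈y⇒x-y≈0 eq ⟩
    0#               ∎))

  private
    -- The additive order of K only gives q² · 1 = 0, but a field has no nilpotents. The same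
    -- argument then descends from q = p^k to p.
    q×1≈0 : q Mult.× 1# ≈ 0#
    q×1≈0 = x^n≈0⇒x≈0 2 (trans (sym (×1-^ q 2)) N×1≈0)

    p×1≈0 : p Mult.× 1# ≈ 0#
    p×1≈0 = x^n≈0⇒x≈0 k (trans (sym (×1-^ p k)) (trans (Mult.×-congˡ (≡.sym q≡p^k)) q×1≈0))

  conj-+ : ∀ x y → (x + y) ^ q ≈ x ^ q + y ^ q
  conj-+ x y = begin
    (x + y) ^ q                      ≈⟨ ^-congʳ (x + y) q≡p^k ⟩
    (x + y) ^ (p ℕ.^ k)              ≈⟨ Frobenius.^p^k-+ commutativeSemiring p-prime p×1≈0 k x y ⟩
    x ^ (p ℕ.^ k) + y ^ (p ℕ.^ k)    ≈⟨ +-cong (^-congʳ x q≡p^k) (^-congʳ y q≡p^k) ⟨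
    x ^ q + y ^ q                    ∎

  conj-* : ∀ x y → (x * y) ^ q ≈ x ^ q * y ^ q
  conj-* x y = ^-distrib-* x y q

  conj-0 : 0# ^ q ≈ 0#
  conj-0 = trans (^-congʳ 0# q≡1+d) (zeroˡ _)

  conj-‿ : ∀ x → (- x) ^ q ≈ - x ^ q
  conj-‿ x = x+y≈0⇒x≈-y _ _ (trans (sym (conj-+ (- x) x)) (trans (^-congˡ q (-‿inverseˡ x)) conj-0))

  conj-ι : ∀ x → ι x ^ q ≈ ι x
  conj-ι x = trans (sym (ι-^ x q)) (ι.⟦⟧-cong (F.fermat′ q≡1+d x))

  conj≈x*x^d : ∀ x → x ^ q ≈ x * x ^ d
  conj≈x*x^d x = ^-congʳ x q≡1+d

  conj-involutive : ∀ x → (x ^ q) ^ q ≈ x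
  conj-involutive x = begin
    (x ^ q) ^ q     ≈⟨ ^-assocʳ x q q ⟩
    x ^ (q ℕ.* q)   ≈⟨ ^-congʳ x (≡.cong (q ℕ.*_) (ℕ.*-identityʳ q)) ⟨
    x ^ (q ℕ.^ 2)   ≈⟨ fermat′ q²≡1+N x ⟩
    x               ∎

  -- q = 1 + 2h vanishes in K, so 2 = 0 would give 1 = 0.
  1+1≉0 : 1# + 1# ≉ 0#
  1+1≉0 2≈0 = 1≉0 (begin
    1#                                 ≈⟨ +-identityʳ 1# ⟨
    1# + 0#                            ≈⟨ +-congˡ (zeroˡ _) ⟨
    1# + 0# * (h Mult.× 1#)    ≈⟨ +-congˡ (*-congʳ (trans (+-congˡ (+-identityʳ 1#)) 2≈0)) ⟨
    1# + (2 Mult.× 1#) * (h Mult.× 1#)    ≈⟨ +-congˡ (Mult.×1-homo-* 2 h) ⟨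
    1# + (2 ℕ.* h) Mult.× 1#
        ≈⟨ +-congˡ (Mult.×-congˡ (≡.trans (≡.cong (h ℕ.+_) (ℕ.+-identityʳ h)) (≡.sym d≡h+h))) ⟩
    suc d Mult.× 1#            ≈⟨ Mult.×-congˡ (≡.sym q≡1+d) ⟩
    q Mult.× 1#                        ≈⟨ q×1≈0 ⟩
    0#                                 ∎)

  x≉-x : ∀ {x} → x ≉ 0# → x ≉ - x
  x≉-x {x} x≉0 x≈-x = *-≉0 1+1≉0 x≉0 (begin
    (1# + 1#) * x    ≈⟨ trans (distribʳ x 1# 1#) (+-cong (*-identityˡ x) (*-identityˡ x)) ⟩
    x + x            ≈⟨ +-congˡ x≈-x ⟩
    x - x            ≈⟨ -‿inverseʳ x ⟩
    0#               ∎)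

  x+x≈0⇒x≈0 : ∀ {x} → x + x ≈ 0# → x ≈ 0#
  x+x≈0⇒x≈0 {x} x+x≈0 = x*y≈0⇒y≈0 1+1≉0
    (trans (trans (distribʳ x 1# 1#) (+-cong (*-identityˡ x) (*-identityˡ x))) x+x≈0)

  -1≉0 : - 1# ≉ 0#
  -1≉0 -1≈0 = 1≉0 (trans (sym (-‿involutive 1#)) (trans (-‿cong -1≈0) -0#≈0#))

  -1*-1≈1 : - 1# * - 1# ≈ 1#
  -1*-1≈1 = trans (solve 1 (λ x → :- x :* :- x := x :* x) refl 1#) (*-identityˡ 1#)

  -1^odd : ∀ j → (- 1#) ^ suc (2 ℕ.* j) ≈ - 1#
  -1^odd j = begin
    - 1# * (- 1#) ^ (2 ℕ.* j)   ≈⟨ *-congˡ (^-assocʳ (- 1#) 2 j) ⟨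
    - 1# * ((- 1#) ^ 2) ^ j     ≈⟨ *-congˡ (^-congˡ j (trans (*-congˡ (*-identityʳ _)) -1*-1≈1)) ⟩
    - 1# * 1# ^ j               ≈⟨ *-congˡ (1^ j) ⟩
    - 1# * 1#                   ≈⟨ *-identityʳ _ ⟩
    - 1#                        ∎

  γ≉0 : γ ≉ 0#
  γ≉0 = proj₁ γ-primitive

  δ : Carrier
  δ = γ ^ m

  δ≉0 : δ ≉ 0#
  δ≉0 = ^-≉0 m γ≉0

  -- δ^d = γ^l is a square root of 1, and it differs from 1 because l is smaller than the order N of
  -- γ.
  δ^d≈-1 : δ ^ d ≈ - 1#
  δ^d≈-1 = go (square≈1 δ^d-square)
    where
    γ^l≈δ^d : δ ^ d ≈ γ ^ l
    γ^l≈δ^d = trans (^-assocʳ γ m d) (^-congʳ γ (≡.trans (ℕ.*-comm m d) (≡.sym l≡d*m)))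
    l<N : l ℕ.< N
    l<N = ≡.subst (l ℕ.<_) l+l≡N (ℕ.m<m+n l (ℕ.>-nonZero⁻¹ l))
    δ^d-square : δ ^ d * δ ^ d ≈ 1#
    δ^d-square = begin
      δ ^ d * δ ^ d      ≈⟨ *-cong γ^l≈δ^d γ^l≈δ^d ⟩
      γ ^ l * γ ^ l      ≈⟨ ^-homo-* γ l l ⟨
      γ ^ (l ℕ.+ l)      ≈⟨ ^-congʳ γ l+l≡N ⟩
      γ ^ N              ≈⟨ fermat q²≡1+N γ≉0 ⟩
      1#                 ∎
    δ^d≉1 : δ ^ d ≉ 1#
    δ^d≉1 eq = ℕ.<⇒≱ l<N (∣⇒≤ (order∣ q²≡1+N {l} (trans (sym γ^l≈δ^d) eq)))
    go : δ ^ d ≈ 1# ⊎ δ ^ d ≈ - 1# → δ ^ d ≈ - 1#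
    go (inj₁ eq) = ⊥-elim (δ^d≉1 eq)
    go (inj₂ eq) = eq

  conj-δ : δ ^ q ≈ - δ
  conj-δ = trans (conj≈x*x^d δ) (trans (*-congˡ δ^d≈-1)
    (trans (sym (-‿distribʳ-* δ 1#)) (-‿cong (*-identityʳ δ))))

  module _ (u v : F.Carrier) where

    conj-ι+ιδ : (ι u + ι v * δ) ^ q ≈ ι u - ι v * δ
    conj-ι+ιδ = begin
      (ι u + ι v * δ) ^ q          ≈⟨ conj-+ _ _ ⟩
      ι u ^ q + (ι v * δ) ^ q      ≈⟨ +-cong (conj-ι u) (conj-* _ _) ⟩
      ι u + ι v ^ q * δ ^ q        ≈⟨ +-congˡ (*-cong (conj-ι v) conj-δ) ⟩
      ι u + ι v * - δ              ≈⟨ +-congˡ (-‿distribʳ-* _ _) ⟨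
      ι u - ι v * δ                ∎

  private
    ι+ιδ : F.Carrier × F.Carrier → Carrier
    ι+ιδ (u , v) = ι u + ι v * δ

    -- Conjugation changes the sign of the δ-part, so adding the conjugate recovers twice the
    -- F-part.
    ι+ιδ-injective : Injective (λ x y → proj₁ x F.≈ proj₁ y × proj₂ x F.≈ proj₂ y) _≈_ ι+ιδ
    ι+ιδ-injective {u , v} {u′ , v′} eq =
      ι-injective u≈ , ι-injective (*-cancelˡ-≉0 δ≉0 (trans (*-comm δ _) (trans vδ≈ (*-comm _ δ))))
      where
      conj-eq : ι u - ι v * δ ≈ ι u′ - ι v′ * δ
      conj-eq = trans (sym (conj-ι+ιδ u v)) (trans (^-congˡ q eq) (conj-ι+ιδ u′ v′))
      u≈ : ι u ≈ ι u′
      u≈ = *-cancelˡ-≉0 1+1≉0 (begin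
        (1# + 1#) * ι u                              ≈⟨ double (ι u) (ι v * δ) ⟩
        (ι u + ι v * δ) + (ι u - ι v * δ)            ≈⟨ +-cong eq conj-eq ⟩
        (ι u′ + ι v′ * δ) + (ι u′ - ι v′ * δ)        ≈⟨ double (ι u′) (ι v′ * δ) ⟨
        (1# + 1#) * ι u′                             ∎)
        where
        double : ∀ x y → (1# + 1#) * x ≈ (x + y) + (x - y)
        double x y = trans (trans (distribʳ x 1# 1#) (+-cong (*-identityˡ x) (*-identityˡ x)))
          (solve 2 (λ x y → x :+ x := (x :+ y) :+ (x :- y)) refl x y)
      vδ≈ : ι v * δ ≈ ι v′ * δ
      vδ≈ = begin
        ι v * δ                     ≈⟨ solve 2 (λ x y → y := (x :+ y) :- x) refl (ι u) _ ⟩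
        (ι u + ι v * δ) - ι u       ≈⟨ +-cong eq (-‿cong u≈) ⟩
        (ι u′ + ι v′ * δ) - ι u′    ≈⟨ solve 2 (λ x y → y := (x :+ y) :- x) refl (ι u′) _ ⟨
        ι v′ * δ                    ∎

  private
    K-cardinality : HasCardinality setoid (q ℕ.* q)
    K-cardinality = ≡.subst (HasCardinality setoid) (≡.cong (q ℕ.*_) (ℕ.*-identityʳ q)) finite

    F²-cardinality : HasCardinality (×-setoid F.setoid F.setoid) (q ℕ.* q)
    F²-cardinality = cardinality-× F.finite F.finite

  -- F × F and K both have q² elements, so the injective map `ι+ιδ` is onto.
  decompose : ∀ x → ∃₂ λ u v → x ≈ ι u + ι v * δ
  decompose x =
    let (u , v) , eq = injective⇒surjective F²-cardinality K-cardinality ι+ιδ ι+ιδ-injective x in u , v , sym eq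

  -- Subtracting the conjugate isolates twice the δ-part, which must therefore vanish.
  conj-fixed⇒ι : ∀ {x} → x ^ q ≈ x → ∃[ u ] x ≈ ι u
  conj-fixed⇒ι {x} fixed =
    let u , v , x≈ = decompose x
        vδ≈0 = x+x≈0⇒x≈0 (begin
          ι v * δ + ι v * δ
              ≈⟨ solve 2 (λ x y → y :+ y := (x :+ y) :- (x :- y)) refl (ι u) _ ⟩
          (ι u + ι v * δ) - (ι u - ι v * δ)
              ≈⟨ x≈y⇒x-y≈0 (trans (sym x≈) (trans (sym fixed) (trans (^-congˡ q x≈) (conj-ι+ιδ u v)))) ⟩
          0#                                      ∎)
    in u , trans x≈ (trans (+-congˡ vδ≈0) (+-identityʳ _))

  -- η is the quadratic character of K; κ restricts to that of F, and separates
  -- the two classes of nonzero elements of δF modulo squares of F.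
  κ η : Carrier → Carrier
  κ x = x ^ h
  η x = x ^ (l)

  -- A square root of -1. The values of `κ` on nonzero elements of δF are I and -I.
  I : Carrier
  I = κ δ

  η≈^d^m : ∀ x → η x ≈ (x ^ d) ^ m
  η≈^d^m x = trans (^-congʳ x l≡d*m) (sym (^-assocʳ x d m))

  κ-cong : ∀ {x y} → x ≈ y → κ x ≈ κ y
  κ-cong = ^-congˡ h

  η-cong : ∀ {x y} → x ≈ y → η x ≈ η y
  η-cong = ^-congˡ (l)

  κ-* : ∀ x y → κ (x * y) ≈ κ x * κ y
  κ-* x y = ^-distrib-* x y h

  η-* : ∀ x y → η (x * y) ≈ η x * η y
  η-* x y = ^-distrib-* x y (l)

  η-conj : ∀ x → η (x ^ q) ≈ η x ^ q
  η-conj x = ^-comm x q (l)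

  κ*κ : ∀ x → κ x * κ x ≈ x ^ d
  κ*κ x = trans (sym (^-homo-* x h h)) (^-congʳ x (≡.sym d≡h+h))

  η*η : ∀ {x} → x ≉ 0# → η x * η x ≈ 1#
  η*η {x} x≉0 = trans (trans (sym (^-homo-* x l l)) (^-congʳ x l+l≡N)) (fermat q²≡1+N x≉0)

  η-values : ∀ {x} → x ≉ 0# → η x ≈ 1# ⊎ η x ≈ - 1#
  η-values x≉0 = square≈1 (η*η x≉0)

  η-square : ∀ {x} → x ≉ 0# → η (x * x) ≈ 1#
  η-square {x} x≉0 = trans (η-* x x) (η*η x≉0)

  η-0 : η 0# ≈ 0#
  η-0 = 0^ l

  κ-0 : κ 0# ≈ 0#
  κ-0 = 0^ h

  I≉0 : I ≉ 0#
  I≉0 = ^-≉0 h δ≉0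

  I*I≈-1 : I * I ≈ - 1#
  I*I≈-1 = trans (κ*κ δ) δ^d≈-1

  κ≉0⇒≉0 : ∀ {x} → κ x ≉ 0# → x ≉ 0#
  κ≉0⇒≉0 κx≉0 x≈0 = κx≉0 (trans (κ-cong x≈0) κ-0)

  module _ {x : Carrier} (x≉0 : x ≉ 0#) (conj-x : x ^ q ≈ x) where

    fixed⇒^d≈1 : x ^ d ≈ 1#
    fixed⇒^d≈1 = *-cancelˡ-≉0 x≉0 (trans (sym (conj≈x*x^d x)) (trans conj-x (sym (*-identityʳ x))))

    -- `η` factors through the power d = q - 1, which is 1 on F: nonzero elements of F are squares
    -- of K.
    fixed⇒η≈1 : η x ≈ 1#
    fixed⇒η≈1 = trans (η≈^d^m x) (trans (^-congˡ m fixed⇒^d≈1) (1^ m))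

    fixed⇒κ-values : κ x ≈ 1# ⊎ κ x ≈ - 1#
    fixed⇒κ-values = square≈1 (trans (κ*κ x) fixed⇒^d≈1)

    fixed⇒κ-square : κ (x * x) ≈ 1#
    fixed⇒κ-square = trans (κ-* x x) (trans (κ*κ x) fixed⇒^d≈1)

  module _ {x : Carrier} (x≉0 : x ≉ 0#) (conj-x : x ^ q ≈ - x) where

    anti⇒^d≈-1 : x ^ d ≈ - 1#
    anti⇒^d≈-1 = *-cancelˡ-≉0 x≉0 (trans (sym (conj≈x*x^d x)) (trans conj-x
      (trans (-‿cong (sym (*-identityʳ x))) (-‿distribʳ-* x 1#))))

    -- η x = (-1)^m, and m = 1 + 2r is odd: nonzero elements of δF are nonsquares of K.
    anti⇒η≈-1 : η x ≈ - 1#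
    anti⇒η≈-1 = begin
      η x                            ≈⟨ η≈^d^m x ⟩
      (x ^ d) ^ m            ≈⟨ ^-congˡ m anti⇒^d≈-1 ⟩
      (- 1#) ^ m                     ≈⟨ ^-congʳ (- 1#) (≡.trans m≡1+h (≡.cong suc h≡2*r)) ⟩
      (- 1#) ^ suc (2 ℕ.* r)         ≈⟨ -1^odd r ⟩
      - 1#                           ∎

    anti⇒κ-values : κ x ≈ I ⊎ κ x ≈ - I
    anti⇒κ-values = Sum.map (x-y≈0⇒x≈y _ _) (x+y≈0⇒x≈-y _ _) (*-≈0 (begin
      (κ x - I) * (κ x + I)   ≈⟨ solve 2 (λ x y → (x :- y) :* (x :+ y) := x :* x :- y :* y) refl (κ x) I ⟩
      κ x * κ x - I * I       ≈⟨ x≈y⇒x-y≈0 (trans (κ*κ x) (trans anti⇒^d≈-1 (sym I*I≈-1))) ⟩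
      0#                      ∎))

  -- Points with κ (g v) = I therefore lie on the quadric (`Inv-κ`).
  κ≈I⇒anti : ∀ {x} → κ x ≈ I → x ^ q ≈ - x
  κ≈I⇒anti {x} κx≈I = begin
    x ^ q                ≈⟨ conj≈x*x^d x ⟩
    x * x ^ d    ≈⟨ *-congˡ (κ*κ x) ⟨
    x * (κ x * κ x)      ≈⟨ *-congˡ (trans (*-cong κx≈I κx≈I) I*I≈-1) ⟩
    x * - 1#             ≈⟨ trans (sym (-‿distribʳ-* x 1#)) (-‿cong (*-identityʳ x)) ⟩
    - x                  ∎

  -- h = 2r is even; in other words, -1 is a square of F.
  κ-‿ : ∀ x → κ (- x) ≈ κ x
  κ-‿ x = begin
    κ (- x)          ≈⟨ κ≈ (- x) ⟩
    (- x * - x) ^ r  ≈⟨ ^-congˡ r (solve 1 (λ x → :- x :* :- x := x :* x) refl x) ⟩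
    (x * x) ^ r      ≈⟨ κ≈ x ⟨
    κ x              ∎
    where
    κ≈ : ∀ x → κ x ≈ (x * x) ^ r
    κ≈ x = trans (^-congʳ x h≡2*r) (trans (sym (^-assocʳ x 2 r)) (^-congˡ r (*-congˡ (*-identityʳ x))))

  ι-fixed⇒η≈1 : ∀ {u} → u F.≉ F.0# → η (ι u) ≈ 1#
  ι-fixed⇒η≈1 {u} u≉0 = fixed⇒η≈1 (ι≉0 u≉0) (conj-ι u)

  κ-ι-square : ∀ {u} → u F.≉ F.0# → κ (ι u * ι u) ≈ 1#
  κ-ι-square {u} u≉0 = fixed⇒κ-square (ι≉0 u≉0) (conj-ι u)

  private
    ∣q²-1 : ∀ e {j} → e ℕ.* j ≡ N → e ∣ q ℕ.^ 2 ∸ 1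
    ∣q²-1 e {j} ej≡N = divides j (≡.trans (≡.cong (_∸ 1) q²≡1+N) (≡.trans (≡.sym ej≡N) (ℕ.*-comm e j)))

  C₀-2⇒η≈1 : ∀ {x} → x ∈ C₀ 2 → η x ≈ 1#
  C₀-2⇒η≈1 = ∈⇒^≈1 q²≡1+N {m = l} (C₀-index 2 (∣q²-1 2 {l} 2*l≡N)) 2*l≡N

  η≈1⇒C₀-2 : ∀ {x} → x ≉ 0# → η x ≈ 1# → x ∈ C₀ 2
  η≈1⇒C₀-2 = ^≈1⇒∈ q²≡1+N {m = l} (C₀-index 2 (∣q²-1 2 {l} 2*l≡N)) 2*l≡N

  C₀-2[q+1]⇒κ≈1 : ∀ {x} → x ∈ C₀ (2 ℕ.* suc q) → κ x ≈ 1#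
  C₀-2[q+1]⇒κ≈1 = ∈⇒^≈1 q²≡1+N (C₀-index (2 ℕ.* suc q) (∣q²-1 (2 ℕ.* suc q) 2*1+q*h≡N)) 2*1+q*h≡N

  κ≈1⇒C₀-2[q+1] : ∀ {x} → x ≉ 0# → κ x ≈ 1# → x ∈ C₀ (2 ℕ.* suc q)
  κ≈1⇒C₀-2[q+1] = ^≈1⇒∈ q²≡1+N (C₀-index (2 ℕ.* suc q) (∣q²-1 (2 ℕ.* suc q) 2*1+q*h≡N)) 2*1+q*h≡N

  private
    j*[2*s]≡s*j+s*j : ∀ j s → j ℕ.* (2 ℕ.* s) ≡ s ℕ.* j ℕ.+ s ℕ.* j
    j*[2*s]≡s*j+s*j j s = ≡.trans (ℕ.*-comm j (2 ℕ.* s))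
        (≡.trans (≡.cong (ℕ._* j) (≡.cong (s ℕ.+_) (ℕ.+-identityʳ s))) (ℕ.*-distribʳ-+ j s s))

  conj-norm : ∀ x → (x ^ suc q) ^ q ≈ x ^ suc q
  conj-norm x = begin
    (x * x ^ q) ^ q      ≈⟨ conj-* x (x ^ q) ⟩
    x ^ q * (x ^ q) ^ q  ≈⟨ *-congˡ (conj-involutive x) ⟩
    x ^ q * x            ≈⟨ *-comm _ _ ⟩
    x * x ^ q            ∎

  -- For x = γ^i, κ x = 1 means that 2(q + 1) divides i, and γ^(q+1) lies in F because it is a norm.
  κ≈1⇒square : ∀ {x} → x ≉ 0# → κ x ≈ 1# → ∃[ u ] x ≈ ι u * ι u
  κ≈1⇒square {x} x≉0 κx≈1 = root (*-cancelʳ-∣ {2 ℕ.* suc q} {i} h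
    (≡.subst (_∣ i ℕ.* h) (≡.sym 2*1+q*h≡N) (order∣ q²≡1+N γ^ih≈1)))
    where
    i = proj₁ (proj₂ γ-primitive x x≉0)
    x≈γ^i : x ≈ γ ^ i
    x≈γ^i = proj₂ (proj₂ γ-primitive x x≉0)
    γ^ih≈1 : γ ^ (i ℕ.* h) ≈ 1#
    γ^ih≈1 = trans (sym (^-assocʳ γ i h)) (trans (κ-cong (sym x≈γ^i)) κx≈1)
    root : 2 ℕ.* suc q ∣ i → ∃[ u ] x ≈ ι u * ι u
    root (divides j i≡) = proj₁ lift , (begin
      x                                      ≈⟨ x≈γ^i ⟩
      γ ^ i                                  ≈⟨ ^-congʳ γ (≡.trans i≡ (j*[2*s]≡s*j+s*j j (suc q))) ⟩
      γ ^ (suc q ℕ.* j ℕ.+ suc q ℕ.* j)      ≈⟨ ^-homo-* γ (suc q ℕ.* j) _ ⟩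
      γ ^ (suc q ℕ.* j) * γ ^ (suc q ℕ.* j)  ≈⟨ *-cong (proj₂ lift) (proj₂ lift) ⟩
      ι (proj₁ lift) * ι (proj₁ lift)        ∎)
      where
      lift : ∃[ u ] γ ^ (suc q ℕ.* j) ≈ ι u
      lift = conj-fixed⇒ι (begin
        (γ ^ (suc q ℕ.* j)) ^ q                ≈⟨ ^-congˡ q (^-assocʳ γ (suc q) j) ⟨
        ((γ ^ suc q) ^ j) ^ q                  ≈⟨ ^-comm (γ ^ suc q) j q ⟩
        ((γ ^ suc q) ^ q) ^ j                  ≈⟨ ^-congˡ j (conj-norm γ) ⟩
        (γ ^ suc q) ^ j                        ≈⟨ ^-assocʳ γ (suc q) j ⟩
        γ ^ (suc q ℕ.* j)                      ∎)

  -- A nonsquare of F, since κ (δ²) = I² = -1. It serves as μ in the hyperbolic case and on lines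
  -- where g vanishes.
  ν : ∃[ u ] δ * δ ≈ ι u
  ν = conj-fixed⇒ι (trans (conj-* δ δ)
    (trans (*-cong conj-δ conj-δ) (solve 1 (λ x → :- x :* :- x := x :* x) refl δ)))

  κ-δ² : κ (δ * δ) ≈ - 1#
  κ-δ² = trans (κ-* δ δ) I*I≈-1

  ½+½≈1 : ½ + ½ ≈ 1#
  ½+½≈1 = trans (+-cong (sym (*-identityˡ ½)) (sym (*-identityˡ ½)))
    (trans (sym (distribʳ ½ 1# 1#)) (⁻¹-inverseʳ 1+1≉0))

  ½≉0 : ½ ≉ 0#
  ½≉0 = x⁻¹≉0 1+1≉0

  conj-½ : ½ ^ q ≈ ½
  conj-½ = *-cancelˡ-≉0 1+1≉0 (trans (double (½ ^ q)) (trans (sym (conj-+ ½ ½))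
    (trans (^-congˡ q ½+½≈1) (trans (1^ q) (trans (sym ½+½≈1) (sym (double ½)))))))
    where
    double : ∀ x → (1# + 1#) * x ≈ x + x
    double x = trans (distribʳ x 1# 1#) (+-cong (*-identityˡ x) (*-identityˡ x))

-- The quadric

module Quadric {c₁ ℓ₁ c₂ ℓ₂ a : Level} (p k : ℕ) {q : ℕ}
  (p-prime : Prime p) (q≡p^k : q ≡ p ℕ.^ k) (E : Exponents q (suc q / 2))
  (F : FiniteField c₁ ℓ₁ q) (K : FiniteField c₂ ℓ₂ (q ℕ.^ 2))
  (ι : FiniteField.Carrier F → FiniteField.Carrier K)
  (ι-hom : IsRingHomomorphism (FiniteField.rawRing F) (FiniteField.rawRing K) ι)
  (γ : FiniteField.Carrier K) (γ-primitive : FiniteField.IsPrimitive K γ)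
  (C₀ : ℕ → Pred (FiniteField.Carrier K) a)
  (C₀-index : ∀ e → e ∣ q ℕ.^ 2 ∸ 1 → FiniteField.IsSubgroupOfIndex K e (C₀ e))
  where

  private
    module F where
      open FiniteField F public
      open FieldProperties F public
    module ι = IsRingHomomorphism ι-hom
  open FiniteField K hiding (zero)
  open FieldProperties K
  open SetoidReasoning setoid
  open Geometry q F K ι ι-hom
  open Construction γ C₀ hiding (δ)
  open QuadraticExtension p k p-prime q≡p^k E F K ι ι-hom γ γ-primitive C₀ C₀-index

  -- Vectors are compared through their coordinates in K, so that all
  -- computations take place in K.
  data Axis : Set where
    x-axis y-axis z-axis : Axis

  coord : Axis → V → Carrier
  coord x-axis (x , y , z) = ι x
  coord y-axis (x , y , z) = y
  coord z-axis (x , y , z) = z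

  X Y Z : V → Carrier
  X = coord x-axis
  Y = coord y-axis
  Z = coord z-axis

  coord-cong : ∀ i {v w} → v ≈ᵥ w → coord i v ≈ coord i w
  coord-cong x-axis (x≈ , _ , _) = ι.⟦⟧-cong x≈
  coord-cong y-axis (_ , y≈ , _) = y≈
  coord-cong z-axis (_ , _ , z≈) = z≈

  coord-injective : ∀ {v w} → (∀ i → coord i v ≈ coord i w) → v ≈ᵥ w
  coord-injective eq = ι-injective (eq x-axis) , eq y-axis , eq z-axis

  coord-0 : ∀ i → coord i 0ᵥ ≈ 0#
  coord-0 x-axis = ι.0#-homo
  coord-0 y-axis = refl
  coord-0 z-axis = refl

  coord-· : ∀ i c v → coord i (c · v) ≈ ι c * coord i v
  coord-· x-axis c v = ι.*-homo c _
  coord-· y-axis c v = refl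
  coord-· z-axis c v = refl

  coord-+ᵥ : ∀ i v w → coord i (v +ᵥ w) ≈ coord i v + coord i w
  coord-+ᵥ x-axis v w = ι.+-homo _ _
  coord-+ᵥ y-axis v w = refl
  coord-+ᵥ z-axis v w = refl

  lin : F.Carrier → F.Carrier → V → V → V
  lin s t v w = s · v +ᵥ t · w

  coord-lin : ∀ i s t v w → coord i (lin s t v w) ≈ ι s * coord i v + ι t * coord i w
  coord-lin i s t v w = trans (coord-+ᵥ i _ _) (+-cong (coord-· i s v) (coord-· i t w))

  -- On the quadric f = g + g^q, so there g takes its values in δF.
  g : V → Carrier
  g v = Y v * Z v + ½ * (X v * X v)

  -- The polar form of g. The coefficient is written ½ + ½ instead of 1 so that `g-lin` and the
  -- identities below are polynomial identities with ½ as an indeterminate.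
  B : V → V → Carrier
  B v w = Y v * Z w + Y w * Z v + (½ + ½) * (X v * X w)

  g-≈ : ∀ {v x y z} → X v ≈ x → Y v ≈ y → Z v ≈ z → g v ≈ y * z + ½ * (x * x)
  g-≈ x≈ y≈ z≈ = +-cong (*-cong y≈ z≈) (*-congˡ (*-cong x≈ x≈))

  g-cong : ∀ {v w} → v ≈ᵥ w → g v ≈ g w
  g-cong {v} {w} v≈w = g-≈ {v} (coord-cong x-axis v≈w) (coord-cong y-axis v≈w) (coord-cong z-axis v≈w)

  g-· : ∀ c v → g (c · v) ≈ ι c * ι c * g v
  g-· c v = trans (g-≈ {c · v} (coord-· x-axis c v) refl refl)
    (solve 5 (λ c h x y z → c :* y :* (c :* z) :+ h :* (c :* x :* (c :* x)) := c :* c :*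
        (y :* z :+ h :* (x :* x)))
      refl (ι c) ½ (X v) (Y v) (Z v))

  g-lin : ∀ s t v w → g (lin s t v w) ≈ ι s * ι s * g v + ι s * ι t * B v w + ι t * ι t * g w
  g-lin s t v w = trans (g-≈ {lin s t v w} (coord-lin x-axis s t v w) refl refl)
    (solve 9 (λ s t h x y z x′ y′ z′ →
      (s :* y :+ t :* y′) :* (s :* z :+ t :* z′) :+ h :* ((s :* x :+ t :* x′) :* (s :* x :+ t :* x′)) :=
      s :* s :* (y :* z :+ h :* (x :* x)) :+ s :* t :* (y :* z′ :+ y′ :* z :+ (h :+ h) :* (x :* x′)) :+ t :* t
          :* (y′ :* z′ :+ h :* (x′ :* x′)))
      refl (ι s) (ι t) ½ (X v) (Y v) (Z v) (X w) (Y w) (Z w))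

  -- Equivalent to f v = 0, and to g v lying in δF.
  Isotropic : V → Set ℓ₂
  Isotropic v = g v ^ q ≈ - g v

  f≈g+conj-g : ∀ v → f v ≈ g v + g v ^ q
  f≈g+conj-g v = begin
    X v ^ 2 + (Y v * Z v + (Y v * Z v) ^ q)      ≈⟨ +-congʳ (begin
      X v ^ 2                   ≈⟨ *-congˡ (*-identityʳ (X v)) ⟩
      x²                        ≈⟨ *-identityˡ x² ⟨
      1# * x²                   ≈⟨ *-congʳ ½+½≈1 ⟨
      (½ + ½) * x²              ≈⟨ distribʳ x² ½ ½ ⟩
      ½ * x² + ½ * x²           ∎) ⟩
    (½ * x² + ½ * x²) + (Y v * Z v + (Y v * Z v) ^ q)
      ≈⟨ solve 3 (λ x u w → (x :+ x) :+ (u :+ w) := (u :+ x) :+ (w :+ x)) refl _ _ _ ⟩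
    g v + ((Y v * Z v) ^ q + ½ * x²)             ≈⟨ +-congˡ (begin
      g v ^ q                               ≈⟨ conj-+ (Y v * Z v) (½ * x²) ⟩
      (Y v * Z v) ^ q + (½ * x²) ^ q        ≈⟨ +-congˡ (conj-* ½ x²) ⟩
      (Y v * Z v) ^ q + ½ ^ q * x² ^ q
          ≈⟨ +-congˡ (*-cong conj-½ (trans (conj-* (X v) (X v)) (*-cong conj-X conj-X))) ⟩
      (Y v * Z v) ^ q + ½ * x²              ∎) ⟨
    g v + g v ^ q                                ∎
    where
    x² = X v * X v
    conj-X : X v ^ q ≈ X v
    conj-X = conj-ι (proj₁ v)

  f≈0⇒isotropic : ∀ v → f v ≈ 0# → Isotropic v
  f≈0⇒isotropic v fv≈0 = x+y≈0⇒x≈-y _ _ (trans (+-comm _ _) (trans (sym (f≈g+conj-g v)) fv≈0))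

  isotropic⇒f≈0 : ∀ v → Isotropic v → f v ≈ 0#
  isotropic⇒f≈0 v iso = trans (f≈g+conj-g v) (trans (+-congˡ iso) (-‿inverseʳ (g v)))

  -- On the quadric, the union ℳ is the set of points ⟨v⟩ with D v.
  D : V → Set ℓ₂
  D v = κ (g v) ≈ I ⊎ (g v ≈ 0# × η (Y v) ≉ - 1# × η (Z v) ≉ - 1#)

  D? : ∀ v → Dec (D v)
  D? v = (κ (g v) ≟ I) ⊎-dec ((g v ≟ 0#) ×-dec ¬? (η (Y v) ≟ (- 1#)) ×-dec ¬? (η (Z v) ≟ (- 1#)))

  κ≈I⇒≉0 : ∀ {x} → κ x ≈ I → x ≉ 0#
  κ≈I⇒≉0 κx≈I = κ≉0⇒≉0 (I≉0 ∘ trans (sym κx≈I))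

  -- Scaling multiplies g by the square of an element of F, where `κ` is 1, and the coordinates by
  -- an element of F, where `η` is 1.
  D-scale : ∀ {c v w} → c F.≉ F.0# → v ≈ᵥ c · w → D w → D v
  D-scale {c} {v} {w} c≉0 v≈cw = Sum.map
    (λ κgw≈I → trans (κ-cong g-scale)
        (trans (κ-* _ _) (trans (*-congʳ (κ-ι-square c≉0)) (trans (*-identityˡ _) κgw≈I))))
    (λ (gw≈0 , ηY , ηZ) → trans g-scale (trans (*-congˡ gw≈0) (zeroʳ _)) ,
      (λ eq → ηY (trans (sym (η-scale y-axis)) eq)) , (λ eq → ηZ (trans (sym (η-scale z-axis)) eq)))
    where
    g-scale : g v ≈ ι c * ι c * g w
    g-scale = trans (g-cong v≈cw) (g-· c w)
    η-scale : ∀ i → η (coord i v) ≈ η (coord i w)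
    η-scale i = trans (η-cong (trans (coord-cong i v≈cw) (coord-· i c w)))
      (trans (η-* _ _) (trans (*-congʳ (ι-fixed⇒η≈1 c≉0)) (*-identityˡ _)))

  isotropic-scale : ∀ {c v w} → v ≈ᵥ c · w → Isotropic w → Isotropic v
  isotropic-scale {c} {v} {w} v≈cw iso = begin
    g v ^ q                            ≈⟨ ^-congˡ q gv≈ ⟩
    (ι c * ι c * g w) ^ q              ≈⟨ trans (conj-* _ _) (*-congʳ (conj-* _ _)) ⟩
    ι c ^ q * ι c ^ q * g w ^ q        ≈⟨ *-cong (*-cong (conj-ι c) (conj-ι c)) iso ⟩
    ι c * ι c * - g w                  ≈⟨ -‿distribʳ-* _ _ ⟨
    - (ι c * ι c * g w)                ≈⟨ -‿cong gv≈ ⟨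
    - g v                              ∎
    where
    gv≈ : g v ≈ ι c * ι c * g w
    gv≈ = trans (g-cong v≈cw) (g-· c w)

  D-∼ : ∀ {P R} → P ∼ R → D (vec R) → D (vec P)
  D-∼ (c , c≉0 , P≈cR) = D-scale c≉0 P≈cR

  1≉-1 : 1# ≉ - 1#
  1≉-1 = x≉-x 1≉0

  -- `D` has to admit zero coordinates, hence its conditions η ≉ -1 in place of η ≈ 1.
  η-0≉-1 : ∀ {x} → x ≈ 0# → η x ≉ - 1#
  η-0≉-1 x≈0 eq = -1≉0 (trans (sym eq) (trans (η-cong x≈0) η-0))

  η≉-1⇒η≈1 : ∀ {x} → x ≉ 0# → η x ≉ - 1# → η x ≈ 1#
  η≉-1⇒η≈1 x≉0 ηx≉-1 = Sum.fromInj₁ (⊥-elim ∘ ηx≉-1) (η-values x≉0)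

  -- The conclusion is not η t ≈ 1 because s may be 0, and then η t = 0.
  η-square-multiple : ∀ {c} s {t} → η c ≈ 1# → t ≈ c * (s * s) → η t ≉ - 1#
  η-square-multiple {c} s {t} ηc≈1 t≈ ηt≈-1 with s ≟ 0#
  ... | yes s≈0 = η-0≉-1 (trans t≈ (trans (*-congˡ (trans (*-congˡ s≈0) (zeroʳ s))) (zeroʳ c))) ηt≈-1
  ... | no  s≉0 = 1≉-1 (begin
    1#                  ≈⟨ *-identityˡ 1# ⟨
    1# * 1#             ≈⟨ *-cong ηc≈1 (η-square s≉0) ⟨
    η c * η (s * s)     ≈⟨ η-* c (s * s) ⟨
    η (c * (s * s))     ≈⟨ η-cong t≈ ⟨
    η t                 ≈⟨ ηt≈-1 ⟩
    - 1#                ∎)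

  -½≉0 : - ½ ≉ 0#
  -½≉0 -½≈0 = ½≉0 (trans (sym (-‿involutive ½)) (trans (-‿cong -½≈0) -0#≈0#))

  η[-½]≈1 : η (- ½) ≈ 1#
  η[-½]≈1 = fixed⇒η≈1 -½≉0 (trans (conj-‿ ½) (-‿cong conj-½))

  η½≈1 : η ½ ≈ 1#
  η½≈1 = fixed⇒η≈1 ½≉0 conj-½

  singular⇒YZ≈ : ∀ v → g v ≈ 0# → Y v * Z v ≈ - ½ * (X v * X v)
  singular⇒YZ≈ v gv≈0 = trans (x+y≈0⇒x≈-y _ _ gv≈0) (-‿distribˡ-* _ _)

  singular⇒X≈0 : ∀ v → g v ≈ 0# → Y v * Z v ≈ 0# → X v ≈ 0#
  singular⇒X≈0 v gv≈0 yz≈0 = square≈0 (x*y≈0⇒y≈0 -½≉0 (trans (sym (singular⇒YZ≈ v gv≈0)) yz≈0))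

  -- Pairs of vectors of which exactly one satisfies D

  Flip : V → V → Set ℓ₂
  Flip v w = (D v → ¬ D w) × (¬ D v → D w)

  -- By isotropy κ (g v) is I or -I, and a factor with κ c = -1 exchanges these. The other
  -- alternative of `D` cannot occur, as c and g v are nonzero.
  flip-similitude : ∀ {c v w} → κ c ≈ - 1# → g v ≉ 0# → Isotropic v → g w ≈ c * g v → Flip v w
  flip-similitude {c} {v} {w} κc≈-1 gv≉0 iso gw≈cgv =
    Sum.[ (λ κgv≈I → Sum.[ (λ κgw≈I → x≉-x I≉0 (trans (sym κgw≈I) (trans κgw≈ (-‿cong κgv≈I))))
                         , (λ (gw≈0 , _) → gv≉0 (x*y≈0⇒y≈0 c≉0 (trans (sym gw≈cgv) gw≈0))) ])
        , (λ (gv≈0 , _) _ → gv≉0 gv≈0) ] ,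
    (λ ¬Dv → inj₁ (trans κgw≈ (trans
        (-‿cong (Sum.fromInj₂ (λ κgv≈I → ⊥-elim (¬Dv (inj₁ κgv≈I))) (anti⇒κ-values gv≉0 iso)))
      (-‿involutive I))))
    where
    c≉0 : c ≉ 0#
    c≉0 = κ≉0⇒≉0 (-1≉0 ∘ trans (sym κc≈-1))
    κgw≈ : κ (g w) ≈ - κ (g v)
    κgw≈ = begin
      κ (g w)          ≈⟨ κ-cong gw≈cgv ⟩
      κ (c * g v)      ≈⟨ κ-* c (g v) ⟩
      κ c * κ (g v)    ≈⟨ *-congʳ κc≈-1 ⟩
      - 1# * κ (g v)   ≈⟨ -‿distribˡ-* 1# _ ⟨
      - (1# * κ (g v)) ≈⟨ -‿cong (*-identityˡ _) ⟩
      - κ (g v)        ∎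

  data YZ-Axis : Set where
    y-axis z-axis : YZ-Axis

  yz : YZ-Axis → V → Carrier
  yz y-axis = Y
  yz z-axis = Z

  -- The nonzero y and z coordinates of a zero of g are in a single class modulo
  -- squares, because -½ is a square of K; this class decides whether D v holds.
  singular-class : ∀ v → ¬ v ≈ᵥ 0ᵥ → g v ≈ 0# →
    ∃[ i ] yz i v ≉ 0# × (D v → η (yz i v) ≈ 1#) × (η (yz i v) ≈ 1# → D v)
  singular-class v v≉0 gv≈0 with Y v ≟ 0# | Z v ≟ 0#
  ... | yes Y≈0 | yes Z≈0 = ⊥-elim
      (v≉0 (ι≈0⇒≈0 (singular⇒X≈0 v gv≈0 (trans (*-congʳ Y≈0) (zeroˡ _))) , Y≈0 , Z≈0))
  ... | no  Y≉0 | _ = y-axis , Y≉0 , (λ Dv → η≉-1⇒η≈1 Y≉0 (proj₁ (D⇒ Dv))) ,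
    (λ ηY≈1 → inj₂ (gv≈0 , (λ ηY≈-1 → 1≉-1 (trans (sym ηY≈1) ηY≈-1)) ,
      (λ ηZ≈-1 → YZ≉ (trans (η-* _ _) (trans (*-cong ηY≈1 ηZ≈-1) (*-identityˡ _))))))
    where
    D⇒ : D v → η (Y v) ≉ - 1# × η (Z v) ≉ - 1#
    D⇒ = Sum.[ (λ κ≈I → ⊥-elim (κ≈I⇒≉0 κ≈I gv≈0)) , proj₂ ]
    YZ≉ : η (Y v * Z v) ≉ - 1#
    YZ≉ = η-square-multiple (X v) η[-½]≈1 (singular⇒YZ≈ v gv≈0)
  ... | yes _ | no Z≉0 = z-axis , Z≉0 , (λ Dv → η≉-1⇒η≈1 Z≉0 (proj₂ (D⇒ Dv))) ,
    (λ ηZ≈1 → inj₂ (gv≈0 , (λ ηY≈-1 → YZ≉ (trans (η-* _ _) (trans (*-cong ηY≈-1 ηZ≈1) (*-identityʳ _)))) ,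
      (λ ηZ≈-1 → 1≉-1 (trans (sym ηZ≈1) ηZ≈-1))))
    where
    D⇒ : D v → η (Y v) ≉ - 1# × η (Z v) ≉ - 1#
    D⇒ = Sum.[ (λ κ≈I → ⊥-elim (κ≈I⇒≉0 κ≈I gv≈0)) , proj₂ ]
    YZ≉ : η (Y v * Z v) ≉ - 1#
    YZ≉ = η-square-multiple (X v) η[-½]≈1 (singular⇒YZ≈ v gv≈0)

  private
    -- Lets an identity that holds only modulo g v and g w (or B v w) be checked as a polynomial
    -- identity, with the vanishing terms and their multipliers written out.
    drop-zeros : ∀ {x z a y b u} → x ≈ z + (a * y + b * u) → y ≈ 0# → u ≈ 0# → x ≈ z
    drop-zeros x≈ y≈0 u≈0 = trans x≈
        (trans (+-congˡ (trans (+-cong (trans (*-congˡ y≈0) (zeroʳ _)) (trans (*-congˡ u≈0) (zeroʳ _)))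
      (+-identityʳ 0#))) (+-identityʳ _))

  -- Replacing yz by -½x² and y′z′ by -½x′² turns y y′ B into -½ times a perfect square; the exact
  -- correction is y′² g v + y² g w. For z the roles are exchanged.
  yzyzB-identity : ∀ i v w → g v ≈ 0# → g w ≈ 0# →
    yz i v * yz i w * B v w ≈ - ½ * ((X v * yz i w - X w * yz i v) * (X v * yz i w - X w * yz i v))
  yzyzB-identity y-axis v w = drop-zeros
    (solve 7 (λ h x y z x′ y′ z′ → y :* y′ :* (y :* z′ :+ y′ :* z :+ (h :+ h) :* (x :* x′)) :=
        :- h :* ((x :* y′ :- x′ :* y) :* (x :* y′ :- x′ :* y)) :+
        (y′ :* y′ :* (y :* z :+ h :* (x :* x)) :+ y :* y :* (y′ :* z′ :+ h :* (x′ :* x′))))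
      refl ½ (X v) (Y v) (Z v) (X w) (Y w) (Z w))
  yzyzB-identity z-axis v w = drop-zeros
    (solve 7 (λ h x y z x′ y′ z′ → z :* z′ :* (y :* z′ :+ y′ :* z :+ (h :+ h) :* (x :* x′)) :=
        :- h :* ((x :* z′ :- x′ :* z) :* (x :* z′ :- x′ :* z)) :+
        (z′ :* z′ :* (y :* z :+ h :* (x :* x)) :+ z :* z :* (y′ :* z′ :+ h :* (x′ :* x′))))
      refl ½ (X v) (Y v) (Z v) (X w) (Y w) (Z w))

  -- The nonzero coordinates supplied by `singular-class` may sit on different axes for v and w. In
  -- the mixed case, y z′ B = (y z′ + ½ x x′)² modulo g v and g w.
  yzB-identity : ∀ i j v w → g v ≈ 0# → g w ≈ 0# → ∃₂ λ c s → η c ≈ 1# × yz i v * yz j w * B v w ≈ c * (s * s)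
  yzB-identity y-axis y-axis v w gv≈0 gw≈0 = - ½ , _ , η[-½]≈1 , yzyzB-identity y-axis v w gv≈0 gw≈0
  yzB-identity z-axis z-axis v w gv≈0 gw≈0 = - ½ , _ , η[-½]≈1 , yzyzB-identity z-axis v w gv≈0 gw≈0
  yzB-identity y-axis z-axis v w gv≈0 gw≈0 = 1# , Y v * Z w + ½ * (X v * X w) , fixed⇒η≈1 1≉0 (1^ q) ,
    trans (drop-zeros
    (solve 7 (λ h x y z x′ y′ z′ → y :* z′ :* (y :* z′ :+ y′ :* z :+ (h :+ h) :* (x :* x′)) :=
        (y :* z′ :+ h :* (x :* x′)) :* (y :* z′ :+ h :* (x :* x′)) :+
        (y′ :* z′ :* (y :* z :+ h :* (x :* x)) :+ :- (h :* (x :* x)) :* (y′ :* z′ :+ h :* (x′ :* x′))))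
      refl ½ (X v) (Y v) (Z v) (X w) (Y w) (Z w)) gv≈0 gw≈0) (sym (*-identityˡ _))
  yzB-identity z-axis y-axis v w gv≈0 gw≈0 = 1# , Z v * Y w + ½ * (X v * X w) , fixed⇒η≈1 1≉0 (1^ q) ,
    trans (drop-zeros
    (solve 7 (λ h x y z x′ y′ z′ → z :* y′ :* (y :* z′ :+ y′ :* z :+ (h :+ h) :* (x :* x′)) :=
        (z :* y′ :+ h :* (x :* x′)) :* (z :* y′ :+ h :* (x :* x′)) :+
        (y′ :* z′ :* (y :* z :+ h :* (x :* x)) :+ :- (h :* (x :* x)) :* (y′ :* z′ :+ h :* (x′ :* x′))))
      refl ½ (X v) (Y v) (Z v) (X w) (Y w) (Z w)) gv≈0 gw≈0) (sym (*-identityˡ _))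

  -- B v w is a nonsquare of K, so v and w belong to different classes.
  flip-hyperbolic : ∀ {v w} → ¬ v ≈ᵥ 0ᵥ → ¬ w ≈ᵥ 0ᵥ → g v ≈ 0# → g w ≈ 0# → B v w ≉ 0# → B v w ^ q ≈ - B v w →
      Flip v w
  flip-hyperbolic {v} {w} v≉0 w≉0 gv≈0 gw≈0 B≉0 conj-B =
    let i , t≉0 , D⇒ηt , _ = singular-class v v≉0 gv≈0
        j , u≉0 , D⇒ηu , ηu⇒D = singular-class w w≉0 gw≈0
        _ , _ , _ , ηt⇒D = singular-class v v≉0 gv≈0
        c , s , ηc≈1 , tuB≈ = yzB-identity i j v w gv≈0 gw≈0
        ηtuB≉-1 = η-square-multiple s ηc≈1 tuB≈
        ηtuB≈ : η (yz i v * yz j w * B v w) ≈ η (yz i v) * η (yz j w) * - 1#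
        ηtuB≈ = trans (η-* _ _) (*-cong (η-* _ _) (anti⇒η≈-1 B≉0 conj-B))
    in (λ Dv Dw → ηtuB≉-1 (trans ηtuB≈
            (trans (*-congʳ (trans (*-cong (D⇒ηt Dv) (D⇒ηu Dw)) (*-identityˡ 1#))) (*-identityˡ _))))
     , (λ ¬Dv → ηu⇒D (η≉-1⇒η≈1 u≉0 (λ ηu≈-1 → ηtuB≉-1 (trans ηtuB≈ (trans (*-congʳ
         (trans (*-cong (Sum.fromInj₂ (λ ηt≈1 → ⊥-elim (¬Dv (ηt⇒D ηt≈1))) (η-values t≉0)) ηu≈-1) -1*-1≈1))
             (*-identityˡ _))))))

  -- Otherwise g w would be both a square and a nonsquare of K.
  singular-radical : ∀ {v w} → ¬ v ≈ᵥ 0ᵥ → g v ≈ 0# → B v w ≈ 0# → Isotropic w → g w ≈ 0#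
  singular-radical {v} {w} v≉0 gv≈0 B≈0 iso with g w ≟ 0#
  ... | yes gw≈0 = gw≈0
  ... | no  gw≉0 = ⊥-elim (contradiction (proj₁ class) (proj₁ (proj₂ class)))
    where
    class = singular-class v v≉0 gv≈0
    contradiction : ∀ i → yz i v ≉ 0# → ⊥
    contradiction i t≉0 = η-square-multiple (s i) η½≈1 (identity i) (begin
        η (yz i v * yz i v * g w)        ≈⟨ η-* _ _ ⟩
        η (yz i v * yz i v) * η (g w)    ≈⟨ *-cong (η-square t≉0) (anti⇒η≈-1 gw≉0 iso) ⟩
        1# * - 1#                        ≈⟨ *-identityˡ _ ⟩
        - 1#                             ∎)
      where
      s : YZ-Axis → Carrier
      s i = X v * yz i w - X w * yz i v
      identity : ∀ i → yz i v * yz i v * g w ≈ ½ * (s i * s i)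
      identity y-axis = drop-zeros (solve 7 (λ h x y z x′ y′ z′ → y :* y :* (y′ :* z′ :+ h :* (x′ :* x′)) :=
           h :* ((x :* y′ :- x′ :* y) :* (x :* y′ :- x′ :* y)) :+ (:- (y′ :* y′) :* (y :* z :+ h :* (x :* x)) :+
             y :* y′ :* (y :* z′ :+ y′ :* z :+ (h :+ h) :* (x :* x′))))
         refl ½ (X v) (Y v) (Z v) (X w) (Y w) (Z w)) gv≈0 B≈0
      identity z-axis = drop-zeros (solve 7 (λ h x y z x′ y′ z′ → z :* z :* (y′ :* z′ :+ h :* (x′ :* x′)) :=
           h :* ((x :* z′ :- x′ :* z) :* (x :* z′ :- x′ :* z)) :+ (:- (z′ :* z′) :* (y :* z :+ h :* (x :* x)) :+
             z :* z′ :* (y :* z′ :+ y′ :* z :+ (h :+ h) :* (x :* x′))))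
         refl ½ (X v) (Y v) (Z v) (X w) (Y w) (Z w)) gv≈0 B≈0

  -- The set ℳ

  Inv : V → Set ℓ₂
  Inv v = Isotropic v × D v

  Inv-∼ : ∀ {P R} → P ∼ R → Inv (vec R) → Inv (vec P)
  Inv-∼ {P} {R} P∼R@(c , _ , P≈cR) (iso , DR) = isotropic-scale {c} {vec P} {vec R} P≈cR iso , D-∼ {P} {R} P∼R
      DR

  isotropic-≈ : ∀ {v x} → g v ≈ x → x ^ q ≈ - x → Isotropic v
  isotropic-≈ gv≈x conj-x = trans (^-congˡ q gv≈x) (trans conj-x (-‿cong (sym gv≈x)))

  singular⇒isotropic : ∀ {v} → g v ≈ 0# → Isotropic v
  singular⇒isotropic {v} gv≈0 = isotropic-≈ {v} gv≈0 (trans conj-0 (sym -0#≈0#))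

  Inv-κ : ∀ {v} → κ (g v) ≈ I → Inv v
  Inv-κ κ≈I = κ≈I⇒anti κ≈I , inj₁ κ≈I

  Inv-singular : ∀ {v} → g v ≈ 0# → η (Y v) ≉ - 1# → η (Z v) ≉ - 1# → Inv v
  Inv-singular {v} gv≈0 ηY ηZ = singular⇒isotropic {v} gv≈0 , inj₂ (gv≈0 , ηY , ηZ)

  Inv-transfer : ∀ {v w} → g w ≈ g v → η (Y w) ≈ η (Y v) → η (Z w) ≈ η (Z v) → Inv v → Inv w
  Inv-transfer {v} {w} g≈ ηY≈ ηZ≈ (iso , Dv) = isotropic-≈ {w} g≈ iso , Sum.map
    (λ κ≈I → trans (κ-cong g≈) κ≈I)
    (λ (gv≈0 , ηY , ηZ) → trans g≈ gv≈0 , (λ eq → ηY (trans (sym ηY≈) eq)) , (λ eq → ηZ (trans (sym ηZ≈) eq)))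
        Dv

  η-⁻¹ : ∀ {u} → u ≉ 0# → η u ≈ 1# → η (u ⁻¹) ≈ 1#
  η-⁻¹ {u} u≉0 ηu≈1 = begin
    η (u ⁻¹)          ≈⟨ *-identityˡ _ ⟨
    1# * η (u ⁻¹)     ≈⟨ *-congʳ ηu≈1 ⟨
    η u * η (u ⁻¹)    ≈⟨ η-* u (u ⁻¹) ⟨
    η (u * u ⁻¹)      ≈⟨ η-cong (⁻¹-inverseʳ u≉0) ⟩
    η 1#              ≈⟨ fixed⇒η≈1 1≉0 (1^ q) ⟩
    1#                ∎

  g-T : ∀ u (u≉0 : u ≉ 0#) P → g (vec (T u u≉0 P)) ≈ g (vec P)
  g-T u u≉0 P = +-congʳ (begin
    Y v * u * (Z v * u ⁻¹)
        ≈⟨ solve 4 (λ y z u u⁻¹ → y :* u :* (z :* u⁻¹) := y :* z :* (u :* u⁻¹)) refl _ _ _ _ ⟩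
    Y v * Z v * (u * u ⁻¹)      ≈⟨ *-congˡ (⁻¹-inverseʳ u≉0) ⟩
    Y v * Z v * 1#              ≈⟨ *-identityʳ _ ⟩
    Y v * Z v                   ∎)
    where v = vec P

  η-absorb : ∀ {u} y → η u ≈ 1# → η (y * u) ≈ η y
  η-absorb y ηu≈1 = trans (η-* y _) (trans (*-congˡ ηu≈1) (*-identityʳ _))

  g-τ : ∀ P → g (vec (τ P)) ≈ g (vec P)
  g-τ P = +-congʳ (*-comm _ _)

  Inv-τ : ∀ P → Inv (vec P) → Inv (vec (τ P))
  Inv-τ P (iso , DP) = isotropic-≈ {vec (τ P)} (g-τ P) iso , Sum.map (trans (κ-cong (g-τ P)))
    (λ (g≈0 , ηY , ηZ) → trans (g-τ P) g≈0 , ηZ , ηY) DP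

  g-σ : ∀ P → g (vec (σ P)) ≈ g (vec P) ^ q
  g-σ P = begin
    Y v ^ q * Z v ^ q + ½ * (X v * X v)              ≈⟨ +-cong (conj-* _ _) (trans (conj-* _ _) (*-cong conj-½
                                                         (trans (conj-* _ _) (*-cong (conj-ι _) (conj-ι _))))) ⟨
    (Y v * Z v) ^ q + (½ * (X v * X v)) ^ q          ≈⟨ conj-+ _ _ ⟨
    g v ^ q                                          ∎
    where v = vec P

  -- σ conjugates g, which on the quadric only changes its sign, and `κ` ignores signs.
  Inv-σ : ∀ P → Inv (vec P) → Inv (vec (σ P))
  Inv-σ P (iso , DP) = isotropic-≈ {vec (σ P)} (g-σ P) (trans (^-congˡ q iso) (conj-‿ _)) , Sum.map
    (λ κ≈I → trans (κ-cong (trans (g-σ P) iso)) (trans (κ-‿ _) κ≈I))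
    (λ (g≈0 , ηY , ηZ) → trans (g-σ P) (trans (^-congˡ q g≈0) conj-0) , ηY ∘ unconj , ηZ ∘ unconj) DP
    where
    unconj : ∀ {y} → η (y ^ q) ≈ - 1# → η y ≈ - 1#
    unconj {y} eq = begin
      η y              ≈⟨ conj-involutive (η y) ⟨
      (η y ^ q) ^ q    ≈⟨ ^-congˡ q (trans (sym (η-conj y)) eq) ⟩
      (- 1#) ^ q       ≈⟨ conj-‿ 1# ⟩
      - 1# ^ q         ≈⟨ -‿cong (1^ q) ⟩
      - 1#             ∎

  ≈ᵥ⇒∼ : ∀ {P R} → vec P ≈ᵥ vec R → P ∼ R
  ≈ᵥ⇒∼ {P} {R} eq = F.1# , F.1≉0 , ≈ᵥ-trans eq (≈ᵥ-sym (·-identity (vec R)))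

  σσ∼ : ∀ P → P ∼ σ (σ P)
  σσ∼ P = ≈ᵥ⇒∼ {P} {σ (σ P)} (F.refl , sym (conj-involutive _) , sym (conj-involutive _))

  -- Both directions go through the induction together, because `inv-A` turns one into the other.
  A-invariant : ∀ {h} → A h → ∀ P → (Inv (vec P) → Inv (vec (h P))) × (Inv (vec (h P)) → Inv (vec P))
  A-invariant (T-gen u u≉0 u∈) P =
    Inv-transfer {vec P} {vec (T u u≉0 P)} (g-T u u≉0 P) ηYu ηZu , Inv-transfer {vec (T u u≉0 P)} {vec P}
        (sym (g-T u u≉0 P)) (sym ηYu) (sym ηZu)
    where
    ηu≈1 = C₀-2⇒η≈1 u∈
    ηYu = η-absorb (Y (vec P)) ηu≈1
    ηZu = η-absorb (Z (vec P)) (η-⁻¹ u≉0 ηu≈1)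
  A-invariant σ-gen P = Inv-σ P , λ inv → Inv-∼ {P} {σ (σ P)} (σσ∼ P) (Inv-σ (σ P) inv)
  A-invariant τ-gen P = Inv-τ P , Inv-τ (τ P)
  A-invariant id-A P = id , id
  A-invariant (∘-A {g} {h} a b) P =
    proj₁ (A-invariant a (h P)) ∘ proj₁ (A-invariant b P) , proj₂ (A-invariant b P) ∘ proj₂
        (A-invariant a (h P))
  A-invariant (inv-A {g} {h} a hg gh) P =
    (λ inv → proj₂ (A-invariant a (h P)) (Inv-∼ {g (h P)} {P} (gh P) inv)) ,
    (λ inv → Inv-∼ {P} {g (h P)} (∼-sym {g (h P)} {P} (gh P)) (proj₁ (A-invariant a (h P)) inv))

  O⇒Inv : ∀ {P R} → Inv (vec P) → R ∈ O P → Inv (vec R)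
  O⇒Inv {P} {R} inv (h , a , R∼hP) = Inv-∼ {R} {h P} R∼hP (proj₁ (A-invariant a P) inv)

  C⇒κ≈I : ∀ {w} → w ∈ C (2 ℕ.* suc q) (suc q / 2) → κ w ≈ I
  C⇒κ≈I (h , h∈ , w≈) = trans (κ-cong w≈) (trans (κ-* δ h) (trans (*-congˡ (C₀-2[q+1]⇒κ≈1 h∈)) (*-identityʳ I)))

  -- g is 0 at the first two base points, δ at the third, and w on S, where the summand -½ cancels
  -- the term ½x² of g at x = 1.
  ℳ⇒Inv : ∀ {R} → R ∈ ℳ → Inv (vec R)
  ℳ⇒Inv {R} (inj₁ R∈O) = O⇒Inv {_} {R} (Inv-singular {F.0# , 0# , 1#}
    (trans (+-cong (zeroˡ _) (trans (*-congˡ (ι0*x≈0 F.refl)) (zeroʳ _))) (+-identityʳ _))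
    (η-0≉-1 refl) (λ eq → 1≉-1 (trans (sym (fixed⇒η≈1 1≉0 (1^ q))) eq))) R∈O
  ℳ⇒Inv {R} (inj₂ (inj₁ R∈O)) = O⇒Inv {_} {R} (Inv-singular {F.1# , 1# , - ½}
    (trans (+-cong (*-identityˡ _) (trans (*-congˡ ι1*ι1≈1) (*-identityʳ ½))) (-‿inverseˡ ½))
    (λ eq → 1≉-1 (trans (sym (fixed⇒η≈1 1≉0 (1^ q))) eq)) (λ eq → 1≉-1 (trans (sym η[-½]≈1) eq))) R∈O
  ℳ⇒Inv {R} (inj₂ (inj₂ (inj₁ R∈O))) = O⇒Inv {_} {R} (Inv-κ {F.0# , 1# , δ} (κ-cong
    (trans (+-cong (*-identityˡ _) (trans (*-congˡ (ι0*x≈0 F.refl)) (zeroʳ _))) (+-identityʳ _)))) R∈O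
  ℳ⇒Inv {R} (inj₂ (inj₂ (inj₂ (w , y , w∈C , y≉0 , R∼)))) = Inv-∼ {R} {⟨ v ∣ F.1≉0 ∘ proj₁ ⟩} R∼
      (Inv-κ {v} (trans (κ-cong (begin
    y * (y ⁻¹ * (w - ½)) + ½ * (ι F.1# * ι F.1#)
        ≈⟨ +-cong (sym (*-assoc _ _ _)) (trans (*-congˡ ι1*ι1≈1) (*-identityʳ ½)) ⟩
    y * y ⁻¹ * (w - ½) + ½
        ≈⟨ +-congʳ (trans (*-congʳ (⁻¹-inverseʳ y≉0)) (*-identityˡ _)) ⟩
    (w - ½) + ½                                     ≈⟨ solve 2 (λ w h → (w :- h) :+ h := w) refl w ½ ⟩
    w                                               ∎)) (C⇒κ≈I w∈C)))
    where
    v : V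
    v = F.1# , y , y ⁻¹ * (w - ½)

  -- From D back to the orbits and to S

  τ-∼ : ∀ {P R} → P ∼ R → τ P ∼ τ R
  τ-∼ (c , c≉0 , x≈ , y≈ , z≈) = c , c≉0 , x≈ , z≈ , y≈

  O-τ : ∀ {P R} → τ R ∈ O P → R ∈ O P
  O-τ {P} {R} (h , a , τR∼hP) = τ ∘ h , ∘-A τ-gen a , τ-∼ {τ R} {h P} τR∼hP

  O-T : ∀ {P R} u (u≉0 : u ≉ 0#) → η u ≈ 1# → ∀ c → c F.≉ F.0# → vec R ≈ᵥ c · vec (T u u≉0 P) → R ∈ O P
  O-T u u≉0 ηu≈1 c c≉0 R≈ = T u u≉0 , T-gen u u≉0 (η≈1⇒C₀-2 u≉0 ηu≈1) , c , c≉0 , R≈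

  private
    P₀ : Point
    P₀ = ⟨ (F.0# , 0# , 1#) ∣ (λ (_ , _ , s) → 1≉0 s) ⟩
    P₁ P₂ : Point
    P₁ = ⟨ (F.1# , 1# , - ½) ∣ F.1≉0 ∘ proj₁ ⟩
    P₂ = ⟨ (F.0# , 1# , δ) ∣ (λ (_ , r , _) → 1≉0 r) ⟩

  x≈0⇒g≈ : ∀ {v} → proj₁ v F.≈ F.0# → g v ≈ Y v * Z v
  x≈0⇒g≈ x≈0 = trans (+-congˡ (trans (*-congˡ (ι0*x≈0 x≈0)) (zeroʳ _))) (+-identityʳ _)

  κ[δ⁻¹w]≈1 : ∀ {w} → κ w ≈ I → κ (δ ⁻¹ * w) ≈ 1#
  κ[δ⁻¹w]≈1 {w} κw≈I = *-cancelˡ-≉0 I≉0 (begin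
    I * κ (δ ⁻¹ * w)       ≈⟨ κ-* δ _ ⟨
    κ (δ * (δ ⁻¹ * w))     ≈⟨ κ-cong (x*[x⁻¹*y]≈y δ≉0 w) ⟩
    κ w                    ≈⟨ κw≈I ⟩
    I                      ≈⟨ *-identityʳ I ⟨
    I * 1#                 ∎)

  κ≈I⇒C : ∀ {w} → κ w ≈ I → w ∈ C (2 ℕ.* suc q) (suc q / 2)
  κ≈I⇒C {w} κw≈I = δ ⁻¹ * w , κ≈1⇒C₀-2[q+1] (κ≉0⇒≉0 (1≉0 ∘ trans (sym (κ[δ⁻¹w]≈1 κw≈I)))) (κ[δ⁻¹w]≈1 κw≈I) , sym
      (x*[x⁻¹*y]≈y δ≉0 w)

  module _ {v : V} (x≉0 : proj₁ v F.≉ F.0#) where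

    private
      x = proj₁ v
      v₁ = x F.⁻¹ · v
      y = Y v₁
      z = Z v₁

    x·x⁻¹v≈v : v ≈ᵥ x · v₁
    x·x⁻¹v≈v = ≈ᵥ-trans (≈ᵥ-sym (·-identity v))
        (≈ᵥ-trans (·-cong (F.sym (F.⁻¹-inverseʳ x≉0)) ≈ᵥ-refl) (·-assoc x (x F.⁻¹) v))

    g-v₁ : g v₁ ≈ y * z + ½
    g-v₁ = +-congˡ (trans (*-congˡ (trans (*-cong X≈1 X≈1) (*-identityˡ 1#))) (*-identityʳ ½))
      where
      X≈1 : X v₁ ≈ 1#
      X≈1 = trans (ι.⟦⟧-cong (F.⁻¹-inverseˡ x≉0)) ι.1#-homo

    Inv-v₁ : Inv v → Inv v₁
    Inv-v₁ (iso , Dv) = isotropic-scale {x F.⁻¹} {v₁} {v} ≈ᵥ-refl iso , D-scale {x F.⁻¹} {v₁} {v} (F.x⁻¹≉0 x≉0)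
        ≈ᵥ-refl Dv

    -- With y = 0 one would have g v₁ = ½, which conjugation fixes and, on the quadric, also
    -- negates.
    Y₁≉0 : Inv v → y ≉ 0#
    Y₁≉0 inv y≈0 = x≉-x ½≉0 (begin
      ½            ≈⟨ conj-½ ⟨
      ½ ^ q        ≈⟨ ^-congˡ q g≈½ ⟨
      g v₁ ^ q     ≈⟨ proj₁ (Inv-v₁ inv) ⟩
      - g v₁       ≈⟨ -‿cong g≈½ ⟩
      - ½          ∎)
      where
      g≈½ : g v₁ ≈ ½
      g≈½ = trans g-v₁ (trans (+-congʳ (trans (*-congʳ y≈0) (zeroˡ z))) (+-identityˡ ½))

    yz≈⇒z≈ : ∀ {u} → y ≉ 0# → y * z ≈ u → z ≈ y ⁻¹ * u
    yz≈⇒z≈ y≉0 yz≈u = *-cancelˡ-≉0 y≉0 (trans yz≈u (sym (x*[x⁻¹*y]≈y y≉0 _)))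

    affine : ∀ {y′ z′} → y ≈ y′ → z ≈ z′ → v ≈ᵥ x · (F.1# , y′ , z′)
    affine y≈ z≈ = ≈ᵥ-trans x·x⁻¹v≈v (·-cong F.refl (F.⁻¹-inverseˡ x≉0 , y≈ , z≈))

  Inv⇒ℳ-κ : ∀ R → Inv (vec R) → κ (g (vec R)) ≈ I → R ∈ ℳ
  Inv⇒ℳ-κ R@(⟨ v@(x , y , z) ∣ _ ⟩) inv κ≈I with x F.≟ F.0#
  ... | no x≉0 = inj₂ (inj₂ (inj₂ (g v₁ , Y v₁ , κ≈I⇒C κ-v₁ , Y₁≉0 {v} x≉0 inv , x , x≉0 ,
      affine {v} x≉0 refl (yz≈⇒z≈ {v} x≉0 (Y₁≉0 {v} x≉0 inv)
        (trans (solve 2 (λ u h → u := (u :+ h) :- h) refl _ ½) (+-congʳ (sym (g-v₁ {v} x≉0))))))))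
    where
    v₁ = x F.⁻¹ · v
    κ-v₁ : κ (g v₁) ≈ I
    κ-v₁ = trans (κ-cong (g-· (x F.⁻¹) v))
        (trans (κ-* _ _) (trans (*-cong (κ-ι-square (F.x⁻¹≉0 x≉0)) κ≈I) (*-identityˡ I)))
  -- Now yz = g v is a nonsquare of K, so exactly one of y and z is a square; `τ` moves it to the y
  -- coordinate.
  ... | yes x≈0 = inj₂ (inj₂
      (inj₁ (Sum.[ orbit R κ≈I x≈0 ,
      (λ ηY≈-1 → O-τ {P₂} {R} (orbit (τ R) (trans (κ-cong (g-τ R)) κ≈I) x≈0 (ηZ≈1 ηY≈-1))) ] (η-values Y≉0))))
    where
    g≈yz = x≈0⇒g≈ {v} x≈0
    g≉0 = κ≈I⇒≉0 κ≈I
    Y≉0 : y ≉ 0#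
    Y≉0 y≈0 = g≉0 (trans g≈yz (trans (*-congʳ y≈0) (zeroˡ z)))
    ηZ≈1 : η y ≈ - 1# → η z ≈ 1#
    ηZ≈1 ηy≈-1 = *-cancelˡ-≉0 -1≉0 (begin
      - 1# * η z     ≈⟨ *-congʳ ηy≈-1 ⟨
      η y * η z      ≈⟨ η-* y z ⟨
      η (y * z)      ≈⟨ η-cong g≈yz ⟨
      η (g v)        ≈⟨ anti⇒η≈-1 g≉0 (proj₁ inv) ⟩
      - 1#           ≈⟨ *-identityʳ _ ⟨
      - 1# * 1#      ∎)
    orbit : ∀ R → κ (g (vec R)) ≈ I → proj₁ (vec R) F.≈ F.0# → η (Y (vec R)) ≈ 1# → R ∈ O P₂
    orbit R@(⟨ v@(x , y , z) ∣ _ ⟩) κ≈I x≈0 ηy≈1 = O-T {P₂} {R} u u≉0 ηu≈1 s s≉0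
      (F.trans x≈0 (F.sym (F.zeroʳ s)) , trans y≈ (*-congˡ (sym (*-identityˡ u))) , z≈)
      where
      -- g v = δs² with s in F, so (0, y, z) = s · (0, u, δu⁻¹) for u = y/s, and u is a square of K
      -- because y and s are.
      root = κ≈1⇒square (κ≉0⇒≉0 (1≉0 ∘ trans (sym (κ[δ⁻¹w]≈1 κ≈I)))) (κ[δ⁻¹w]≈1 κ≈I)
      s = proj₁ root
      g≈δs² : g v ≈ δ * (ι s * ι s)
      g≈δs² = trans (sym (x*[x⁻¹*y]≈y δ≉0 (g v))) (*-congˡ (proj₂ root))
      ιs≉0 : ι s ≉ 0#
      ιs≉0 ιs≈0 = κ≈I⇒≉0 κ≈I (trans g≈δs² (trans (*-congˡ (trans (*-congʳ ιs≈0) (zeroˡ _))) (zeroʳ δ)))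
      s≉0 : s F.≉ F.0#
      s≉0 s≈0 = ιs≉0 (trans (ι.⟦⟧-cong s≈0) ι.0#-homo)
      y≉0 : y ≉ 0#
      y≉0 y≈0 = κ≈I⇒≉0 κ≈I (trans (x≈0⇒g≈ {v} x≈0) (trans (*-congʳ y≈0) (zeroˡ z)))
      u = y * ι s ⁻¹
      u≉0 = *-≉0 y≉0 (x⁻¹≉0 ιs≉0)
      ηu≈1 : η u ≈ 1#
      ηu≈1 = trans (η-absorb y (η-⁻¹ ιs≉0 (ι-fixed⇒η≈1 s≉0))) ηy≈1
      y≈ : y ≈ ι s * u
      y≈ = sym (trans (solve 3 (λ s y i → s :* (y :* i) := y :* (s :* i)) refl (ι s) y (ι s ⁻¹))
        (trans (*-congˡ (⁻¹-inverseʳ ιs≉0)) (*-identityʳ y)))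
      z≈ : z ≈ ι s * (δ * u ⁻¹)
      z≈ = *-cancelˡ-≉0 y≉0 (begin
        y * z                                  ≈⟨ x≈0⇒g≈ {v} x≈0 ⟨
        g v                                    ≈⟨ g≈δs² ⟩
        δ * (ι s * ι s)                        ≈⟨ *-identityʳ _ ⟨
        δ * (ι s * ι s) * 1#                   ≈⟨ *-congˡ (⁻¹-inverseʳ u≉0) ⟨
        δ * (ι s * ι s) * (u * u ⁻¹)
            ≈⟨ solve 4 (λ d s u i → d :* (s :* s) :* (u :* i) := s :* u :* (s :* (d :* i))) refl δ (ι s) u
            (u ⁻¹) ⟩
        ι s * u * (ι s * (δ * u ⁻¹))           ≈⟨ *-congʳ y≈ ⟨
        y * (ι s * (δ * u ⁻¹))                 ∎)

  Inv⇒ℳ-singular : ∀ R → Inv (vec R) → g (vec R) ≈ 0# → η (Y (vec R)) ≉ - 1# → η (Z (vec R)) ≉ - 1# → R ∈ ℳ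
  Inv⇒ℳ-singular R@(⟨ v@(x , y , z) ∣ v≉0 ⟩) inv g≈0 ηY ηZ with x F.≟ F.0#
  -- Scaled to x = 1, the vector is (1, y₁, -½y₁⁻¹), the image of (1, 1, -½) under T for u = y₁.
  ... | no x≉0 = inj₂ (inj₁ (O-T {P₁} {R} y₁ y₁≉0 ηy₁≈1 x x≉0 (affine {v} x≉0 (sym (*-identityˡ y₁))
      (trans (yz≈⇒z≈ {v} x≉0 y₁≉0 (x+y≈0⇒x≈-y _ _ (trans (sym (g-v₁ {v} x≉0)) g-v₁≈0))) (*-comm _ _)))))
    where
    y₁ = ι (x F.⁻¹) * y
    y₁≉0 : y₁ ≉ 0#
    y₁≉0 = Y₁≉0 {v} x≉0 inv
    g-v₁≈0 : g (x F.⁻¹ · v) ≈ 0#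
    g-v₁≈0 = trans (g-· (x F.⁻¹) v) (trans (*-congˡ g≈0) (zeroʳ _))
    ηy₁≈1 : η y₁ ≈ 1#
    ηy₁≈1 = η≉-1⇒η≈1 y₁≉0 (λ eq → ηY
        (trans (sym (η-absorb y (ι-fixed⇒η≈1 (F.x⁻¹≉0 x≉0)))) (trans (η-cong (*-comm _ _)) eq)))
  -- Here yz = g v = 0, and `τ` reduces the case z = 0 to y = 0.
  ... | yes x≈0 = inj₁ (Sum.[ (λ y≈0 → orbit R x≈0 y≈0 ηZ) , (λ z≈0 → O-τ {P₀} {R} (orbit (τ R) x≈0 z≈0 ηY)) ]
      (*-≈0 (trans (sym (x≈0⇒g≈ {v} x≈0)) g≈0)))
    where
    orbit : ∀ R → proj₁ (vec R) F.≈ F.0# → Y (vec R) ≈ 0# → η (Z (vec R)) ≉ - 1# → R ∈ O P₀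
    orbit R@(⟨ (x , y , z) ∣ v≉0 ⟩) x≈0 y≈0 ηz = O-T {P₀} {R} (z ⁻¹) (x⁻¹≉0 z≉0) (η-⁻¹ z≉0 (η≉-1⇒η≈1 z≉0 ηz))
        F.1# F.1≉0
      (≈ᵥ-trans (x≈0 , trans y≈0 (sym (zeroˡ _)) , *-cancelˡ-≉0 (x⁻¹≉0 z≉0)
        (trans (⁻¹-inverseˡ z≉0) (sym (trans (*-congˡ (*-identityˡ _)) (⁻¹-inverseʳ (x⁻¹≉0 z≉0))))))
            (≈ᵥ-sym (·-identity _)))
      where
      z≉0 : z ≉ 0#
      z≉0 z≈0 = v≉0 (x≈0 , y≈0 , z≈0)

  Inv⇒ℳ : ∀ R → Inv (vec R) → R ∈ ℳ
  Inv⇒ℳ R inv = Sum.[ Inv⇒ℳ-κ R inv , (λ (g≈0 , ηY , ηZ) → Inv⇒ℳ-singular R inv g≈0 ηY ηZ) ] (proj₂ inv)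

  -- Lines of the quadric

  module Basis (l : Line) where

    open Line l public

    ⟦_,_⟧ : F.Carrier → F.Carrier → V
    ⟦ s , t ⟧ = lin s t (vec P) (vec R)

    coord-⟦⟧ : ∀ i s t → coord i ⟦ s , t ⟧ ≈ ι s * coord i (vec P) + ι t * coord i (vec R)
    coord-⟦⟧ i s t = coord-lin i s t (vec P) (vec R)

    ⟦⟧-cong : ∀ {s s′ t t′} → s F.≈ s′ → t F.≈ t′ → ⟦ s , t ⟧ ≈ᵥ ⟦ s′ , t′ ⟧
    ⟦⟧-cong {s} {s′} {t} {t′} s≈ t≈ = coord-injective {⟦ s , t ⟧} {⟦ s′ , t′ ⟧} λ i → trans (coord-⟦⟧ i s t)
      (trans (+-cong (*-congʳ (ι.⟦⟧-cong s≈)) (*-congʳ (ι.⟦⟧-cong t≈))) (sym (coord-⟦⟧ i s′ t′)))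

    ·-⟦⟧ : ∀ c s t → c · ⟦ s , t ⟧ ≈ᵥ ⟦ c F.* s , c F.* t ⟧
    ·-⟦⟧ c s t = coord-injective {c · ⟦ s , t ⟧} {⟦ c F.* s , c F.* t ⟧} λ i → begin
      coord i (c · ⟦ s , t ⟧)
          ≈⟨ trans (coord-· i c ⟦ s , t ⟧) (*-congˡ (coord-⟦⟧ i s t)) ⟩
      ι c * (ι s * coord i (vec P) + ι t * coord i (vec R))
          ≈⟨ trans (distribˡ _ _ _) (+-cong (sym (*-assoc _ _ _)) (sym (*-assoc _ _ _))) ⟩
      ι c * ι s * coord i (vec P) + ι c * ι t * coord i (vec R)
          ≈⟨ +-cong (*-congʳ (ι.*-homo c s)) (*-congʳ (ι.*-homo c t)) ⟨
      ι (c F.* s) * coord i (vec P) + ι (c F.* t) * coord i (vec R) ≈⟨ coord-⟦⟧ i (c F.* s) (c F.* t) ⟨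
      coord i ⟦ c F.* s , c F.* t ⟧                              ∎

    ⟦s,0⟧ : ∀ s {t} → t F.≈ F.0# → ⟦ s , t ⟧ ≈ᵥ s · vec P
    ⟦s,0⟧ s {t} t≈0 = coord-injective {⟦ s , t ⟧} {s · vec P} λ i → trans (coord-⟦⟧ i s t)
      (trans (+-congˡ (ι0*x≈0 t≈0)) (trans (+-identityʳ _) (sym (coord-· i s (vec P)))))

    ⟦0,t⟧ : ∀ {s} t → s F.≈ F.0# → ⟦ s , t ⟧ ≈ᵥ t · vec R
    ⟦0,t⟧ {s} t s≈0 = coord-injective {⟦ s , t ⟧} {t · vec R} λ i → trans (coord-⟦⟧ i s t)
      (trans (+-congʳ (ι0*x≈0 s≈0)) (trans (+-identityˡ _) (sym (coord-· i t (vec R)))))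

    P≈⟦1,0⟧ : vec P ≈ᵥ ⟦ F.1# , F.0# ⟧
    P≈⟦1,0⟧ = ≈ᵥ-sym (≈ᵥ-trans (⟦s,0⟧ F.1# F.refl) (·-identity (vec P)))

    R≈⟦0,1⟧ : vec R ≈ᵥ ⟦ F.0# , F.1# ⟧
    R≈⟦0,1⟧ = ≈ᵥ-sym (≈ᵥ-trans (⟦0,t⟧ F.1# F.refl) (·-identity (vec R)))

    ·≈0 : ∀ {c v} → ¬ v ≈ᵥ 0ᵥ → c · v ≈ᵥ 0ᵥ → c F.≈ F.0#
    ·≈0 {c} {v} v≉0 cv≈0 with c F.≟ F.0#
    ... | yes c≈0 = c≈0
    ... | no  c≉0 = ⊥-elim (v≉0 (coord-injective {v} {0ᵥ} λ i → trans (x*y≈0⇒y≈0 (ι≉0 c≉0)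
      (trans (sym (coord-· i c v)) (trans (coord-cong i cv≈0) (coord-0 i)))) (sym (coord-0 i))))

    independent : ∀ {s t} → ⟦ s , t ⟧ ≈ᵥ 0ᵥ → s F.≈ F.0# × t F.≈ F.0#
    independent {s} {t} eq with t F.≟ F.0#
    ... | yes t≈0 = ·≈0 {s} {vec P} (vec≉0 P) (≈ᵥ-trans (≈ᵥ-sym (⟦s,0⟧ s t≈0)) eq) , t≈0
    ... | no  t≉0 = ⊥-elim (P≁R (∼-sym {R} {P} (c , c≉0 , R≈cP)))
      where
      c = F.- (t F.⁻¹ F.* s)
      R≈cP : vec R ≈ᵥ c · vec P
      R≈cP = coord-injective {vec R} {c · vec P} λ i → *-cancelˡ-≉0 (ι≉0 t≉0) (begin
        ι t * coord i (vec R)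
            ≈⟨ x+y≈0⇒x≈-y _ _ (trans (+-comm _ _)
            (trans (sym (coord-⟦⟧ i s t)) (trans (coord-cong i eq) (coord-0 i)))) ⟩
        - (ι s * coord i (vec P))
            ≈⟨ -‿cong (*-congʳ (trans (sym (ι.⟦⟧-cong (F.x*[x⁻¹*y]≈y t≉0 s))) (ι.*-homo t _))) ⟩
        - (ι t * ι (t F.⁻¹ F.* s) * coord i (vec P))
                                   ≈⟨ solve 3 (λ x y z → :- (x :* y :* z) := x :* (:- y :* z)) refl _ _ _ ⟩
        ι t * (- ι (t F.⁻¹ F.* s) * coord i (vec P)) ≈⟨ *-congˡ (*-congʳ (ι.-‿homo _)) ⟨
        ι t * (ι c * coord i (vec P)) ≈⟨ *-congˡ (coord-· i c (vec P)) ⟨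
        ι t * coord i (c · vec P)     ∎)
      c≉0 : c F.≉ F.0#
      c≉0 c≈0 = vec≉0 R (coord-injective {vec R} {0ᵥ} λ i → trans (coord-cong i R≈cP)
          (trans (coord-· i c (vec P))
        (trans (ι0*x≈0 c≈0) (sym (coord-0 i)))))

    ⟦⟧-injective : ∀ {s t s′ t′} → ⟦ s , t ⟧ ≈ᵥ ⟦ s′ , t′ ⟧ → s F.≈ s′ × t F.≈ t′
    ⟦⟧-injective {s} {t} {s′} {t′} eq =
      let s-s′≈0 , t-t′≈0 = independent {s F.- s′} {t F.- t′}
              (coord-injective {⟦ s F.- s′ , t F.- t′ ⟧} {0ᵥ} λ i → begin
            coord i ⟦ s F.- s′ , t F.- t′ ⟧
              ≈⟨ coord-⟦⟧ i _ _ ⟩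
            ι (s F.- s′) * coord i (vec P) + ι (t F.- t′) * coord i (vec R)
              ≈⟨ +-cong (*-congʳ (ι-‿- s s′)) (*-congʳ (ι-‿- t t′)) ⟩
            (ι s - ι s′) * coord i (vec P) + (ι t - ι t′) * coord i (vec R)
              ≈⟨ solve 6 (λ s s′ t t′ x y → (s :- s′) :* x :+ (t :- t′) :* y := (s :* x :+ t :* y) :-
                  (s′ :* x :+ t′ :* y)) refl _ _ _ _ _ _ ⟩
            (ι s * coord i (vec P) + ι t * coord i (vec R)) - (ι s′ * coord i (vec P) + ι t′ * coord i (vec R))
              ≈⟨ x≈y⇒x-y≈0 (trans (sym (coord-⟦⟧ i s t)) (trans (coord-cong i eq) (coord-⟦⟧ i s′ t′))) ⟩
            0#
              ≈⟨ coord-0 i ⟨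
            coord i 0ᵥ ∎)
      in F.x-y≈0⇒x≈y s s′ s-s′≈0 , F.x-y≈0⇒x≈y t t′ t-t′≈0
      where
      ι-‿- : ∀ s s′ → ι (s F.- s′) ≈ ι s - ι s′
      ι-‿- s s′ = trans (ι.+-homo s _) (+-congˡ (ι.-‿homo s′))

    NonZero² : F.Carrier → F.Carrier → Set ℓ₁
    NonZero² s t = ¬ (s F.≈ F.0# × t F.≈ F.0#)

    point : ∀ s t → NonZero² s t → Point
    point s t st≉0 = ⟨ ⟦ s , t ⟧ ∣ st≉0 ∘ independent ⟩

    coordinates≉0 : ∀ X {s t} → vec X ≈ᵥ ⟦ s , t ⟧ → NonZero² s t
    coordinates≉0 X {s} {t} X≈ (s≈0 , t≈0) = vec≉0 X
        (≈ᵥ-trans X≈ (coord-injective {⟦ s , t ⟧} {0ᵥ} λ i → trans (coord-⟦⟧ i s t)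
      (trans (+-cong (ι0*x≈0 s≈0) (ι0*x≈0 t≈0))
        (trans (+-identityʳ 0#) (sym (coord-0 i))))))

    proportional : ∀ {v w c s t s′ t′} → v ≈ᵥ c · w → v ≈ᵥ ⟦ s , t ⟧ → w ≈ᵥ ⟦ s′ , t′ ⟧ → s F.≈ c F.* s′ × t F.≈
        c F.* t′
    proportional {v} {w} {c} {s} {t} {s′} {t′} v≈cw v≈ w≈ =
      ⟦⟧-injective {s} {t} {c F.* s′} {c F.* t′}
          (≈ᵥ-trans (≈ᵥ-sym v≈) (≈ᵥ-trans v≈cw (≈ᵥ-trans (·-cong F.refl w≈) (·-⟦⟧ c s′ t′))))

    -- The affine coordinate s/t of a point of the line, with `zero` for the point P at infinity.
    -- The decision is a separate argument so that the lemmas on `slope` can match on it.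
    slope-dec : ∀ s t → Dec (t F.≈ F.0#) → Fin (suc q)
    slope-dec s t (yes _) = zero
    slope-dec s t (no  _) = suc (Inverse.to F.finite (t F.⁻¹ F.* s))

    slope : F.Carrier → F.Carrier → Fin (suc q)
    slope s t = slope-dec s t (t F.≟ F.0#)

    slope-0 : ∀ {s t} → t F.≈ F.0# → slope s t ≡ zero
    slope-0 {s} {t} t≈0 = lemma (t F.≟ F.0#)
      where
      lemma : ∀ t≟0 → slope-dec s t t≟0 ≡ zero
      lemma (yes _)   = ≡.refl
      lemma (no  t≉0) = ⊥-elim (t≉0 t≈0)

    slope-≉0 : ∀ {s t} → t F.≉ F.0# → slope s t ≡ suc (Inverse.to F.finite (t F.⁻¹ F.* s))
    slope-≉0 {s} {t} t≉0 = lemma (t F.≟ F.0#)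
      where
      lemma : ∀ t≟0 → slope-dec s t t≟0 ≡ suc (Inverse.to F.finite (t F.⁻¹ F.* s))
      lemma (yes t≈0) = ⊥-elim (t≉0 t≈0)
      lemma (no  _)   = ≡.refl

    slope-proportional : ∀ {c s t s′ t′} → c F.≉ F.0# → s F.≈ c F.* s′ → t F.≈ c F.* t′ → slope s t ≡ slope s′
        t′
    slope-proportional {c} {s} {t} {s′} {t′} c≉0 s≈ t≈ = lemma (t′ F.≟ F.0#)
      where
      lemma : Dec (t′ F.≈ F.0#) → slope s t ≡ slope s′ t′
      lemma (yes t′≈0) = ≡.trans (slope-0 {s} (F.trans t≈ (F.trans (F.*-congˡ t′≈0) (F.zeroʳ c))))
          (≡.sym (slope-0 {s′} t′≈0))
      lemma (no  t′≉0) = ≡.trans (slope-≉0 {s} t≉0) (≡.trans (≡.cong suc (Inverse.to-cong F.finite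
          (F.*-cancelˡ-≉0 t≉0 (F.trans (F.x*[x⁻¹*y]≈y t≉0 s) (F.trans s≈ (F.sym (F.trans (F.*-congʳ t≈)
            (F.trans (F.*-assoc c t′ _) (F.*-congˡ (F.x*[x⁻¹*y]≈y t′≉0 s′))))))))))
          (≡.sym (slope-≉0 {s′} t′≉0)))
        where
        t≉0 : t F.≉ F.0#
        t≉0 t≈0 = F.*-≉0 c≉0 t′≉0 (F.trans (F.sym t≈) t≈0)

    points-cardinality : HasCardinality (restrict (pointsOf l)) (suc q)
    points-cardinality = mkInverse (restrict (pointsOf l)) (≡.setoid (Fin (suc q))) to from
      (λ {x} {y} → to-cong {x} {y}) (λ { {i} ≡.refl → ∼-refl {proj₁ (from i)} }) to∘from from∘to
      where
      to : ∃[ X ] X ∈ pointsOf l → Fin (suc q)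
      to (X , s , t , _) = slope s t
      from : Fin (suc q) → ∃[ X ] X ∈ pointsOf l
      from zero    = point F.1# F.0# (F.1≉0 ∘ proj₁) , F.1# , F.0# , ≈ᵥ-refl
      from (suc i) = point (Inverse.from F.finite i) F.1# (F.1≉0 ∘ proj₂) , Inverse.from F.finite i , F.1# ,
          ≈ᵥ-refl
      to-cong : ∀ {x y} → proj₁ x ∼ proj₁ y → to x ≡ to y
      to-cong {X , s , t , X≈} {X′ , s′ , t′ , X′≈} (c , c≉0 , X≈cX′) =
        let s≈ , t≈ = proportional {vec X} {vec X′} {c} {s} {t} {s′} {t′} X≈cX′ X≈ X′≈ in slope-proportional c≉0
                s≈ t≈
      to∘from : ∀ i → to (from i) ≡ i
      to∘from zero    = slope-0 {F.1#} F.refl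
      to∘from (suc i) = ≡.trans (slope-≉0 {Inverse.from F.finite i} F.1≉0) (≡.cong suc (≡.trans
        (Inverse.to-cong F.finite (F.trans (F.sym (F.*-identityˡ _)) (F.trans (F.sym (F.*-assoc _ _ _))
          (F.trans (F.*-congʳ (F.⁻¹-inverseʳ F.1≉0)) (F.*-identityˡ _)))))
        (Inverse.inverseˡ F.finite F.refl)))
      from∘to : ∀ x → proj₁ (from (to x)) ∼ proj₁ x
      from∘to (X , s , t , X≈) = lemma (t F.≟ F.0#)
        where
        lemma : Dec (t F.≈ F.0#) → proj₁ (from (slope s t)) ∼ X
        lemma (yes t≈0) rewrite slope-0 {s} t≈0 = s F.⁻¹ , F.x⁻¹≉0 s≉0 ,
            ≈ᵥ-trans (⟦⟧-cong (F.sym (F.⁻¹-inverseˡ s≉0)) (F.sym (F.trans (F.*-congˡ t≈0) (F.zeroʳ _))))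
              (≈ᵥ-trans (≈ᵥ-sym (·-⟦⟧ (s F.⁻¹) s t)) (·-cong F.refl (≈ᵥ-sym X≈)))
          where
          s≉0 : s F.≉ F.0#
          s≉0 s≈0 = coordinates≉0 X {s} {t} X≈ (s≈0 , t≈0)
        lemma (no t≉0) rewrite slope-≉0 {s} t≉0 = t F.⁻¹ , F.x⁻¹≉0 t≉0 ,
            ≈ᵥ-trans (⟦⟧-cong (Inverse.inverseʳ F.finite ≡.refl) (F.sym (F.⁻¹-inverseˡ t≉0)))
              (≈ᵥ-trans (≈ᵥ-sym (·-⟦⟧ (t F.⁻¹) s t)) (·-cong F.refl (≈ᵥ-sym X≈)))

  Half : Line → Set _
  Half l = HasCardinality (restrict (pointsOf l ∩ (D ∘ vec))) (suc q / 2)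

  -- The matrix (0 μ ; 1 0) acts on the points of the line and exchanges the points
  -- satisfying D with the others.
  flip⇒half : ∀ l μ → μ F.≉ F.0# →
    (∀ s t → Basis.NonZero² l s t → Flip (Basis.⟦_,_⟧ l s t) (Basis.⟦_,_⟧ l (μ F.* t) s)) → Half l
  flip⇒half l μ μ≉0 flip = cardinality-via {S = restrict (pointsOf l ∩ (D ∘ vec))}
      (Sub-∩ PG {P = pointsOf l} {R = D ∘ vec})
    (half (restrict (pointsOf l)) {P = D ∘ vec ∘ proj₁}
        (λ {x} {y} x∼y → D-∼ {proj₁ y} {proj₁ x} (∼-sym {proj₁ x} {proj₁ y} x∼y)) (D? ∘ vec ∘ proj₁)
      (≡.subst (HasCardinality (restrict (pointsOf l))) 1+q≡2m points-cardinality)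
      φ (λ {x} {y} → φ-injective {x} {y})
      (λ x@(X , s , t , X≈) DX → proj₁ (flip s t (nz x))
          (D-scale F.1≉0 (≈ᵥ-trans (≈ᵥ-sym X≈) (≈ᵥ-sym (·-identity (vec X)))) DX))
      (λ x@(X , s , t , X≈) ¬DX → proj₂ (flip s t (nz x))
          (λ D⟦⟧ → ¬DX (D-scale F.1≉0 (≈ᵥ-trans X≈ (≈ᵥ-sym (·-identity ⟦ s , t ⟧))) D⟦⟧))))
    where
    open Basis l
    open Exponents E using (h; d≡h+h; q≡1+d; m≡1+h)
    1+q≡2m : suc q ≡ 2 ℕ.* (suc q / 2)
    1+q≡2m = ≡.trans (≡.cong suc (≡.trans q≡1+d (≡.cong suc d≡h+h)))
      (≡.trans (≡.sym (≡.cong suc (ℕ.+-suc h h)))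
          (≡.trans (≡.cong (suc h ℕ.+_) (≡.sym (ℕ.+-identityʳ (suc h)))) (≡.cong (2 ℕ.*_) (≡.sym m≡1+h))))
    nz : ∀ ((X , s , t , _) : ∃[ X ] X ∈ pointsOf l) → NonZero² s t
    nz (X , s , t , X≈) = coordinates≉0 X {s} {t} X≈
    φ-nz : ∀ {s t} → NonZero² s t → NonZero² (μ F.* t) s
    φ-nz st≉0 (μt≈0 , s≈0) = st≉0 (s≈0 , F.x*y≈0⇒y≈0 μ≉0 μt≈0)
    φ : ∃[ X ] X ∈ pointsOf l → ∃[ X ] X ∈ pointsOf l
    φ x@(X , s , t , X≈) = point (μ F.* t) s (φ-nz (nz x)) , μ F.* t , s , ≈ᵥ-refl
    φ-injective : ∀ {x y} → proj₁ (φ x) ∼ proj₁ (φ y) → proj₁ x ∼ proj₁ y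
    φ-injective {X , s , t , X≈} {X′ , s′ , t′ , X′≈} (c , c≉0 , eq) =
      let μt≈ , s≈ = ⟦⟧-injective {μ F.* t} {s} {c F.* (μ F.* t′)} {c F.* s′}
              (≈ᵥ-trans eq (·-⟦⟧ c (μ F.* t′) s′))
          t≈ = F.*-cancelˡ-≉0 μ≉0 (F.trans μt≈
              (F.trans (F.sym (F.*-assoc c μ t′)) (F.trans (F.*-congʳ (F.*-comm c μ)) (F.*-assoc μ c t′))))
      in c , c≉0 , ≈ᵥ-trans X≈ (≈ᵥ-trans (⟦⟧-cong s≈ t≈)
              (≈ᵥ-trans (≈ᵥ-sym (·-⟦⟧ c s′ t′)) (·-cong F.refl (≈ᵥ-sym X′≈))))

  -- Changes of basis of a line

  Half-⊆ : ∀ l l′ → pointsOf l ⊆ pointsOf l′ → pointsOf l′ ⊆ pointsOf l → Half l′ → Half l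
  Half-⊆ l l′ l⊆l′ l′⊆l = cardinality-via {S = restrict (pointsOf l ∩ (D ∘ vec))}
      {T = restrict (pointsOf l′ ∩ (D ∘ vec))}
    (Sub-cong PG {P = pointsOf l ∩ (D ∘ vec)} {R = pointsOf l′ ∩ (D ∘ vec)}
      (λ {X} (X∈l , DX) → l⊆l′ {X} X∈l , DX) (λ {X} (X∈l′ , DX) → l′⊆l {X} X∈l′ , DX))

  module _ (l : Line) where

    open Basis l

    swap-line : Line
    swap-line = record { P = R ; R = P ; P≁R = λ R∼P → P≁R (∼-sym {R} {P} R∼P) }

    swap-≈ : ∀ s t → ⟦ s , t ⟧ ≈ᵥ Basis.⟦_,_⟧ swap-line t s
    swap-≈ s t = F.+-comm _ _ , +-comm _ _ , +-comm _ _

    swap-⊆ : pointsOf l ⊆ pointsOf swap-line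
    swap-⊆ (s , t , X≈) = t , s , ≈ᵥ-trans X≈ (swap-≈ s t)

    swap-⊇ : pointsOf swap-line ⊆ pointsOf l
    swap-⊇ (s , t , X≈) = t , s , ≈ᵥ-trans X≈ (≈ᵥ-sym (swap-≈ t s))

    module _ (α : F.Carrier) {β : F.Carrier} (β≉0 : β F.≉ F.0#) where

      shear-line : Line
      shear-line = record { P = P ; R = point α β (β≉0 ∘ proj₂) ; P≁R = λ (c , c≉0 , P≈cR′) →
        F.*-≉0 c≉0 β≉0 (F.sym (proj₂ (⟦⟧-injective {F.1#} {F.0#} {c F.* α} {c F.* β}
          (≈ᵥ-trans (≈ᵥ-sym P≈⟦1,0⟧) (≈ᵥ-trans P≈cR′ (·-⟦⟧ c α β)))))) }

      shear-≈ : ∀ s t → Basis.⟦_,_⟧ shear-line s t ≈ᵥ ⟦ s F.+ t F.* α , t F.* β ⟧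
      shear-≈ s t = coord-injective {Basis.⟦_,_⟧ shear-line s t} {⟦ s F.+ t F.* α , t F.* β ⟧} λ i → begin
        coord i (Basis.⟦_,_⟧ shear-line s t)
          ≈⟨ trans (Basis.coord-⟦⟧ shear-line i s t) (+-congˡ (*-congˡ (coord-⟦⟧ i α β))) ⟩
        ι s * coord i (vec P) + ι t * (ι α * coord i (vec P) + ι β * coord i (vec R))
          ≈⟨ solve 6 (λ s t a b x y → s :* x :+ t :* (a :* x :+ b :* y) := (s :+ t :* a) :* x :+ t :* b :* y)
              refl _ _ _ _ _ _ ⟩
        (ι s + ι t * ι α) * coord i (vec P) + ι t * ι β * coord i (vec R)
          ≈⟨ +-cong (*-congʳ (trans (ι.+-homo s _) (+-congˡ (ι.*-homo t α)))) (*-congʳ (ι.*-homo t β)) ⟨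
        ι (s F.+ t F.* α) * coord i (vec P) + ι (t F.* β) * coord i (vec R)
          ≈⟨ coord-⟦⟧ i _ _ ⟨
        coord i ⟦ s F.+ t F.* α , t F.* β ⟧ ∎

      shear-⊇ : pointsOf shear-line ⊆ pointsOf l
      shear-⊇ (s , t , X≈) = s F.+ t F.* α , t F.* β , ≈ᵥ-trans X≈ (shear-≈ s t)

      shear-⊆ : pointsOf l ⊆ pointsOf shear-line
      shear-⊆ (s , t , X≈) = s F.- t′ F.* α , t′ , ≈ᵥ-trans X≈ (≈ᵥ-trans (⟦⟧-cong
          (F.solve 2 (λ s u → s F.:= (s F.:- u) F.:+ u) F.refl s (t′ F.* α))
          (F.sym (F.trans (F.*-assoc _ _ _) (F.trans (F.*-congˡ (F.⁻¹-inverseˡ β≉0)) (F.*-identityʳ t)))))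
        (≈ᵥ-sym (shear-≈ _ t′)))
        where t′ = t F.* β F.⁻¹

      half-shear : Half shear-line → Half l
      half-shear = Half-⊆ l shear-line (λ {X} → shear-⊆ {X}) (λ {X} → shear-⊇ {X})

    half-swap : Half swap-line → Half l
    half-swap = Half-⊆ l swap-line (λ {X} → swap-⊆ {X}) (λ {X} → swap-⊇ {X})

  Flip-sym : ∀ {v w} → Flip v w → Flip w v
  Flip-sym {v} {w} (v⇒¬w , ¬v⇒w) = (λ Dw Dv → v⇒¬w Dv Dw) , λ ¬Dw → lemma ¬Dw (D? v)
    where
    lemma : ¬ D w → Dec (D v) → D v
    lemma ¬Dw (yes Dv) = Dv
    lemma ¬Dw (no ¬Dv) = ⊥-elim (¬Dw (¬v⇒w ¬Dv))

  unscale : ∀ {c v w} → c F.≉ F.0# → v ≈ᵥ c · w → w ≈ᵥ c F.⁻¹ · v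
  unscale {c} {v} {w} c≉0 v≈cw = ≈ᵥ-trans (≈ᵥ-sym (·-identity w))
      (≈ᵥ-trans (·-cong (F.sym (F.⁻¹-inverseˡ c≉0)) ≈ᵥ-refl)
    (≈ᵥ-trans (·-assoc (c F.⁻¹) c w) (·-cong F.refl (≈ᵥ-sym v≈cw))))

  Flip-scale : ∀ {c d v w v′ w′} → c F.≉ F.0# → d F.≉ F.0# → v′ ≈ᵥ c · v → w′ ≈ᵥ d · w → Flip v w → Flip v′ w′
  Flip-scale {c} {d} c≉0 d≉0 v′≈ w′≈ (v⇒¬w , ¬v⇒w) =
    (λ Dv′ Dw′ → v⇒¬w (D-scale (F.x⁻¹≉0 c≉0) (unscale c≉0 v′≈) Dv′)
        (D-scale (F.x⁻¹≉0 d≉0) (unscale d≉0 w′≈) Dw′)) ,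
    (λ ¬Dv′ → D-scale d≉0 w′≈ (¬v⇒w (λ Dv → ¬Dv′ (D-scale c≉0 v′≈ Dv))))

  -- Both elements lie in δF, so conjugation fixes their ratio. All values of g and B on a line of
  -- the quadric are of this kind, and these ratios are the coefficients used to change its basis.
  conj-ratio : ∀ {u w} → u ≉ 0# → u ^ q ≈ - u → w ^ q ≈ - w → ∃[ e ] ι e * u ≈ w
  conj-ratio {u} {w} u≉0 conj-u conj-w = let e , x≈ιe = conj-fixed⇒ι fixed in e , trans (*-congʳ (sym x≈ιe))
      xu≈w
    where
    x = w * u ⁻¹
    xu≈w : x * u ≈ w
    xu≈w = trans (*-assoc _ _ _) (trans (*-congˡ (⁻¹-inverseˡ u≉0)) (*-identityʳ w))
    fixed : x ^ q ≈ x
    fixed = *-cancelˡ-≉0 u≉0 (begin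
      u * x ^ q              ≈⟨ solve 2 (λ u y → u :* y := :- (y :* :- u)) refl u _ ⟩
      - (x ^ q * - u)        ≈⟨ -‿cong (*-congˡ conj-u) ⟨
      - (x ^ q * u ^ q)      ≈⟨ -‿cong (conj-* x u) ⟨
      - ((x * u) ^ q)        ≈⟨ -‿cong (trans (^-congˡ q xu≈w) conj-w) ⟩
      - - w                  ≈⟨ -‿involutive w ⟩
      w                      ≈⟨ trans (*-comm u x) xu≈w ⟨
      u * x                  ∎)

  anti-+ : ∀ {x y} → x ^ q ≈ - x → y ^ q ≈ - y → (x + y) ^ q ≈ - (x + y)
  anti-+ {x} {y} conj-x conj-y = trans (conj-+ x y) (trans (+-cong conj-x conj-y)
    (solve 2 (λ x y → :- x :+ :- y := :- (x :+ y)) refl x y))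

  anti-‿ : ∀ {x} → x ^ q ≈ - x → (- x) ^ q ≈ - - x
  anti-‿ conj-x = trans (conj-‿ _) (-‿cong conj-x)

  IsotropicLine : Line → Set _
  IsotropicLine l = ∀ X → X ∈ pointsOf l → Isotropic (vec X)

  B-lin : ∀ s t v w → B v (lin s t v w) ≈ ι s * (g v + g v) + ι t * B v w
  B-lin s t v w = trans (+-cong (+-congˡ refl) (*-congˡ (*-congˡ (coord-lin x-axis s t v w))))
    (solve 9 (λ s t h x y z x′ y′ z′ →
      y :* (s :* z :+ t :* z′) :+ (s :* y :+ t :* y′) :* z :+ (h :+ h) :* (x :* (s :* x :+ t :* x′)) :=
      s :* ((y :* z :+ h :* (x :* x)) :+ (y :* z :+ h :* (x :* x))) :+ t :*
          (y :* z′ :+ y′ :* z :+ (h :+ h) :* (x :* x′)))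
      refl (ι s) (ι t) ½ (X v) (Y v) (Z v) (X w) (Y w) (Z w))

  -- Lines on which g is nondegenerate

  module _ (l : Line) where

    open Basis l

    private
      gP = g (vec P)
      gR = g (vec R)
      β = B (vec P) (vec R)

    g-⟦⟧ : ∀ s t → g ⟦ s , t ⟧ ≈ ι s * ι s * gP + ι s * ι t * β + ι t * ι t * gR
    g-⟦⟧ s t = g-lin s t (vec P) (vec R)

    module _ (iso : IsotropicLine l) where

      isotropic-⟦⟧ : ∀ s t → NonZero² s t → Isotropic ⟦ s , t ⟧
      isotropic-⟦⟧ s t st≉0 = iso (point s t st≉0) (s , t , ≈ᵥ-refl)

      isotropic-P : Isotropic (vec P)
      isotropic-P = iso P (F.1# , F.0# , P≈⟦1,0⟧)

      isotropic-R : Isotropic (vec R)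
      isotropic-R = iso R (F.0# , F.1# , R≈⟦0,1⟧)

      -- β = g (P + R) - g P - g R, and δF contains all three values because the whole line lies on
      -- the quadric.
      conj-β : β ^ q ≈ - β
      conj-β = trans (^-congˡ q β≈)
          (trans (anti-+ (isotropic-⟦⟧ F.1# F.1# (F.1≉0 ∘ proj₁)) (anti-‿ (anti-+ isotropic-P isotropic-R)))
          (-‿cong (sym β≈)))
        where
        1*1* : ∀ x → ι F.1# * ι F.1# * x ≈ x
        1*1* x = trans (*-congʳ ι1*ι1≈1) (*-identityˡ x)
        β≈ : β ≈ g ⟦ F.1# , F.1# ⟧ - (gP + gR)
        β≈ = begin
          β
              ≈⟨ solve 3 (λ x y z → y := (x :+ y :+ z) :- (x :+ z)) refl gP β gR ⟩
          gP + β + gR - (gP + gR)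
              ≈⟨ +-congʳ (trans (g-⟦⟧ F.1# F.1#) (+-cong (+-cong (1*1* gP) (1*1* β)) (1*1* gR))) ⟨
          g ⟦ F.1# , F.1# ⟧ - (gP + gR)      ∎

      flip-P-R : gP ≈ 0# → gR ≈ 0# → β ≉ 0# → Flip (vec P) (vec R)
      flip-P-R gP≈0 gR≈0 β≉0 = flip-hyperbolic (vec≉0 P) (vec≉0 R) gP≈0 gR≈0 β≉0 conj-β

      -- In this basis g = stβ, so away from P and R the map multiplies g by μ, for which the
      -- nonsquare δ² is chosen. The points P and R are exchanged, and `flip-P-R` treats them.
      half-hyperbolic : gP ≈ 0# → gR ≈ 0# → β ≉ 0# → Half l
      half-hyperbolic gP≈0 gR≈0 β≉0 = flip⇒half l μ μ≉0 flip
        where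
        μ = proj₁ ν
        ιμ≈δ² : δ * δ ≈ ι μ
        ιμ≈δ² = proj₂ ν
        μ≉0 : μ F.≉ F.0#
        μ≉0 μ≈0 = *-≉0 δ≉0 δ≉0 (trans ιμ≈δ² (trans (ι.⟦⟧-cong μ≈0) ι.0#-homo))
        g-st : ∀ s t → g ⟦ s , t ⟧ ≈ ι s * ι t * β
        g-st s t = trans (g-⟦⟧ s t)
            (trans (+-cong (trans (+-congʳ (trans (*-congˡ gP≈0) (zeroʳ _))) (+-identityˡ _))
            (trans (*-congˡ gR≈0) (zeroʳ _))) (+-identityʳ _))
        cases : ∀ s t → NonZero² s t → Dec (s F.≈ F.0#) → Dec (t F.≈ F.0#) → Flip ⟦ s , t ⟧ ⟦ μ F.* t , s ⟧
        cases s t st≉0 (yes s≈0) (yes t≈0) = ⊥-elim (st≉0 (s≈0 , t≈0))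
        cases s t st≉0 (yes s≈0) (no  t≉0) = Flip-scale t≉0 (F.*-≉0 μ≉0 t≉0) (⟦0,t⟧ t s≈0) (⟦s,0⟧ (μ F.* t) s≈0)
          (Flip-sym {vec P} {vec R} (flip-P-R gP≈0 gR≈0 β≉0))
        cases s t st≉0 (no  s≉0) (yes t≈0) = Flip-scale s≉0 s≉0 (⟦s,0⟧ s t≈0)
            (⟦0,t⟧ s (F.trans (F.*-congˡ t≈0) (F.zeroʳ μ)))
          (flip-P-R gP≈0 gR≈0 β≉0)
        cases s t st≉0 (no  s≉0) (no  t≉0) = flip-similitude {ι μ} {⟦ s , t ⟧} {⟦ μ F.* t , s ⟧}
            (trans (κ-cong (sym ιμ≈δ²)) κ-δ²)
          (λ g≈0 → *-≉0 (*-≉0 (ι≉0 s≉0) (ι≉0 t≉0)) β≉0 (trans (sym (g-st s t)) g≈0)) (isotropic-⟦⟧ s t st≉0)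
              (begin
            g ⟦ μ F.* t , s ⟧              ≈⟨ g-st (μ F.* t) s ⟩
            ι (μ F.* t) * ι s * β          ≈⟨ *-congʳ (*-congʳ (ι.*-homo μ t)) ⟩
            ι μ * ι t * ι s * β
                ≈⟨ solve 4 (λ m t s b → m :* t :* s :* b := m :* (s :* t :* b)) refl _ _ _ _ ⟩
            ι μ * (ι s * ι t * β)          ≈⟨ *-congˡ (g-st s t) ⟨
            ι μ * g ⟦ s , t ⟧              ∎)
        flip : ∀ s t → NonZero² s t → Flip ⟦ s , t ⟧ ⟦ μ F.* t , s ⟧
        flip s t st≉0 = cases s t st≉0 (s F.≟ F.0#) (t F.≟ F.0#)

      -- If g R = e g P, then g is proportional to s² + et². The choice μ = -e comes from (et)² +
      -- es² = e(s² + et²): the map multiplies g by e.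
      half-orthogonal : (∀ s t → NonZero² s t → g ⟦ s , t ⟧ ≉ 0#) → β ≈ 0# → Half l
      half-orthogonal anisotropic β≈0 = flip⇒half l μ μ≉0 (λ s t st≉0 →
        flip-similitude {ι e} {⟦ s , t ⟧} {⟦ μ F.* t , s ⟧} κe≈-1 (anisotropic s t st≉0) (isotropic-⟦⟧ s t st≉0)
            (begin
          g ⟦ μ F.* t , s ⟧                                  ≈⟨ g-st (μ F.* t) s ⟩
          (ι (μ F.* t) * ι (μ F.* t) + ι e * (ι s * ι s)) * gP  ≈⟨ *-congʳ (+-congʳ (*-cong ιμt ιμt)) ⟩
          (- ι e * ι t * (- ι e * ι t) + ι e * (ι s * ι s)) * gP
            ≈⟨ solve 4 (λ e s t g → (:- e :* t :* (:- e :* t) :+ e :* (s :* s)) :* g := e :*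
                ((s :* s :+ e :* (t :* t)) :* g)) refl (ι e) (ι s) (ι t) gP ⟩
          ι e * ((ι s * ι s + ι e * (ι t * ι t)) * gP)       ≈⟨ *-congˡ (g-st s t) ⟨
          ι e * g ⟦ s , t ⟧                                  ∎))
        where
        gP≉0 : gP ≉ 0#
        gP≉0 gP≈0 = anisotropic F.1# F.0# (F.1≉0 ∘ proj₁) (trans (g-cong (≈ᵥ-sym P≈⟦1,0⟧)) gP≈0)
        ratio : ∃[ e ] ι e * gP ≈ gR
        ratio = conj-ratio gP≉0 isotropic-P isotropic-R
        e = proj₁ ratio
        μ = F.- e
        e≉0 : e F.≉ F.0#
        e≉0 e≈0 = anisotropic F.0# F.1# (F.1≉0 ∘ proj₂) (trans (g-cong (≈ᵥ-sym R≈⟦0,1⟧))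
          (trans (sym (proj₂ ratio)) (ι0*x≈0 e≈0)))
        μ≉0 : μ F.≉ F.0#
        μ≉0 μ≈0 = e≉0 (F.trans (F.sym (F.-‿involutive e)) (F.trans (F.-‿cong μ≈0) F.-0#≈0#))
        ιμt : ∀ {t} → ι (μ F.* t) ≈ - ι e * ι t
        ιμt {t} = trans (ι.*-homo μ t) (*-congʳ (ι.-‿homo e))
        g-st : ∀ s t → g ⟦ s , t ⟧ ≈ (ι s * ι s + ι e * (ι t * ι t)) * gP
        g-st s t = begin
          g ⟦ s , t ⟧                                                   ≈⟨ g-⟦⟧ s t ⟩
          ι s * ι s * gP + ι s * ι t * β + ι t * ι t * gR
              ≈⟨ +-cong (trans (+-congˡ (trans (*-congˡ β≈0) (zeroʳ _))) (+-identityʳ _))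
              (*-congˡ (sym (proj₂ ratio))) ⟩
          ι s * ι s * gP + ι t * ι t * (ι e * gP)
              ≈⟨ solve 4 (λ e s t g → s :* s :* g :+ t :* t :* (e :* g) := (s :* s :+ e :* (t :* t)) :* g) refl
              (ι e) (ι s) (ι t) gP ⟩
          (ι s * ι s + ι e * (ι t * ι t)) * gP                          ∎
        -- If e were a square of F, so would be -e = s², and sP + R would be a zero of g.
        κe≉1 : κ (ι e) ≉ 1#
        κe≉1 κe≈1 = anisotropic (proj₁ root) F.1# (F.1≉0 ∘ proj₂)
            (trans (g-st (proj₁ root) F.1#) (trans (*-congʳ (begin
            ι s * ι s + ι e * (ι F.1# * ι F.1#)
                ≈⟨ +-cong (sym (proj₂ root)) (trans (*-congˡ ι1*ι1≈1) (*-identityʳ _)) ⟩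
            - ι e + ι e                           ≈⟨ -‿inverseˡ _ ⟩
            0#                                    ∎)) (zeroˡ gP)))
          where
          -e≉0 : - ι e ≉ 0#
          -e≉0 -e≈0 = ι≉0 μ≉0 (trans (ι.-‿homo e) -e≈0)
          root : ∃[ u ] - ι e ≈ ι u * ι u
          root = κ≈1⇒square -e≉0 (trans (κ-‿ _) κe≈1)
          s = proj₁ root
        κe≈-1 : κ (ι e) ≈ - 1#
        κe≈-1 = Sum.fromInj₂ (⊥-elim ∘ κe≉1) (fixed⇒κ-values (ι≉0 e≉0) (conj-ι e))

  -- Lines on which g vanishes

  other : YZ-Axis → YZ-Axis
  other y-axis = z-axis
  other z-axis = y-axis

  -- For each i these vectors form a copy of K, a plane over F on which g is identically 0.
  OnAxis : YZ-Axis → V → Set ℓ₂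
  OnAxis i v = X v ≈ 0# × yz (other i) v ≈ 0#

  yz-lin : ∀ i s t v w → yz i (lin s t v w) ≈ ι s * yz i v + ι t * yz i w
  yz-lin y-axis = coord-lin y-axis
  yz-lin z-axis = coord-lin z-axis

  private
    combination≈0 : ∀ {s t x y} → x ≈ 0# → y ≈ 0# → s * x + t * y ≈ 0#
    combination≈0 x≈0 y≈0 = trans (+-cong (trans (*-congˡ x≈0) (zeroʳ _)) (trans (*-congˡ y≈0) (zeroʳ _)))
        (+-identityʳ 0#)

  OnAxis-lin : ∀ i {s t v w} → OnAxis i v → OnAxis i w → OnAxis i (lin s t v w)
  OnAxis-lin i {s} {t} {v} {w} (Xv , yzv) (Xw , yzw) =
    trans (coord-lin x-axis s t v w) (combination≈0 Xv Xw) , trans (yz-lin (other i) s t v w)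
        (combination≈0 yzv yzw)

  OnAxis-≈0 : ∀ i {v} → OnAxis i v → yz i v ≈ 0# → v ≈ᵥ 0ᵥ
  OnAxis-≈0 y-axis (X≈0 , Z≈0) Y≈0 = ι≈0⇒≈0 X≈0 , Y≈0 , Z≈0
  OnAxis-≈0 z-axis (X≈0 , Y≈0) Z≈0 = ι≈0⇒≈0 X≈0 , Y≈0 , Z≈0

  OnAxis-g : ∀ i {v} → OnAxis i v → g v ≈ 0#
  OnAxis-g i {v} (X≈0 , other≈0) = trans
      (+-cong (product i other≈0) (trans (*-congˡ (trans (*-congˡ X≈0) (zeroʳ _))) (zeroʳ ½))) (+-identityʳ 0#)
    where
    product : ∀ i → yz (other i) v ≈ 0# → Y v * Z v ≈ 0#
    product y-axis Z≈0 = trans (*-congˡ Z≈0) (zeroʳ _)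
    product z-axis Y≈0 = trans (*-congʳ Y≈0) (zeroˡ _)

  OnAxis-D : ∀ i {v} → OnAxis i v → (D v → η (yz i v) ≉ - 1#) × (η (yz i v) ≉ - 1# → D v)
  OnAxis-D i {v} on@(_ , other≈0) =
    Sum.[ (λ κ≈I → ⊥-elim (κ≈I⇒≉0 κ≈I (OnAxis-g i {v} on))) , (λ (_ , ηY , ηZ) → pick i ηY ηZ) ] ,
        (λ η≉ → inj₂ (OnAxis-g i {v} on , both i η≉ other≈0))
    where
    pick : ∀ i → η (Y v) ≉ - 1# → η (Z v) ≉ - 1# → η (yz i v) ≉ - 1#
    pick y-axis ηY _ = ηY
    pick z-axis _ ηZ = ηZ
    both : ∀ i → η (yz i v) ≉ - 1# → yz (other i) v ≈ 0# → η (Y v) ≉ - 1# × η (Z v) ≉ - 1#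
    both y-axis ηY Z≈0 = ηY , η-0≉-1 Z≈0
    both z-axis ηZ Y≈0 = η-0≉-1 Y≈0 , ηZ

  -- δ is a nonsquare of K, so multiplication by it changes the sign of `η`.
  flip-axis : ∀ i {v w} → OnAxis i v → OnAxis i w → yz i v ≉ 0# → yz i w ≈ δ * yz i v → Flip v w
  flip-axis i {v} {w} onv onw yzv≉0 yzw≈ =
    (λ Dv Dw → proj₁ (OnAxis-D i {w} onw) Dw
        (trans ηw≈ (trans (*-congˡ (η≉-1⇒η≈1 yzv≉0 (proj₁ (OnAxis-D i {v} onv) Dv))) (*-identityʳ _)))) ,
    (λ ¬Dv → proj₂ (OnAxis-D i {w} onw) (λ ηw≈-1 → ¬Dv (proj₂ (OnAxis-D i {v} onv) (λ ηv≈-1 →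
      1≉-1 (trans (sym -1*-1≈1) (trans (*-congˡ (sym ηv≈-1)) (trans (sym ηw≈) ηw≈-1)))))))
    where
    ηw≈ : η (yz i w) ≈ - 1# * η (yz i v)
    ηw≈ = trans (η-cong yzw≈) (trans (η-* δ _) (*-congʳ (anti⇒η≈-1 δ≉0 conj-δ)))

  -- In the F-basis u, δu the matrix with μ = δ² is multiplication by δ.
  half-axis-δ : ∀ i l → OnAxis i (vec (Line.P l)) → OnAxis i (vec (Line.R l)) →
    yz i (vec (Line.R l)) ≈ δ * yz i (vec (Line.P l)) → Half l
  half-axis-δ i l onP onR R≈δP = flip⇒half l μ μ≉0 λ s t st≉0 →
    flip-axis i {⟦ s , t ⟧} {⟦ μ F.* t , s ⟧} (on s t) (on (μ F.* t) s)
        (λ yz≈0 → st≉0 (independent (OnAxis-≈0 i {⟦ s , t ⟧} (on s t) yz≈0))) (begin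
      yz i ⟦ μ F.* t , s ⟧              ≈⟨ yz-lin i (μ F.* t) s (vec P) (vec R) ⟩
      ι (μ F.* t) * u + ι s * yz i (vec R)
          ≈⟨ +-cong (*-congʳ (trans (ι.*-homo μ t) (*-congʳ (sym (proj₂ ν))))) (*-congˡ R≈δP) ⟩
      δ * δ * ι t * u + ι s * (δ * u)
          ≈⟨ solve 4 (λ d s t u → d :* d :* t :* u :+ s :* (d :* u) := d :* (s :* u :+ t :* (d :* u))) refl δ
          (ι s) (ι t) u ⟩
      δ * (ι s * u + ι t * (δ * u))
          ≈⟨ *-congˡ (trans (yz-lin i s t (vec P) (vec R)) (+-congˡ (*-congˡ R≈δP))) ⟨
      δ * yz i ⟦ s , t ⟧                ∎)
    where
    open Basis l
    μ = proj₁ ν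
    u = yz i (vec P)
    μ≉0 : μ F.≉ F.0#
    μ≉0 μ≈0 = *-≉0 δ≉0 δ≉0 (trans (proj₂ ν) (trans (ι.⟦⟧-cong μ≈0) ι.0#-homo))
    on : ∀ s t → OnAxis i ⟦ s , t ⟧
    on s t = OnAxis-lin i {s} {t} {vec P} {vec R} onP onR

  -- Writing w/u = a + bδ and replacing R by b⁻¹(R - aP) produces the basis u, δu.
  half-axis : ∀ i l → OnAxis i (vec (Line.P l)) → OnAxis i (vec (Line.R l)) → Half l
  half-axis i l onP onR =
    let a , b , ρ≈ = decompose (w * u ⁻¹)
        w≈ : w ≈ (ι a + ι b * δ) * u
        w≈ = trans (sym (trans (*-assoc _ _ _) (trans (*-congˡ (⁻¹-inverseˡ u≉0)) (*-identityʳ w))))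
            (*-congʳ ρ≈)
    in finish a b w≈
    where
    open Basis l
    u = yz i (vec P)
    w = yz i (vec R)
    u≉0 : u ≉ 0#
    u≉0 u≈0 = vec≉0 P (OnAxis-≈0 i {vec P} onP u≈0)
    finish : ∀ a b → w ≈ (ι a + ι b * δ) * u → Half l
    finish a b w≈ = half-shear l α β≉0
        (half-axis-δ i (shear-line l α β≉0) onP (OnAxis-lin i {α} {β} {vec P} {vec R} onP onR)
        (*-cancelˡ-≉0 (ι≉0 b≉0) (begin
        ι b * yz i ⟦ α , β ⟧                        ≈⟨ *-congˡ (yz-lin i α β (vec P) (vec R)) ⟩
        ι b * (ι α * u + ι β * w)                   ≈⟨ *-congˡ (+-congˡ (*-congˡ w≈)) ⟩
        ι b * (ι α * u + ι β * ((ι a + ι b * δ) * u))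
            ≈⟨ *-congˡ (+-congʳ (*-congʳ (trans (ι.-‿homo _) (-‿cong (ι.*-homo β a))))) ⟩
        ι b * (- (ι β * ι a) * u + ι β * ((ι a + ι b * δ) * u))
            ≈⟨ solve 5 (λ b c a d u → b :* (:- (c :* a) :* u :+ c :* ((a :+ b :* d) :* u)) := (b :* c) :*
            (b :* (d :* u))) refl (ι b) (ι β) (ι a) δ u ⟩
        ι b * ι β * (ι b * (δ * u))
            ≈⟨ *-congʳ (trans (sym (ι.*-homo b β)) (trans (ι.⟦⟧-cong (F.⁻¹-inverseʳ b≉0)) ι.1#-homo)) ⟩
        1# * (ι b * (δ * u))                        ≈⟨ *-identityˡ _ ⟩
        ι b * (δ * u)                               ∎)))
      where
      -- With b = 0 one would have aP - R = 0, against independence.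
      b≉0 : b F.≉ F.0#
      b≉0 b≈0 = F.1≉0 (F.trans (F.sym (F.-‿involutive F.1#))
          (F.trans (F.-‿cong (proj₂ (independent {a} {F.- F.1#} (OnAxis-≈0 i {⟦ a , F.- F.1# ⟧}
        (OnAxis-lin i {a} {F.- F.1#} {vec P} {vec R} onP onR) (begin
          yz i ⟦ a , F.- F.1# ⟧                 ≈⟨ yz-lin i a (F.- F.1#) (vec P) (vec R) ⟩
          ι a * u + ι (F.- F.1#) * w
              ≈⟨ +-congˡ (trans (*-cong (trans (ι.-‿homo _) (-‿cong ι.1#-homo)) w≈)
              (trans (sym (-‿distribˡ-* _ _)) (-‿cong (*-identityˡ _)))) ⟩
          ι a * u - (ι a + ι b * δ) * u
              ≈⟨ +-congˡ (-‿cong (*-congʳ (trans (+-congˡ (ι0*x≈0 b≈0)) (+-identityʳ _)))) ⟩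
          ι a * u - ι a * u                     ≈⟨ -‿inverseʳ _ ⟩
          0#                                    ∎))))) F.-0#≈0#))
      β = b F.⁻¹
      β≉0 : β F.≉ F.0#
      β≉0 = F.x⁻¹≉0 b≉0
      α = F.- (β F.* a)

  module _ (l : Line) where

    open Basis l

    private
      v = vec P
      w = vec R

    -- For B = 0, `yzyzB-identity` says that the squares of the minors of v and w formed from x and
    -- one other coordinate vanish. These minors are the coordinates of a combination of v and w
    -- with coefficients from their x coordinates, so independence gives x = 0. Then yz = 0 on each
    -- vector, and B = 0 puts both on the same axis.
    half-singular : g v ≈ 0# → g w ≈ 0# → B v w ≈ 0# → Half l
    half-singular gv≈0 gw≈0 B≈0 = cases (Y v ≟ 0#) (Z v ≟ 0#)
      where
      minor : ∀ i → X v * yz i w ≈ X w * yz i v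
      minor i = x-y≈0⇒x≈y _ _ (square≈0
          (x*y≈0⇒y≈0 -½≉0 (trans (sym (yzyzB-identity i v w gv≈0 gw≈0)) (trans (*-congˡ B≈0) (zeroʳ _)))))
      dependent : ⟦ proj₁ w , F.- proj₁ v ⟧ ≈ᵥ 0ᵥ
      dependent = coord-injective {⟦ proj₁ w , F.- proj₁ v ⟧} {0ᵥ} λ i → trans (coord-⟦⟧ i _ _)
          (trans (+-congˡ (*-congʳ (ι.-‿homo _)))
        (trans (trans (+-congˡ (sym (-‿distribˡ-* _ _))) (x≈y⇒x-y≈0 (sym (minor′ i)))) (sym (coord-0 i))))
        where
        minor′ : ∀ i → X v * coord i w ≈ X w * coord i v
        minor′ x-axis = *-comm _ _
        minor′ y-axis = minor y-axis
        minor′ z-axis = minor z-axis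
      Xw≈0 : X w ≈ 0#
      Xw≈0 = trans (ι.⟦⟧-cong (proj₁ (independent dependent))) ι.0#-homo
      Xv≈0 : X v ≈ 0#
      Xv≈0 = trans (ι.⟦⟧-cong (F.trans (F.sym (F.-‿involutive _))
          (F.trans (F.-‿cong (proj₂ (independent dependent))) F.-0#≈0#))) ι.0#-homo
      YZ≈0 : ∀ {v} → X v ≈ 0# → g v ≈ 0# → Y v * Z v ≈ 0#
      YZ≈0 {v} Xv≈0 gv≈0 = trans (sym (x≈0⇒g≈ {v} (ι≈0⇒≈0 Xv≈0))) gv≈0
      YZ+YZ≈0 : Y v * Z w + Y w * Z v ≈ 0#
      YZ+YZ≈0 = trans (sym (trans (+-congˡ (trans (*-congˡ (trans (*-congʳ Xv≈0) (zeroˡ _))) (zeroʳ _)))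
          (+-identityʳ _))) B≈0
      cases : Dec (Y v ≈ 0#) → Dec (Z v ≈ 0#) → Half l
      cases (yes Y≈0) (yes Z≈0) = ⊥-elim (vec≉0 P (ι≈0⇒≈0 Xv≈0 , Y≈0 , Z≈0))
      cases (no Y≉0) _ = half-axis y-axis l (Xv≈0 , Zv≈0) (Xw≈0 ,
          x*y≈0⇒y≈0 Y≉0 (trans (sym (+-identityʳ _))
              (trans (+-congˡ (sym (trans (*-congˡ Zv≈0) (zeroʳ _)))) YZ+YZ≈0)))
        where
        Zv≈0 : Z v ≈ 0#
        Zv≈0 = x*y≈0⇒y≈0 Y≉0 (YZ≈0 {v} Xv≈0 gv≈0)
      cases (yes Yv≈0) (no Z≉0) = half-axis z-axis l (Xv≈0 , Yv≈0) (Xw≈0 ,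
          x*y≈0⇒y≈0 Z≉0 (trans (*-comm _ _)
              (trans (sym (+-identityˡ _)) (trans (+-congʳ (sym (trans (*-congʳ Yv≈0) (zeroˡ _)))) YZ+YZ≈0))))

    isotropic-shear : ∀ α {β} (β≉0 : β F.≉ F.0#) → IsotropicLine l → IsotropicLine (shear-line l α β≉0)
    isotropic-shear α β≉0 iso X X∈ = iso X (shear-⊇ l α β≉0 {X} X∈)

    -- If B ≠ 0, then e = -g R / B makes eP + R a second zero of g. If B = 0, `singular-radical`
    -- shows that g vanishes at R too.
    half-isotropic : IsotropicLine l → g v ≈ 0# → Half l
    half-isotropic iso gv≈0 = cases (B v w ≟ 0#)
      where
      cases : Dec (B v w ≈ 0#) → Half l
      cases (yes B≈0) = half-singular gv≈0 (singular-radical (vec≉0 P) gv≈0 B≈0 (isotropic-R l iso)) B≈0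
      cases (no  B≉0) = half-shear l e F.1≉0
          (half-hyperbolic (shear-line l e F.1≉0) (isotropic-shear e F.1≉0 iso) gv≈0 gR′≈0 B′≉0)
        where
        ratio : ∃[ e ] ι e * B v w ≈ - g w
        ratio = conj-ratio B≉0 (conj-β l iso) (anti-‿ (isotropic-R l iso))
        e = proj₁ ratio
        gR′≈0 : g ⟦ e , F.1# ⟧ ≈ 0#
        gR′≈0 = begin
          g ⟦ e , F.1# ⟧          ≈⟨ g-⟦⟧ l e F.1# ⟩
          ι e * ι e * g v + ι e * ι F.1# * B v w + ι F.1# * ι F.1# * g w
            ≈⟨ +-cong (+-cong (trans (*-congˡ gv≈0) (zeroʳ _))
                (trans (*-congʳ (trans (*-congˡ ι.1#-homo) (*-identityʳ _))) (proj₂ ratio)))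
                 (trans (*-congʳ ι1*ι1≈1) (*-identityˡ _)) ⟩
          0# - g w + g w          ≈⟨ trans (+-congʳ (+-identityˡ _)) (-‿inverseˡ _) ⟩
          0#                      ∎
        B′≉0 : B v ⟦ e , F.1# ⟧ ≉ 0#
        B′≉0 B′≈0 = B≉0 (begin
          B v w
              ≈⟨ trans (+-cong (trans (*-congˡ (trans (+-cong gv≈0 gv≈0) (+-identityʳ 0#))) (zeroʳ _)) ι1*x≈x)
              (+-identityˡ _) ⟨
          ι e * (g v + g v) + ι F.1# * B v w     ≈⟨ B-lin e F.1# v w ⟨
          B v ⟦ e , F.1# ⟧                       ≈⟨ B′≈0 ⟩
          0#                                     ∎)

    -- The coefficient e = -B / (2 g P) makes eP + R orthogonal to P, and g P is nonzero by
    -- anisotropy.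
    half-anisotropic : IsotropicLine l → (∀ X → X ∈ pointsOf l → g (vec X) ≉ 0#) → Half l
    half-anisotropic iso anisotropic = half-shear l e F.1≉0 (half-orthogonal l′ (isotropic-shear e F.1≉0 iso)
        (λ s t st≉0 → anisotropic (Basis.point l′ s t st≉0)
            (shear-⊇ l e F.1≉0 {Basis.point l′ s t st≉0} (s , t , ≈ᵥ-refl))) B′≈0)
      where
      gv≉0 : g v ≉ 0#
      gv≉0 = anisotropic P (F.1# , F.0# , P≈⟦1,0⟧)
      iso-v = isotropic-P l iso
      ratio : ∃[ e ] ι e * (g v + g v) ≈ - B v w
      ratio = conj-ratio (gv≉0 ∘ x+x≈0⇒x≈0) (anti-+ iso-v iso-v) (anti-‿ (conj-β l iso))
      e = proj₁ ratio
      l′ = shear-line l e F.1≉0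
      B′≈0 : B v ⟦ e , F.1# ⟧ ≈ 0#
      B′≈0 = trans (B-lin e F.1# v w) (trans (+-cong (proj₂ ratio) ι1*x≈x) (-‿inverseˡ _))

  -- The general line and the theorem

  half-line : ∀ l → IsotropicLine l → Half l
  -- The points of the line are P and the sP + R with s in F, so a finite search either finds a zero
  -- of g or excludes all of them.
  half-line l iso = cases (g (vec P) ≟ 0#) (Fin.any? (λ i → g ⟦ Inverse.from F.finite i , F.1# ⟧ ≟ 0#))
    where
    open Basis l
    cases : Dec (g (vec P) ≈ 0#) → Dec (∃[ i ] g ⟦ Inverse.from F.finite i , F.1# ⟧ ≈ 0#) → Half l
    cases (yes gP≈0) _ = half-isotropic l iso gP≈0
    -- The shear makes the zero sP + R the second basis point, and the swap makes it the first.
    cases (no gP≉0) (yes (i , g≈0)) = half-shear l s F.1≉0 (half-swap l₁ (half-isotropic (swap-line l₁)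
        (λ X X∈ → isotropic-shear l s F.1≉0 iso X (swap-⊇ l₁ {X} X∈)) g≈0))
      where
      s = Inverse.from F.finite i
      l₁ = shear-line l s F.1≉0
    cases (no gP≉0) (no none) = half-anisotropic l iso (λ X (s , t , X≈) g≈0 → lemma X s t X≈ g≈0 (t F.≟ F.0#))
      where
      lemma : ∀ X s t → vec X ≈ᵥ ⟦ s , t ⟧ → g (vec X) ≈ 0# → Dec (t F.≈ F.0#) → ⊥
      lemma X s t X≈ g≈0 (yes t≈0) = *-≉0 (*-≉0 (ι≉0 s≉0) (ι≉0 s≉0)) gP≉0 (trans (sym (g-· s (vec P)))
          (trans (g-cong (≈ᵥ-trans (≈ᵥ-sym (⟦s,0⟧ s t≈0)) (≈ᵥ-sym X≈))) g≈0))
        where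
        s≉0 : s F.≉ F.0#
        s≉0 s≈0 = coordinates≉0 X {s} {t} X≈ (s≈0 , t≈0)
      lemma X s t X≈ g≈0 (no t≉0) = none (Inverse.to F.finite s′ , (begin
          g ⟦ Inverse.from F.finite (Inverse.to F.finite s′) , F.1# ⟧
              ≈⟨ g-cong (⟦⟧-cong (Inverse.inverseʳ F.finite ≡.refl) (F.sym (F.⁻¹-inverseˡ t≉0))) ⟩
          g ⟦ s′ , t F.⁻¹ F.* t ⟧                    ≈⟨ g-cong (≈ᵥ-sym (·-⟦⟧ (t F.⁻¹) s t)) ⟩
          g (t F.⁻¹ · ⟦ s , t ⟧)                     ≈⟨ g-cong (·-cong F.refl (≈ᵥ-sym X≈)) ⟩
          g (t F.⁻¹ · vec X)                         ≈⟨ g-· (t F.⁻¹) (vec X) ⟩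
          ι (t F.⁻¹) * ι (t F.⁻¹) * g (vec X)        ≈⟨ trans (*-congˡ g≈0) (zeroʳ _) ⟩
          0#                                         ∎))
        where s′ = t F.⁻¹ F.* s

  ℳ-isOvoid : IsOvoid (suc q / 2) ℳ
  ℳ-isOvoid = record
    { positive = ≡.subst (0 ℕ.<_) (≡.sym (Exponents.m≡1+h E)) ℕ.z<s
    ; respects = λ {P} {R} P∼R P∈ℳ → Inv⇒ℳ R (Inv-∼ {R} {P} (∼-sym {P} {R} P∼R) (ℳ⇒Inv {P} P∈ℳ))
    ; onQ4 = λ {P} P∈ℳ → isotropic⇒f≈0 (vec P) (proj₁ (ℳ⇒Inv {P} P∈ℳ))
    ; meets = λ l l⊆Q4 → cardinality-via {S = restrict (pointsOf l ∩ ℳ)} {T = restrict (pointsOf l ∩ (D ∘ vec))}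
        (Sub-cong PG {P = pointsOf l ∩ ℳ} {R = pointsOf l ∩ (D ∘ vec)}
          (λ {X} (X∈l , X∈ℳ) → X∈l , proj₂ (ℳ⇒Inv {X} X∈ℳ))
          (λ {X} (X∈l , DX) → X∈l , Inv⇒ℳ X (f≈0⇒isotropic (vec X) (l⊆Q4 {X} X∈l) , DX)))
        (half-line l (λ X X∈l → f≈0⇒isotropic (vec X) (l⊆Q4 {X} X∈l))) }

open import Data.Nat.Base using (_^_; _<_)

theorem5 :
  ∀ {c₁ ℓ₁ c₂ ℓ₂ a : Level} (p k q : ℕ) → Prime p → 0 < k → q ≡ p ^ k → q % 4 ≡ 1 →
  (F : FiniteField c₁ ℓ₁ q) (K : FiniteField c₂ ℓ₂ (q ^ 2)) →
  (ι : FiniteField.Carrier F → FiniteField.Carrier K) →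
  (ι-hom : IsRingHomomorphism (FiniteField.rawRing F) (FiniteField.rawRing K) ι) →
  (γ : FiniteField.Carrier K) → FiniteField.IsPrimitive K γ →
  (C₀ : ℕ → Pred (FiniteField.Carrier K) a) →
  (∀ e → e ∣ q ^ 2 ∸ 1 → FiniteField.IsSubgroupOfIndex K e (C₀ e)) →
  let open Geometry q F K ι ι-hom
      open Construction γ C₀
  in IsOvoid (suc q / 2) ℳ
theorem5 p k q p-prime 0<k q≡p^k q%4≡1 F K ι ι-hom γ γ-primitive C₀ C₀-index =
  Quadric.ℳ-isOvoid p k p-prime q≡p^k (exponents q%4≡1 q≢1) F K ι ι-hom γ γ-primitive C₀ C₀-index
  where
  q≢1 : ¬ q ≡ 1
  q≢1 q≡1 = ℕ.<⇒≢ (ℕ.^-monoʳ-< p (ℕ.nonTrivial⇒n>1 p {{prime⇒nonTrivial p-prime}}) 0<k)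
      (≡.sym (≡.trans (≡.sym q≡p^k) q≡1))
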